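{- Assume $G$ has at least one perfect matching. Then there exists a weight function $w\in\mathcal{W}^{(\log_2 n+1)\log_2 n}$ such that $\mathrm{Min}(\mathrm{PM},w)$ consists of a single point (equivalently, $G$ has a unique perfect matching of minimum $w$-weight).
   Context: $G=(V,E)$ is a fixed undirected simple graph with $n$ vertices, where $n$ is assumed sufficiently large and $\log_2 n$ is assumed to be an integer (otherwise it stands for $\lceil\log_2 n\rceil$). $\mathrm{PM}\subseteq\mathbb{R}^E$ is the perfect matching polytope of $G$, the convex hull of the indicator vectors of all perfect matchings of $G$. For a subset $F\subseteq \mathrm{PM}$ and $w:E\to\mathbb{R}$, $\mathrm{Min}(F,w)=\arg\min\{\langle w,x\rangle : x\in F\}$. Weight functions: number the edges $E=\{e_1,\dots,e_{|E|}\}$ in an arbitrary fixed way. For an integer $t\ge 7$ let $\mathcal{W}(t)=\{w_k : k=2,\dots,t\}$ where $w_k:E\to\mathbb{Z}$ is $w_k(e_j)=(4n^2+1)^j \bmod k$. Let $\mathcal{W}=\mathcal{W}(n^{20})$. For $w:E\to\mathbb{Z}$ and $w'\in\mathcal{W}$ define the concatenation $w\circ w'=n^{21}w+w'$. For $k\ge1$, $\mathcal{W}^k$ is the set of all functions $(\cdots((w_1\circ w_2)\circ w_3)\cdots)\circ w_k$ with $w_1,\dots,w_k\in\mathcal{W}$. -}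

module Defs where

open import Data.Nat using (ℕ; zero; suc; _+_; _*_; _^_; _≤_)
open import Data.Nat.DivMod using (_%_)
open import Data.Fin using (Fin; toℕ; _≟_)
open import Data.Bool using (Bool; true; false; _∧_; _∨_; if_then_else_)
open import Data.Vec using (Vec; lookup)
open import Data.List using (List; []; _∷_)
open import Data.Product using (Σ; _×_; _,_; proj₁; proj₂)
open import Data.Sum using (_⊎_)
open import Relation.Nullary using (¬_)
open import Relation.Nullary.Decidable using (⌊_⌋)
open import Relation.Binary.PropositionalEquality using (_≡_)

sumFin : {m : ℕ} → (Fin m → ℕ) → ℕ
sumFin {zero}  f = 0
sumFin {suc m} f = f Fin.zero + sumFin (λ i → f (Fin.suc i))

-- A simple undirected graph on vertex set Fin n with m edges, numbered
-- e_1, ..., e_m by the index Fin m (index i is edge e_{toℕ i + 1}).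
-- The numbering is arbitrary: the theorem quantifies over all such graphs.
record Graph (n : ℕ) : Set where
  field
    m        : ℕ
    ends     : Fin m → Fin n × Fin n
    loopless : ∀ i → ¬ (proj₁ (ends i) ≡ proj₂ (ends i))
    noMulti  : ∀ i j →
               ((proj₁ (ends i) ≡ proj₁ (ends j) × proj₂ (ends i) ≡ proj₂ (ends j)) ⊎
                (proj₁ (ends i) ≡ proj₂ (ends j) × proj₂ (ends i) ≡ proj₁ (ends j))) →
               i ≡ j

open Graph public

EdgeSet : {n : ℕ} → Graph n → Set
EdgeSet G = Vec Bool (m G)

incident : {n : ℕ} (G : Graph n) → Fin n → Fin (m G) → Bool
incident G v i = ⌊ v ≟ proj₁ (ends G i) ⌋ ∨ ⌊ v ≟ proj₂ (ends G i) ⌋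

degIn : {n : ℕ} (G : Graph n) → EdgeSet G → Fin n → ℕ
degIn G M v = sumFin (λ i → if lookup M i ∧ incident G v i then 1 else 0)

IsPerfectMatching : {n : ℕ} (G : Graph n) → EdgeSet G → Set
IsPerfectMatching G M = ∀ v → degIn G M v ≡ 1

weight : {n : ℕ} (G : Graph n) → (Fin (m G) → ℕ) → EdgeSet G → ℕ
weight G w M = sumFin (λ i → if lookup M i then w i else 0)

UniqueMinPM : {n : ℕ} (G : Graph n) → (Fin (m G) → ℕ) → Set
UniqueMinPM G w =
  Σ (EdgeSet G) (λ M → IsPerfectMatching G M ×
     (∀ M' → IsPerfectMatching G M' → weight G w M ≤ weight G w M') ×
     (∀ M' → IsPerfectMatching G M' → weight G w M' ≤ weight G w M → M' ≡ M))

-- The basic weight w_k : e_j ↦ (4n²+1)^j mod k  (only used for k ≥ 2;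
-- the value for k = 0 is an irrelevant dummy).
wk : (n : ℕ) {m : ℕ} → ℕ → Fin m → ℕ
wk n zero    e = 0
wk n (suc k) e = ((4 * n ^ 2 + 1) ^ (toℕ e + 1)) % suc k

-- concatenation w ∘ w_k = n^21 * w + w_k, iterated along a list of moduli
concatW : (n : ℕ) {m : ℕ} → (Fin m → ℕ) → List ℕ → (Fin m → ℕ)
concatW n w []       = w
concatW n w (k ∷ ks) = concatW n (λ e → n ^ 21 * w e + wk n k e) ks

-- the element (...((w_{k₀} ∘ w_{k₁}) ∘ w_{k₂}) ...) ∘ w_{k_r} of W^{r+1}
iterW : (n : ℕ) {m : ℕ} → ℕ → List ℕ → (Fin m → ℕ)
iterW n k₀ ks = concatW n (wk n k₀) ks

-- k is a valid modulus for 𝒲 = 𝒲(n^20), i.e. 2 ≤ k ≤ n^20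
ValidModulus : ℕ → ℕ → Set
ValidModulus n k = 2 ≤ k × k ≤ n ^ 20

{-# OPTIONS --safe #-}

-- The argument of Svensson and Tarnawski, with polytopes replaced by minimum-weight perfect matchings.
-- A face is the set of minimisers of the weight built so far; it comes with a maximal laminar family of
-- tight sets, the odd sets that every minimiser leaves exactly once.  Maximal tight sets with at most ℓ
-- vertices are contracted to nodes; walks between nodes avoid the edges leaving larger tight sets.  The
-- invariant at level ℓ says that tight sets of size ≤ ℓ are contractible (the edge leaving the set determines
-- the matching inside) and that every closed alternating walk through nodes of total size ≤ ℓ cancels.
--
-- One modulus gives nonzero weight to any prescribed list of polynomially many nonzero vectors, since a
-- number divisible by all k ≤ t is at least 2^(t/2).  Cutting a walk of size ≤ 2ℓ into four pieces shows
-- that, given the invariant, there are only polynomially many different walks of size ≤ 2ℓ.  The tight sets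
-- with more than ℓ and at most 2ℓ vertices form disjoint chains; they become contractible after one modulus
-- for the consecutive segments of the chains and log₂ ℓ moduli doubling the length of the determined
-- segments.  One more modulus kills the walks of size ≤ 2ℓ, which gives the invariant at level 2ℓ.  Hence
-- log₂ n + 1 moduli suffice per level, and at level n the minimiser is unique.
--
-- A walk that survives in the new face lifts to a vector balanced on its tight sets.  Such a vector is
-- orthogonal to the weight: this is the Cunningham–Marsh duality for maximum-weight matchings, proved here by
-- Schrijver's induction on the weight together with Lovász's exchange argument.
module Submission where

open import Defs
open import Data.Nat as ℕ using (ℕ; zero; suc; z≤n; s≤s; _+_; _*_; _∸_; _^_; _⊓_; _≤_; _<_; _≥_; NonZero; ⌈_/2⌉; ⌊_/2⌋)
import Data.Nat.Properties as ℕ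
open import Data.Nat.Divisibility using (_∣_; divides; _∣?_; ∣m+n∣m⇒∣n; *-cancelˡ-∣; ∣n⇒∣m*n; ∣m⇒∣m*n; ∣⇒≤; 1∣_)
open import Data.Nat.DivMod using (_%_; _/_; m≡m%n+[m/n]*n; m%n<n)
open import Data.Nat.Induction using (<-rec)
open import Data.Nat.ListAction using (product)
open import Data.Nat.Logarithm using (⌈log₂_⌉; ⌈log₂⌉-mono-≤; ⌈log₂2^n⌉≡n; ⌈log₂⌈n/2⌉⌉≡⌈log₂n⌉∸1)
open import Data.Nat.Tactic.RingSolver using () renaming (solve-∀ to solve-ℕ)
open import Data.Integer as ℤ using (ℤ; 0ℤ; ∣_∣; _-_)
import Data.Integer.Properties as ℤ
open import Data.Integer.Tactic.RingSolver using () renaming (solve-∀ to solve-ℤ)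
open import Data.Fin as Fin using (Fin; zero; suc; _≟_; toℕ)
open import Data.Fin.Properties using (any?; all?; suc-injective; injective⇒≤; combine-injective)
open import Data.Bool as Bool using (Bool; true; false; _∧_; _∨_; not; _xor_; if_then_else_)
open import Data.Bool.Properties using (not-involutive)
open import Data.Maybe using (Maybe; just; nothing)
open import Data.Product using (Σ; ∃; _×_; _,_; proj₁; proj₂)
open import Data.Sum using (_⊎_; inj₁; inj₂)
open import Data.Empty using (⊥; ⊥-elim)
open import Data.Unit using (tt)
open import Data.List using (List; []; _∷_; _++_; [_]; length; map; allFin; upTo; replicate; cartesianProductWith)
open import Data.List.Properties using (length-map; length-++; length-tabulate; length-upTo; length-replicate; ++-identityʳ)
open import Data.List.Membership.Propositional using (_∈_; find)
open import Data.List.Membership.Propositional.Properties using (∈-++⁺ˡ; ∈-++⁺ʳ; ∈-++⁻; ∈-map⁺; ∈-map⁻; ∈-allFin; ∈-upTo⁺; ∈-cartesianProductWith⁺; ∈-cartesianProductWith⁻)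
open import Data.List.Relation.Unary.Any as Any using (here; there)
open import Data.List.Relation.Unary.All as All using (All; []; _∷_)
open import Data.List.Relation.Unary.All.Properties using (++⁺; replicate⁺)
open import Data.Vec using (lookup; tabulate)
open import Data.Vec.Properties using (lookup∘tabulate; tabulate∘lookup; tabulate-cong)
open import Function using (_∘_)
open import Relation.Nullary using (¬_; Dec; yes; no)
open import Relation.Nullary.Decidable using (⌊_⌋; map′; _×-dec_; _⊎-dec_; ¬?; decidable-stable)
open import Relation.Binary.PropositionalEquality using (_≡_; _≢_; _≗_; refl; sym; trans; cong; cong₂; subst; module ≡-Reasoning)
open import Algebra.Structures using (IsCommutativeSemiring)

-- No contraction is carried out on the graph. The nodes are the classes of a relation `nd`, and
-- each edge of a walk is completed by the matching inside the two nodes that it touches (`vec`);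
-- contractibility makes this completion unambiguous. Hence the order within a level: tight sets of
-- size up to 2ℓ must be contractible before walks of size 2ℓ through them can be given vectors and
-- removed. A modulus removes two kinds of vectors. Differences of two minimisers have weight 0
-- because minimisers weigh the same, and this is enough for contracting tight sets. A closed walk
-- surviving in the new face need not be such a difference; only for these is duality needed.
-- `Kills` records both kinds. A whole chain of tight sets cannot be handled by one modulus, since
-- the choices of crossing edges at all its members may be exponentially many. A doubling step looks
-- at three members at a time, so its vectors are indexed by four crossing edges: one at each outer
-- set and two at the middle one.

∧-true : ∀ {a b} → a ∧ b ≡ true → a ≡ true × b ≡ true
∧-true {true} {true} _ = refl , refl

∧-intro : ∀ {a b} → a ≡ true → b ≡ true → a ∧ b ≡ true
∧-intro refl refl = refl

∨-true : ∀ {a b} → a ∨ b ≡ true → a ≡ true ⊎ b ≡ true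
∨-true {true}  _ = inj₁ refl
∨-true {false} p = inj₂ p

∨-introˡ : ∀ {a b} → a ≡ true → a ∨ b ≡ true
∨-introˡ refl = refl

∨-introʳ : ∀ {a b} → b ≡ true → a ∨ b ≡ true
∨-introʳ {true}  refl = refl
∨-introʳ {false} refl = refl

true≢false : ∀ {a} → a ≡ true → a ≡ false → ⊥
true≢false refl ()

¬true : ∀ {a} → ¬ a ≡ true → a ≡ false
¬true {true}  h = ⊥-elim (h refl)
¬true {false} h = refl

iff→≡ : ∀ {a b} → (a ≡ true → b ≡ true) → (b ≡ true → a ≡ true) → a ≡ b
iff→≡ {true}          f g = sym (f refl)
iff→≡ {false} {true}  f g = g refl
iff→≡ {false} {false} f g = refl

bool : (a : Bool) → a ≡ true ⊎ a ≡ false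
bool true  = inj₁ refl
bool false = inj₂ refl

≟-refl : ∀ {n} (v : Fin n) → ⌊ v ≟ v ⌋ ≡ true
≟-refl v with v ≟ v
... | yes _ = refl
... | no ¬p = ⊥-elim (¬p refl)

≟-true : ∀ {n} {u v : Fin n} → ⌊ u ≟ v ⌋ ≡ true → u ≡ v
≟-true {u = u} {v} p with u ≟ v
... | yes q = q

≟-false : ∀ {n} {u v : Fin n} → u ≢ v → ⌊ u ≟ v ⌋ ≡ false
≟-false {u = u} {v} p with u ≟ v
... | yes q = ⊥-elim (p q)
... | no _  = refl

-- Deciding statements about all subsets

Respects≗ : ∀ {k} → ((Fin k → Bool) → Set) → Set
Respects≗ P = ∀ {f g} → f ≗ g → P f → P g

private
  cons : ∀ {k} → Bool → (Fin k → Bool) → Fin (suc k) → Bool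
  cons b f zero    = b
  cons b f (suc i) = f i

  cons-cong : ∀ {k} b {f g : Fin k → Bool} → f ≗ g → cons b f ≗ cons b g
  cons-cong b e zero    = refl
  cons-cong b e (suc i) = e i

  uncons : ∀ {k} (f : Fin (suc k) → Bool) → f ≗ cons (f zero) (f ∘ suc)
  uncons f zero    = refl
  uncons f (suc i) = refl

opaque
  -- Splitting a subset at its first element recovers it only pointwise, so a property can be
  -- searched exhaustively only if it is invariant under `≗`.
  anyFun? : ∀ {k} {P : (Fin k → Bool) → Set} → Respects≗ P → (∀ f → Dec (P f)) → Dec (∃ P)
  anyFun? {zero} resp d = map′ (_ ,_) (λ { (f , p) → resp (λ ()) p }) (d (λ ()))
  anyFun? {suc k} {P} resp d with anyFun? {P = λ f → P (cons true f)} (λ e → resp (cons-cong true e)) (λ f → d (cons true f))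
                            | anyFun? {P = λ f → P (cons false f)} (λ e → resp (cons-cong false e)) (λ f → d (cons false f))
  ... | yes (f , p) | _ = yes (cons true f , p)
  ... | no _ | yes (f , p) = yes (cons false f , p)
  ... | no ¬p | no ¬q = no λ { (f , p) → go f (f zero) refl p }
    where
    go : ∀ f b → f zero ≡ b → P f → ⊥
    go f true  eq p = ¬p (f ∘ suc , resp (λ i → trans (uncons f i) (cong (λ b → cons b (f ∘ suc) i) eq)) p)
    go f false eq p = ¬q (f ∘ suc , resp (λ i → trans (uncons f i) (cong (λ b → cons b (f ∘ suc) i) eq)) p)

  allFun? : ∀ {k} {P : (Fin k → Bool) → Set} → Respects≗ P → (∀ f → Dec (P f)) → Dec (∀ f → P f)
  allFun? resp d with anyFun? (λ e ¬p p → ¬p (resp (sym ∘ e) p)) (λ f → ¬? (d f))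
  ... | yes (f , ¬p) = no λ h → ¬p (h f)
  ... | no ¬e = yes λ f → decidable-stable (d f) (λ ¬p → ¬e (f , ¬p))

_→?_ : {A B : Set} → Dec A → Dec B → Dec (A → B)
yes a →? yes b = yes λ _ → b
yes a →? no ¬b = no λ f → ¬b (f a)
no ¬a →? _     = yes λ a → ⊥-elim (¬a a)

-- Finite sums, the handshake identity and counting

module Sum {A : Set} {_⊕_ _⊗_ : A → A → A} {0# 1# : A}
           (isCSR : IsCommutativeSemiring _≡_ _⊕_ _⊗_ 0# 1#) where

  open IsCommutativeSemiring isCSR using (+-identityˡ; +-identityʳ; +-assoc; +-comm; zeroˡ; zeroʳ; distribˡ; *-identityˡ; *-identityʳ; *-assoc; *-comm)
  open ≡-Reasoning

  χ : Bool → A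
  χ true  = 1#
  χ false = 0#

  interchange : ∀ a b c d → (a ⊕ b) ⊕ (c ⊕ d) ≡ (a ⊕ c) ⊕ (b ⊕ d)
  interchange a b c d = begin
    (a ⊕ b) ⊕ (c ⊕ d)  ≡⟨ +-assoc a b _ ⟩
    a ⊕ (b ⊕ (c ⊕ d))  ≡⟨ cong (a ⊕_) (+-assoc b c d) ⟨
    a ⊕ ((b ⊕ c) ⊕ d)  ≡⟨ cong (λ x → a ⊕ (x ⊕ d)) (+-comm b c) ⟩
    a ⊕ ((c ⊕ b) ⊕ d)  ≡⟨ cong (a ⊕_) (+-assoc c b d) ⟩
    a ⊕ (c ⊕ (b ⊕ d))  ≡⟨ +-assoc a c _ ⟨
    (a ⊕ c) ⊕ (b ⊕ d)  ∎

  opaque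
    ∑ : ∀ {k} → (Fin k → A) → A
    ∑ {zero}  f = 0#
    ∑ {suc k} f = f zero ⊕ ∑ (f ∘ suc)

    ∑-cong : ∀ {k} {f g : Fin k → A} → f ≗ g → ∑ f ≡ ∑ g
    ∑-cong {zero}  e = refl
    ∑-cong {suc k} e = cong₂ _⊕_ (e zero) (∑-cong (e ∘ suc))

    ∑-0 : ∀ {k} {f : Fin k → A} → (∀ i → f i ≡ 0#) → ∑ f ≡ 0#
    ∑-0 {zero}  e = refl
    ∑-0 {suc k} e = trans (cong₂ _⊕_ (e zero) (∑-0 (e ∘ suc))) (+-identityˡ 0#)

    ∑-+ : ∀ {k} (f g : Fin k → A) → ∑ (λ i → f i ⊕ g i) ≡ ∑ f ⊕ ∑ g
    ∑-+ {zero}  f g = sym (+-identityˡ 0#)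
    ∑-+ {suc k} f g = trans (cong ((f zero ⊕ g zero) ⊕_) (∑-+ (f ∘ suc) (g ∘ suc))) (interchange _ _ _ _)

    ∑-* : ∀ {k} a (f : Fin k → A) → ∑ (λ i → a ⊗ f i) ≡ a ⊗ ∑ f
    ∑-* {zero}  a f = sym (zeroʳ a)
    ∑-* {suc k} a f = trans (cong ((a ⊗ f zero) ⊕_) (∑-* a (f ∘ suc))) (sym (distribˡ a _ _))

    ∑-comm : ∀ {k l} (f : Fin k → Fin l → A) → ∑ (λ i → ∑ (f i)) ≡ ∑ (λ j → ∑ (λ i → f i j))
    ∑-comm {zero} {l} f = sym (∑-0 {l} (λ _ → refl))
    ∑-comm {suc k} f = trans (cong (∑ (f zero) ⊕_) (∑-comm (f ∘ suc))) (sym (∑-+ (f zero) _))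

    ∑-pt : ∀ {k} (j : Fin k) (f : Fin k → A) → ∑ (λ i → f i ⊗ χ ⌊ j ≟ i ⌋) ≡ f j
    ∑-pt {suc k} zero f = begin
      (f zero ⊗ 1#) ⊕ ∑ (λ i → f (suc i) ⊗ 0#) ≡⟨ cong₂ _⊕_ (*-identityʳ _) (∑-0 {k} (λ i → zeroʳ (f (suc i)))) ⟩
      f zero ⊕ 0#                               ≡⟨ +-identityʳ _ ⟩
      f zero                                    ∎
    ∑-pt {suc k} (suc j) f = begin
      (f zero ⊗ 0#) ⊕ ∑ (λ i → f (suc i) ⊗ χ ⌊ suc j ≟ suc i ⌋)
        ≡⟨ cong₂ _⊕_ (zeroʳ _) (∑-cong λ i → cong (λ b → f (suc i) ⊗ χ b) (lemma i)) ⟩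
      0# ⊕ ∑ (λ i → f (suc i) ⊗ χ ⌊ j ≟ i ⌋)  ≡⟨ +-identityˡ _ ⟩
      ∑ (λ i → f (suc i) ⊗ χ ⌊ j ≟ i ⌋)       ≡⟨ ∑-pt j (f ∘ suc) ⟩
      f (suc j)                                ∎
      where
      lemma : ∀ i → ⌊ suc j ≟ suc i ⌋ ≡ ⌊ j ≟ i ⌋
      lemma i with j ≟ i
      ... | yes _ = refl
      ... | no _  = refl

  χ-∧ : ∀ a b → χ (a ∧ b) ≡ χ a ⊗ χ b
  χ-∧ true  b = sym (*-identityˡ _)
  χ-∧ false b = sym (zeroˡ _)

  module Handshake {n m : ℕ} (s t : Fin m → Fin n) (loopless : ∀ e → s e ≢ t e) where

    -- cut x S = x(δ(S)) and inner x S = x(E[S]) for an edge vector x.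
    cut : (Fin m → A) → (Fin n → Bool) → A
    cut x S = ∑ (λ e → x e ⊗ χ (S (s e) xor S (t e)))

    inner : (Fin m → A) → (Fin n → Bool) → A
    inner x S = ∑ (λ e → x e ⊗ χ (S (s e) ∧ S (t e)))

    star : Fin n → Fin n → Bool
    star v u = ⌊ u ≟ v ⌋

    -- Each edge is counted once for every end in `S`. The identity is needed both over ℕ, for
    -- matchings, and over ℤ, for signed edge vectors, hence the general semiring.
    handshake : ∀ x S → ∑ (λ v → χ (S v) ⊗ cut x (star v)) ≡ cut x S ⊕ (inner x S ⊕ inner x S)
    handshake x S = begin
      ∑ (λ v → χ (S v) ⊗ cut x (star v))
        ≡⟨ ∑-cong (λ v → ∑-* (χ (S v)) _) ⟨
      ∑ (λ v → ∑ (λ e → χ (S v) ⊗ (x e ⊗ χ (star v (s e) xor star v (t e)))))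
        ≡⟨ ∑-comm _ ⟩
      ∑ (λ e → ∑ (λ v → χ (S v) ⊗ (x e ⊗ χ (star v (s e) xor star v (t e)))))
        ≡⟨ ∑-cong perEdge ⟩
      ∑ (λ e → (x e ⊗ χ (S (s e) xor S (t e))) ⊕ ((x e ⊗ χ (S (s e) ∧ S (t e))) ⊕ (x e ⊗ χ (S (s e) ∧ S (t e)))))
        ≡⟨ ∑-+ _ _ ⟩
      cut x S ⊕ ∑ (λ e → (x e ⊗ χ (S (s e) ∧ S (t e))) ⊕ (x e ⊗ χ (S (s e) ∧ S (t e))))
        ≡⟨ cong (cut x S ⊕_) (∑-+ _ _) ⟩
      cut x S ⊕ (inner x S ⊕ inner x S) ∎
      where
      split : ∀ e v → χ (star v (s e) xor star v (t e)) ≡ χ ⌊ s e ≟ v ⌋ ⊕ χ ⌊ t e ≟ v ⌋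
      split e v with s e ≟ v | t e ≟ v
      ... | yes p | yes q = ⊥-elim (loopless e (trans p (sym q)))
      ... | yes p | no  q = sym (+-identityʳ _)
      ... | no  p | yes q = sym (+-identityˡ _)
      ... | no  p | no  q = sym (+-identityˡ _)
      rearr : ∀ e v → χ (S v) ⊗ (x e ⊗ χ (star v (s e) xor star v (t e)))
                    ≡ ((x e ⊗ χ (S v)) ⊗ χ ⌊ s e ≟ v ⌋) ⊕ ((x e ⊗ χ (S v)) ⊗ χ ⌊ t e ≟ v ⌋)
      rearr e v = begin
        χ (S v) ⊗ (x e ⊗ χ (star v (s e) xor star v (t e)))  ≡⟨ *-assoc _ _ _ ⟨
        (χ (S v) ⊗ x e) ⊗ χ (star v (s e) xor star v (t e))  ≡⟨ cong₂ _⊗_ (*-comm _ _) (split e v) ⟩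
        (x e ⊗ χ (S v)) ⊗ (χ ⌊ s e ≟ v ⌋ ⊕ χ ⌊ t e ≟ v ⌋)    ≡⟨ distribˡ _ _ _ ⟩
        _ ∎
      parts : ∀ a b → χ a ⊕ χ b ≡ χ (a xor b) ⊕ (χ (a ∧ b) ⊕ χ (a ∧ b))
      parts true  true  = sym (+-identityˡ _)
      parts true  false = cong (1# ⊕_) (sym (+-identityˡ _))
      parts false b     = trans (+-comm _ _) (cong (χ b ⊕_) (sym (+-identityˡ _)))
      perEdge : ∀ e → ∑ (λ v → χ (S v) ⊗ (x e ⊗ χ (star v (s e) xor star v (t e))))
                    ≡ (x e ⊗ χ (S (s e) xor S (t e))) ⊕ ((x e ⊗ χ (S (s e) ∧ S (t e))) ⊕ (x e ⊗ χ (S (s e) ∧ S (t e))))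
      perEdge e = begin
        ∑ (λ v → χ (S v) ⊗ (x e ⊗ χ (star v (s e) xor star v (t e))))
          ≡⟨ ∑-cong (rearr e) ⟩
        ∑ (λ v → ((x e ⊗ χ (S v)) ⊗ χ ⌊ s e ≟ v ⌋) ⊕ ((x e ⊗ χ (S v)) ⊗ χ ⌊ t e ≟ v ⌋))
          ≡⟨ ∑-+ _ _ ⟩
        ∑ (λ v → (x e ⊗ χ (S v)) ⊗ χ ⌊ s e ≟ v ⌋) ⊕ ∑ (λ v → (x e ⊗ χ (S v)) ⊗ χ ⌊ t e ≟ v ⌋)
          ≡⟨ cong₂ _⊕_ (∑-pt (s e) _) (∑-pt (t e) _) ⟩
        (x e ⊗ χ (S (s e))) ⊕ (x e ⊗ χ (S (t e)))
          ≡⟨ distribˡ _ _ _ ⟨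
        x e ⊗ (χ (S (s e)) ⊕ χ (S (t e)))
          ≡⟨ cong (x e ⊗_) (parts (S (s e)) (S (t e))) ⟩
        x e ⊗ (χ (S (s e) xor S (t e)) ⊕ (χ (S (s e) ∧ S (t e)) ⊕ χ (S (s e) ∧ S (t e))))
          ≡⟨ trans (distribˡ _ _ _) (cong ((x e ⊗ χ (S (s e) xor S (t e))) ⊕_) (distribˡ _ _ _)) ⟩
        _ ∎

module ΣN = Sum ℕ.+-*-isCommutativeSemiring
module ΣZ = Sum ℤ.+-*-isCommutativeSemiring

open ΣN public using () renaming (∑ to ∑ℕ; χ to χℕ)
open ΣZ public using () renaming (∑ to ∑ℤ; χ to χℤ)

cnt : ∀ {k} → (Fin k → Bool) → ℕ
cnt p = ∑ℕ (χℕ ∘ p)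

opaque
  unfolding ΣN.∑
  ∑ℕ-mono : ∀ {k} {f g : Fin k → ℕ} → (∀ i → f i ℕ.≤ g i) → ∑ℕ f ℕ.≤ ∑ℕ g
  ∑ℕ-mono {zero}  h = z≤n
  ∑ℕ-mono {suc k} h = ℕ.+-mono-≤ (h zero) (∑ℕ-mono (h ∘ suc))

  ∑ℕ-mono-< : ∀ {k} {f g : Fin k → ℕ} → (∀ i → f i ℕ.≤ g i) → ∀ i → f i ℕ.< g i → ∑ℕ f ℕ.< ∑ℕ g
  ∑ℕ-mono-< {suc k} h zero    lt = ℕ.+-mono-<-≤ lt (∑ℕ-mono (h ∘ suc))
  ∑ℕ-mono-< {suc k} h (suc i) lt = ℕ.+-mono-≤-< (h zero) (∑ℕ-mono-< (h ∘ suc) i lt)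

  term≤∑ℕ : ∀ {k} (f : Fin k → ℕ) i → f i ℕ.≤ ∑ℕ f
  term≤∑ℕ f zero    = ℕ.m≤m+n _ _
  term≤∑ℕ f (suc i) = ℕ.≤-trans (term≤∑ℕ (f ∘ suc) i) (ℕ.m≤n+m _ _)

∑ℕ≡0 : ∀ {k} (f : Fin k → ℕ) → ∑ℕ f ≡ 0 → ∀ i → f i ≡ 0
∑ℕ≡0 f h i = ℕ.n≤0⇒n≡0 (subst (f i ℕ.≤_) h (term≤∑ℕ f i))

χℕ-mono : ∀ {a b} → (a ≡ true → b ≡ true) → χℕ a ℕ.≤ χℕ b
χℕ-mono {true}  h rewrite h refl = ℕ.≤-refl
χℕ-mono {false} h = z≤n

cnt-cong : ∀ {k} {p q : Fin k → Bool} → p ≗ q → cnt p ≡ cnt q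
cnt-cong e = ΣN.∑-cong (λ i → cong χℕ (e i))

cnt-mono : ∀ {k} {p q : Fin k → Bool} → (∀ i → p i ≡ true → q i ≡ true) → cnt p ℕ.≤ cnt q
cnt-mono h = ∑ℕ-mono (λ i → χℕ-mono (h i))

cnt-strict : ∀ {k} {p q : Fin k → Bool} → (∀ i → p i ≡ true → q i ≡ true) →
             ∀ i → p i ≡ false → q i ≡ true → cnt p ℕ.< cnt q
cnt-strict {p = p} {q} h i pi qi = ∑ℕ-mono-< (λ j → χℕ-mono (h j)) i (lt (p i) (q i) pi qi)
  where
  lt : ∀ a b → a ≡ false → b ≡ true → χℕ a ℕ.< χℕ b
  lt _ _ refl refl = s≤s z≤n

cnt-pos : ∀ {k} (p : Fin k → Bool) i → p i ≡ true → 1 ℕ.≤ cnt p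
cnt-pos p i h = ℕ.≤-trans (ℕ.≤-reflexive (sym (cong χℕ h))) (term≤∑ℕ (χℕ ∘ p) i)

opaque
  unfolding ΣN.∑
  cnt-exists : ∀ {k} (p : Fin k → Bool) → 1 ℕ.≤ cnt p → ∃ λ i → p i ≡ true
  cnt-exists {suc k} p h with p zero in eq
  ... | true  = zero , eq
  ... | false = let i , q = cnt-exists (p ∘ suc) h in suc i , q

cnt-none : ∀ {k} (p : Fin k → Bool) → (∀ i → p i ≡ false) → cnt p ≡ 0
cnt-none p h = ΣN.∑-0 (λ i → cong χℕ (h i))

opaque
  unfolding ΣN.∑
  cnt≤1→unique : ∀ {k} (p : Fin k → Bool) → cnt p ℕ.≤ 1 → ∀ {i j} → p i ≡ true → p j ≡ true → i ≡ j
  cnt≤1→unique p h {zero} {zero} a b = refl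
  cnt≤1→unique {suc k} p h {zero} {suc j} a b rewrite a = ⊥-elim (ℕ.n≮n 1 (ℕ.≤-trans (s≤s (cnt-pos (p ∘ suc) j b)) h))
  cnt≤1→unique {suc k} p h {suc i} {zero} a b rewrite b = ⊥-elim (ℕ.n≮n 1 (ℕ.≤-trans (s≤s (cnt-pos (p ∘ suc) i a)) h))
  cnt≤1→unique {suc k} p h {suc i} {suc j} a b = cong suc (cnt≤1→unique (p ∘ suc) (ℕ.≤-trans (ℕ.m≤n+m _ _) h) a b)

  unique→cnt≤1 : ∀ {k} (p : Fin k → Bool) → (∀ {i j} → p i ≡ true → p j ≡ true → i ≡ j) → cnt p ℕ.≤ 1
  unique→cnt≤1 {zero}  p h = z≤n
  unique→cnt≤1 {suc k} p h with p zero in eq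
  ... | false = unique→cnt≤1 (p ∘ suc) (λ a b → suc-injective (h a b))
  ... | true = ℕ.≤-reflexive (cong suc (cnt-none (p ∘ suc) λ i → ¬true λ q → zero≢suc (h eq q)))
    where
    zero≢suc : ∀ {k} {i : Fin k} → zero ≢ suc i
    zero≢suc ()

cnt≡1 : ∀ {k} (p : Fin k → Bool) i → p i ≡ true → (∀ {i j} → p i ≡ true → p j ≡ true → i ≡ j) → cnt p ≡ 1
cnt≡1 p i pi u = ℕ.≤-antisym (unique→cnt≤1 p u) (cnt-pos p i pi)

cnt-+ : ∀ {k} (p q r : Fin k → Bool) → (∀ i → χℕ (r i) ≡ χℕ (p i) ℕ.+ χℕ (q i)) → cnt r ≡ cnt p ℕ.+ cnt q
cnt-+ p q r h = trans (ΣN.∑-cong h) (ΣN.∑-+ _ _)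

opaque
  unfolding ΣN.∑
  cnt≤k : ∀ {k} (p : Fin k → Bool) → cnt p ℕ.≤ k
  cnt≤k {zero}  p = z≤n
  cnt≤k {suc k} p = ℕ.+-mono-≤ (χ≤1 (p zero)) (cnt≤k (p ∘ suc))
    where
    χ≤1 : ∀ a → χℕ a ℕ.≤ 1
    χ≤1 true  = ℕ.≤-refl
    χ≤1 false = z≤n

-- Matchings

opaque
  -- As long as a strictly smaller value exists the search moves there; the first value bounds the
  -- number of moves.
  argmin : ∀ {k} {P : (Fin k → Bool) → Set} → Respects≗ P → (∀ f → Dec (P f)) →
           (v : (Fin k → Bool) → ℕ) → (∀ {f g} → f ≗ g → v f ≡ v g) →
           ∃ P → ∃ λ f → P f × (∀ g → P g → v f ≤ v g)
  argmin {P = P} resp dec v vresp (f₀ , p₀) = go (v f₀) f₀ p₀ ℕ.≤-refl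
    where
    go : ∀ b f → P f → v f ≤ b → ∃ λ f → P f × (∀ g → P g → v f ≤ v g)
    go b f p le with anyFun? (λ { e (q , lt) → resp e q , subst (_< v f) (vresp e) lt }) (λ g → dec g ×-dec (v g ℕ.<? v f))
    go b f p le | no ¬e = f , p , λ g q → ℕ.≮⇒≥ (λ lt → ¬e (g , q , lt))
    go zero f p le | yes (g , q , lt) = ⊥-elim (ℕ.n≮0 (ℕ.<-≤-trans lt le))
    go (suc b) f p le | yes (g , q , lt) = go b g q (ℕ.≤-pred (ℕ.≤-trans lt le))

  argmax : ∀ {k} {P : (Fin k → Bool) → Set} → Respects≗ P → (∀ f → Dec (P f)) →
           (v : (Fin k → Bool) → ℕ) → (∀ {f g} → f ≗ g → v f ≡ v g) → ∀ b → (∀ f → v f ≤ b) →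
           ∃ P → ∃ λ f → P f × (∀ g → P g → v g ≤ v f)
  argmax resp dec v vresp b bound e =
    let f , p , h = argmin resp dec (λ f → b ∸ v f) (λ e → cong (b ∸_) (vresp e)) e
    in f , p , λ g q → ℕ.≮⇒≥ (λ lt → ℕ.<⇒≱ (ℕ.∸-monoʳ-< lt (bound g)) (h g q))

record Multigraph (n m : ℕ) : Set where
  field
    s t : Fin m → Fin n
    s≢t : ∀ e → s e ≢ t e

module Matchings {n m : ℕ} (Γ : Multigraph n m) where

  open Multigraph Γ

  VS ES : Set
  VS = Fin n → Bool
  ES = Fin m → Bool

  module HN = ΣN.Handshake s t s≢t
  module HZ = ΣZ.Handshake s t s≢t
  open HN public using (star)

  infix 4 _∈ₑ_ _∈ₑ?_
  _∈ₑ_ : Fin n → Fin m → Set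
  v ∈ₑ e = s e ≡ v ⊎ t e ≡ v

  _∈ₑ?_ : ∀ v e → Dec (v ∈ₑ e)
  v ∈ₑ? e = (s e ≟ v) ⊎-dec (t e ≟ v)

  cross ins : VS → ES
  cross S e = S (s e) xor S (t e)
  ins S e = S (s e) ∧ S (t e)

  two-ends : ∀ {e x y z} → x ∈ₑ e → y ∈ₑ e → x ≢ y → z ∈ₑ e → z ≡ x ⊎ z ≡ y
  two-ends (inj₁ refl) (inj₁ refl) ne _ = ⊥-elim (ne refl)
  two-ends (inj₂ refl) (inj₂ refl) ne _ = ⊥-elim (ne refl)
  two-ends (inj₁ refl) (inj₂ refl) ne (inj₁ refl) = inj₁ refl
  two-ends (inj₁ refl) (inj₂ refl) ne (inj₂ refl) = inj₂ refl
  two-ends (inj₂ refl) (inj₁ refl) ne (inj₁ refl) = inj₂ refl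
  two-ends (inj₂ refl) (inj₁ refl) ne (inj₂ refl) = inj₁ refl

  other : ∀ {v e} → v ∈ₑ e → ∃ λ u → u ∈ₑ e × v ≢ u
  other {e = e} (inj₁ refl) = t e , inj₂ refl , s≢t e
  other {e = e} (inj₂ refl) = s e , inj₁ refl , (s≢t e ∘ sym)

  cross-intro : ∀ {S : VS} {e x y} → x ∈ₑ e → y ∈ₑ e → S x ≡ true → S y ≡ false → cross S e ≡ true
  cross-intro (inj₁ refl) (inj₁ refl) p q = ⊥-elim (true≢false p q)
  cross-intro (inj₂ refl) (inj₂ refl) p q = ⊥-elim (true≢false p q)
  cross-intro (inj₁ refl) (inj₂ refl) p q rewrite p | q = refl
  cross-intro (inj₂ refl) (inj₁ refl) p q rewrite p | q = refl

  cross-elim : ∀ (S : VS) e → cross S e ≡ true → ∃ λ x → ∃ λ y → x ∈ₑ e × y ∈ₑ e × S x ≡ true × S y ≡ false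
  cross-elim S e c with S (s e) in p | S (t e) in q
  ... | true  | false = s e , t e , inj₁ refl , inj₂ refl , p , q
  ... | false | true  = t e , s e , inj₂ refl , inj₁ refl , q , p

  not-cross : ∀ (S : VS) {e x y} → cross S e ≡ false → x ∈ₑ e → y ∈ₑ e → S x ≡ true → S y ≡ true
  not-cross S {e} {x} {y} c xe ye p with S y in q
  ... | true = refl
  ... | false = ⊥-elim (true≢false (cross-intro {S} xe ye p q) c)

  ins-elim : ∀ {S : VS} {e x} → ins S e ≡ true → x ∈ₑ e → S x ≡ true
  ins-elim {S} {e} p (inj₁ refl) = proj₁ (∧-true p)
  ins-elim {S} {e} p (inj₂ refl) = proj₂ (∧-true {S (s e)} p)

  ins-intro : ∀ {S : VS} {e} → (∀ {x} → x ∈ₑ e → S x ≡ true) → ins S e ≡ true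
  ins-intro h = ∧-intro (h (inj₁ refl)) (h (inj₂ refl))

  Mat : ES → Set
  Mat M = ∀ v e f → M e ≡ true → M f ≡ true → v ∈ₑ e → v ∈ₑ f → e ≡ f

  Cov : ES → Fin n → Set
  Cov M v = ∃ λ e → M e ≡ true × v ∈ₑ e

  PM : ES → Set
  PM M = Mat M × (∀ v → Cov M v)

  Mat-resp : Respects≗ Mat
  Mat-resp eq h v e f p q = h v e f (trans (eq e) p) (trans (eq f) q)

  Cov-resp : ∀ {v} → Respects≗ (λ M → Cov M v)
  Cov-resp eq (e , p , q) = e , trans (sym (eq e)) p , q

  PM-resp : Respects≗ PM
  PM-resp eq (a , b) = Mat-resp eq a , λ v → Cov-resp eq (b v)

  Mat? : ∀ M → Dec (Mat M)
  Mat? M = all? λ v → all? λ e → all? λ f →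
    (M e Bool.≟ true) →? ((M f Bool.≟ true) →? ((v ∈ₑ? e) →? ((v ∈ₑ? f) →? (e ≟ f))))

  Cov? : ∀ M v → Dec (Cov M v)
  Cov? M v = any? λ e → (M e Bool.≟ true) ×-dec (v ∈ₑ? e)

  PM? : ∀ M → Dec (PM M)
  PM? M = Mat? M ×-dec all? (Cov? M)

  Mat-⊆ : ∀ {M N} → (∀ e → N e ≡ true → M e ≡ true) → Mat M → Mat N
  Mat-⊆ h mat v e f p q = mat v e f (h e p) (h f q)

  wt : (Fin m → ℕ) → ES → ℕ
  wt w M = ∑ℕ (λ e → χℕ (M e) * w e)

  wt-resp : ∀ w {M N} → M ≗ N → wt w M ≡ wt w N
  wt-resp w eq = ΣN.∑-cong (λ e → cong (λ b → χℕ b * w e) (eq e))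

  χ*≤ : ∀ b x → χℕ b * x ≤ x
  χ*≤ true  x = ℕ.≤-reflexive (ℕ.+-identityʳ x)
  χ*≤ false x = z≤n

  wt≤∑ : ∀ w M → wt w M ≤ ∑ℕ w
  wt≤∑ w M = ∑ℕ-mono (λ e → χ*≤ (M e) (w e))

  wt-+ : ∀ w₁ w₂ {w} M → (∀ e → M e ≡ true → w e ≡ w₁ e + w₂ e) → wt w M ≡ wt w₁ M + wt w₂ M
  wt-+ w₁ w₂ {w} M h = trans (ΣN.∑-cong pt) (ΣN.∑-+ _ _)
    where
    pt : ∀ e → χℕ (M e) * w e ≡ χℕ (M e) * w₁ e + χℕ (M e) * w₂ e
    pt e with M e in eq
    ... | true = trans (cong (_+ 0) (h e eq)) (trans (ℕ.+-identityʳ _) (sym (cong₂ _+_ (ℕ.+-identityʳ (w₁ e)) (ℕ.+-identityʳ (w₂ e)))))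
    ... | false = refl

  cutM inM : ES → VS → ℕ
  cutM M = HN.cut (χℕ ∘ M)
  inM M = HN.inner (χℕ ∘ M)

  cutM-cnt : ∀ M S → cutM M S ≡ cnt (λ e → M e ∧ cross S e)
  cutM-cnt M S = ΣN.∑-cong (λ e → sym (ΣN.χ-∧ (M e) _))

  star-self : ∀ v → star v v ≡ true
  star-self v = ≟-refl v

  star-cross : ∀ {v e} → v ∈ₑ e → cross (star v) e ≡ true
  star-cross {v} {e} h with other h
  ... | u , ue , ne = cross-intro {star v} h ue (star-self v) (≟-false (λ p → ne (sym p)))

  star-cross⁻ : ∀ {v} e → cross (star v) e ≡ true → v ∈ₑ e
  star-cross⁻ {v} e c with cross-elim (star v) e c
  ... | x , _ , xe , _ , p , _ = subst (_∈ₑ e) (≟-true p) xe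

  deg≤1 : ∀ {M} → Mat M → ∀ v → cutM M (star v) ≤ 1
  deg≤1 {M} mat v rewrite cutM-cnt M (star v) = unique→cnt≤1 _ λ {e} {f} p q →
    mat v e f (proj₁ (∧-true p)) (proj₁ (∧-true q)) (star-cross⁻ e (proj₂ (∧-true {M e} p))) (star-cross⁻ f (proj₂ (∧-true {M f} q)))

  deg≥1 : ∀ {M v} → Cov M v → 1 ≤ cutM M (star v)
  deg≥1 {M} {v} (e , p , q) rewrite cutM-cnt M (star v) = cnt-pos _ e (∧-intro p (star-cross q))

  deg≡0 : ∀ {M v} → ¬ Cov M v → cutM M (star v) ≡ 0
  deg≡0 {M} {v} h rewrite cutM-cnt M (star v) = cnt-none _ λ e → ¬true λ p →
    h (e , proj₁ (∧-true p) , star-cross⁻ e (proj₂ (∧-true {M e} p)))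

  private
    χ*-mono : ∀ {b x y} → (b ≡ true → x ≤ y) → χℕ b * x ≤ χℕ b * y
    χ*-mono {true}  h = ℕ.+-monoˡ-≤ 0 (h refl)
    χ*-mono {false} h = z≤n

    cnt-as : ∀ (S : VS) → cnt S ≡ ∑ℕ (λ v → χℕ (S v) * 1)
    cnt-as S = ΣN.∑-cong (λ v → sym (ℕ.*-identityʳ _))

  size-PM : ∀ {M} → PM M → ∀ S → cnt S ≡ cutM M S + (inM M S + inM M S)
  size-PM {M} (mat , cov) S = trans (cnt-as S)
    (trans (ΣN.∑-cong (λ v → cong (χℕ (S v) *_) (ℕ.≤-antisym (deg≥1 (cov v)) (deg≤1 mat v)))) (HN.handshake (χℕ ∘ M) S))

  cut+in≤ : ∀ {M} → Mat M → ∀ S → cutM M S + (inM M S + inM M S) ≤ cnt S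
  cut+in≤ {M} mat S = subst (_≤ cnt S) (HN.handshake (χℕ ∘ M) S)
    (subst (∑ℕ (λ v → χℕ (S v) * cutM M (star v)) ≤_) (sym (cnt-as S)) (∑ℕ-mono λ v → χ*-mono {S v} (λ _ → deg≤1 mat v)))

  in≤ : ∀ {M} → Mat M → ∀ S → inM M S + inM M S ≤ cnt S
  in≤ {M} mat S = ℕ.≤-trans (ℕ.m≤n+m _ (cutM M S)) (cut+in≤ mat S)

  in< : ∀ {M} → Mat M → ∀ (S : VS) {v} → S v ≡ true → ¬ Cov M v → inM M S + inM M S < cnt S
  in< {M} mat S {v} Sv ¬c = ℕ.≤-<-trans (ℕ.m≤n+m (inM M S + inM M S) (cutM M S)) (subst (_< cnt S) (HN.handshake (χℕ ∘ M) S)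
    (subst (∑ℕ (λ v → χℕ (S v) * cutM M (star v)) <_) (sym (cnt-as S))
      (∑ℕ-mono-< (λ v → χ*-mono {S v} (λ _ → deg≤1 mat v)) v lt)))
    where
    lt : χℕ (S v) * cutM M (star v) < χℕ (S v) * 1
    lt rewrite Sv | deg≡0 ¬c = s≤s z≤n

  -- With no edge of `M` leaving `S`, the vertices of `S` are the ends of the edges inside and the
  -- missed ones, of which there is at most one.
  size≤ : ∀ {M} → Mat M → ∀ (S : VS) → (∀ e → M e ≡ true → cross S e ≡ false) →
          (∀ {u v} → S u ≡ true → S v ≡ true → ¬ Cov M u → ¬ Cov M v → u ≡ v) → cnt S ≤ 1 + (inM M S + inM M S)
  size≤ {M} mat S nocross uniq = begin
    cnt S ≤⟨ ∑ℕ-mono pt ⟩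
    ∑ℕ (λ v → χℕ (missed v) + χℕ (S v) * cutM M (star v)) ≡⟨ ΣN.∑-+ _ _ ⟩
    cnt missed + ∑ℕ (λ v → χℕ (S v) * cutM M (star v)) ≡⟨ cong (cnt missed +_) (HN.handshake (χℕ ∘ M) S) ⟩
    cnt missed + (cutM M S + (inM M S + inM M S)) ≡⟨ cong (λ x → cnt missed + (x + (inM M S + inM M S))) zero-cut ⟩
    cnt missed + (inM M S + inM M S) ≤⟨ ℕ.+-monoˡ-≤ _ (unique→cnt≤1 missed uq) ⟩
    1 + (inM M S + inM M S) ∎
    where
    open ℕ.≤-Reasoning
    missed : VS
    missed v = S v ∧ not ⌊ Cov? M v ⌋
    pt : ∀ v → χℕ (S v) ≤ χℕ (missed v) + χℕ (S v) * cutM M (star v)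
    pt v with S v | Cov? M v
    ... | false | _ = z≤n
    ... | true | yes c = ℕ.≤-trans (deg≥1 c) (ℕ.≤-reflexive (sym (ℕ.+-identityʳ _)))
    ... | true | no ¬c = s≤s z≤n
    zero-cut : cutM M S ≡ 0
    zero-cut = trans (cutM-cnt M S) (cnt-none _ λ e → ¬true λ p → true≢false (proj₂ (∧-true {M e} p)) (nocross e (proj₁ (∧-true p))))
    uq : ∀ {u v} → missed u ≡ true → missed v ≡ true → u ≡ v
    uq {u} {v} p q with Cov? M u | Cov? M v
    uq {u} {v} p q | no a | no b = uniq (proj₁ (∧-true p)) (proj₁ (∧-true q)) a b
    uq {u} {v} p q | yes a | _ = ⊥-elim (true≢false (proj₂ (∧-true {S u} p)) refl)
    uq {u} {v} p q | no _ | yes b = ⊥-elim (true≢false (proj₂ (∧-true {S v} q)) refl)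

  -- Looking at the end `s e` alone is asymmetric on edges that cross `P`; this does no harm once
  -- the two matchings agree on the cut.
  swap : VS → ES → ES → ES
  swap P M N e = if P (s e) then N e else M e

  AgreeOnCut : VS → ES → ES → Set
  AgreeOnCut P M N = ∀ e → cross P e ≡ true → M e ≡ N e

  module _ {P : VS} {M N : ES} (agree : AgreeOnCut P M N) where

    swap-in : ∀ {v e} → v ∈ₑ e → P v ≡ true → swap P M N e ≡ N e
    swap-in {v} {e} ve Pv with P (s e) in eq
    ... | true = refl
    ... | false = agree e (cross-intro {P} ve (inj₁ refl) Pv eq)

    swap-out : ∀ {v e} → v ∈ₑ e → P v ≡ false → swap P M N e ≡ M e
    swap-out {v} {e} ve Pv with P (s e) in eq
    ... | false = refl
    ... | true = sym (agree e (cross-intro {P} (inj₁ refl) ve eq Pv))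

    swap-Mat : Mat M → Mat N → Mat (swap P M N)
    swap-Mat mM mN v e f p q ve vf with P v in eq
    ... | true = mN v e f (trans (sym (swap-in ve eq)) p) (trans (sym (swap-in vf eq)) q) ve vf
    ... | false = mM v e f (trans (sym (swap-out ve eq)) p) (trans (sym (swap-out vf eq)) q) ve vf

    swap-Cov-in : ∀ {v} → P v ≡ true → Cov N v → Cov (swap P M N) v
    swap-Cov-in Pv (e , p , q) = e , trans (swap-in q Pv) p , q

    swap-Cov-out : ∀ {v} → P v ≡ false → Cov M v → Cov (swap P M N) v
    swap-Cov-out Pv (e , p , q) = e , trans (swap-out q Pv) p , q

    swap-PM : PM M → PM N → PM (swap P M N)
    swap-PM (mM , cM) (mN , cN) = swap-Mat mM mN , cov
      where
      cov : ∀ v → Cov (swap P M N) v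
      cov v with P v in eq
      ... | true  = swap-Cov-in eq (cN v)
      ... | false = swap-Cov-out eq (cM v)

  swap-wt : ∀ w P M N → wt w (swap P M N) + wt w (swap P N M) ≡ wt w M + wt w N
  swap-wt w P M N = trans (sym (ΣN.∑-+ _ _)) (trans (ΣN.∑-cong pt) (ΣN.∑-+ _ _))
    where
    pt : ∀ e → χℕ (swap P M N e) * w e + χℕ (swap P N M e) * w e ≡ χℕ (M e) * w e + χℕ (N e) * w e
    pt e with P (s e)
    ... | true  = ℕ.+-comm (χℕ (N e) * w e) _
    ... | false = refl

  Closed : ES → VS → Set
  Closed M P = ∀ {e x y} → M e ≡ true → x ∈ₑ e → y ∈ₑ e → P x ≡ true → P y ≡ true

  Closed→agree : ∀ {P M N} → Closed M P → Closed N P → AgreeOnCut P M N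
  Closed→agree {P} {M} {N} cM cN e cr with cross-elim P e cr
  ... | x , y , xe , ye , Px , Py = trans (none M cM) (sym (none N cN))
    where
    none : ∀ K → Closed K P → K e ≡ false
    none K cl = ¬true λ p → true≢false (cl p xe ye Px) Py

  -- `P` is the component of `t₀` in the union of the two matchings. It is a path because `N` misses
  -- `t₀`, and `z` is its other end. The exchange argument needs to know that `M` can miss only the
  -- two ends.
  alternating-path : ∀ {M N} → Mat M → Mat N → ∀ {t₀} → ¬ Cov N t₀ →
    ∃ λ P → P t₀ ≡ true × Closed M P × Closed N P × ∃ λ z → ∀ x → P x ≡ true → x ≢ t₀ → x ≢ z → Cov M x
  alternating-path {M} {N} mM mN {t₀} ¬N =
    let P , p , cN , cM , z , h = go n N M mN mM t₀ (star t₀) (star-self t₀) (star-self t₀)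
          (λ {e} {x} p xe ye q → ⊥-elim (¬N (e , p , subst (_∈ₑ e) (≟-true q) xe)))
          (λ {e} {x} p xe ye q → ⊥-elim (empty t₀ x q))
          (λ x p ne → ⊥-elim (ne (≟-true p))) (λ x p ne → ⊥-elim (ne (≟-true p)))
          (ℕ.m≤n+m n _)
    in P , p , cM , cN , z , λ x a b c → proj₂ (h x a b c)
    where
    rem add : VS → Fin n → VS
    rem P a v = P v ∧ not ⌊ v ≟ a ⌋
    add P b v = P v ∨ ⌊ v ≟ b ⌋

    rem⁺ : ∀ (P : VS) a x → P x ≡ true → x ≢ a → rem P a x ≡ true
    rem⁺ P a x p ne = ∧-intro p (cong not (≟-false ne))

    rem⁻ : ∀ (P : VS) a x → rem P a x ≡ true → P x ≡ true × x ≢ a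
    rem⁻ P a x p = proj₁ (∧-true p) , λ { refl → true≢false (proj₂ (∧-true {P x} p)) (cong not (≟-refl x)) }

    empty : ∀ a x → rem (star a) a x ≡ true → ⊥
    empty a x p = let q , ne = rem⁻ (star a) a x p in ne (≟-true q)

    Result : ES → ES → Set
    Result N₁ N₂ = ∃ λ P → P t₀ ≡ true × Closed N₁ P × Closed N₂ P ×
      ∃ λ z → ∀ x → P x ≡ true → x ≢ t₀ → x ≢ z → Cov N₁ x × Cov N₂ x

    -- `a` is the end of the path built so far. The matching used last is `N₁`, so `P` is closed
    -- under it; `P` without `a` is closed under `N₂`, which is followed next. The two change roles
    -- at each extension, and `k` bounds the number of vertices outside `P`.
    go : ∀ k N₁ N₂ → Mat N₁ → Mat N₂ → ∀ a P → P a ≡ true → P t₀ ≡ true →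
         Closed N₁ P → Closed N₂ (rem P a) → (∀ x → P x ≡ true → x ≢ t₀ → Cov N₁ x) →
         (∀ x → P x ≡ true → x ≢ t₀ → x ≢ a → Cov N₂ x) → n ≤ cnt P + k → Result N₁ N₂
    go k N₁ N₂ m₁ m₂ a P Pa Pt i₁ i₂ i₃ i₄ fuel with Cov? N₂ a
    ... | no ¬c = P , Pt , i₁ , cl₂ , a , λ x p q r → i₃ x p q , i₄ x p q r
      where
      cl₂ : Closed N₂ P
      cl₂ {e} {x} {y} p xe ye Px with x ≟ a
      ... | yes refl = ⊥-elim (¬c (e , p , xe))
      ... | no ne = proj₁ (rem⁻ P a y (i₂ p xe ye (rem⁺ P a x Px ne)))
    ... | yes (f , N₂f , af) with other af
    ... | b , bf , a≢b = next k fuel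
      where
      b∉P : P b ≡ false
      -- Otherwise `f` would lead from `P` without `a` back to `a`, against closedness under `N₂`.
      b∉P = ¬true λ Pb → proj₂ (rem⁻ P a a (i₂ N₂f bf af (rem⁺ P a b Pb (a≢b ∘ sym)))) refl
      Q = add P b
      Qb : Q b ≡ true
      Qb = ∨-introʳ {P b} (≟-refl b)
      toQ : ∀ {x} → P x ≡ true → Q x ≡ true
      toQ = ∨-introˡ
      fromQ : ∀ {x} → Q x ≡ true → P x ≡ true ⊎ x ≡ b
      fromQ {x} q with ∨-true {P x} q
      ... | inj₁ p = inj₁ p
      ... | inj₂ p = inj₂ (≟-true p)
      ends-f : ∀ {y} → y ∈ₑ f → Q y ≡ true
      ends-f yf with two-ends af bf a≢b yf
      ... | inj₁ refl = toQ Pa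
      ... | inj₂ refl = Qb
      j₁ : Closed N₂ Q
      j₁ {e} {x} {y} p xe ye Qx with fromQ Qx
      ... | inj₂ refl with m₂ b e f p N₂f xe bf
      ...   | refl = ends-f ye
      j₁ {e} {x} {y} p xe ye Qx | inj₁ Px with x ≟ a
      ... | yes refl with m₂ a e f p N₂f xe af
      ...   | refl = ends-f ye
      j₁ {e} {x} {y} p xe ye Qx | inj₁ Px | no ne = toQ (proj₁ (rem⁻ P a y (i₂ p xe ye (rem⁺ P a x Px ne))))
      j₂ : Closed N₁ (rem Q b)
      j₂ {e} {x} {y} p xe ye q with rem⁻ Q b x q
      ... | Qx , ne with fromQ Qx
      ... | inj₂ eq = ⊥-elim (ne eq)
      ... | inj₁ Px = let Py = i₁ p xe ye Px in rem⁺ Q b y (toQ Py) (λ { refl → true≢false Py b∉P })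
      j₃ : ∀ x → Q x ≡ true → x ≢ t₀ → Cov N₂ x
      j₃ x Qx ne with fromQ Qx
      ... | inj₂ refl = f , N₂f , bf
      ... | inj₁ Px with x ≟ a
      ... | yes refl = f , N₂f , af
      ... | no ne′ = i₄ x Px ne ne′
      j₄ : ∀ x → Q x ≡ true → x ≢ t₀ → x ≢ b → Cov N₁ x
      j₄ x Qx ne ne′ with fromQ Qx
      ... | inj₂ eq = ⊥-elim (ne′ eq)
      ... | inj₁ Px = i₃ x Px ne
      P<Q : cnt P < cnt Q
      P<Q = cnt-strict (λ i → toQ) b b∉P Qb
      next : ∀ k → n ≤ cnt P + k → Result N₁ N₂
      next zero fuel = ⊥-elim (ℕ.<-irrefl refl (ℕ.≤-<-trans fuel (ℕ.<-≤-trans (subst (_< cnt Q) (sym (ℕ.+-identityʳ _)) P<Q) (cnt≤k Q))))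
      next (suc k) fuel with go k N₂ N₁ m₂ m₁ b Q Qb (toQ Pt) j₁ j₂ j₃ j₄
                             (ℕ.≤-trans fuel (ℕ.≤-trans (ℕ.≤-reflexive (ℕ.+-suc (cnt P) k)) (ℕ.+-monoˡ-≤ k P<Q)))
      ... | R , r , c₂ , c₁ , z , h = R , r , c₁ , c₂ , z , λ x p q r → let u , v = h x p q r in v , u

-- Duality for maximum-weight matchings

⌊⌋⁺ : {A : Set} (d : Dec A) → A → ⌊ d ⌋ ≡ true
⌊⌋⁺ (yes _) _ = refl
⌊⌋⁺ (no ¬a) a = ⊥-elim (¬a a)

⌊⌋⁻ : {A : Set} (d : Dec A) → ⌊ d ⌋ ≡ true → A
⌊⌋⁻ (yes a) _ = a

half-≤ : ∀ {a b} → a + a ≤ suc (b + b) → a ≤ b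
half-≤ {a} {b} h = ℕ.≮⇒≥ λ lt → ℕ.<⇒≱ (ℕ.≤-trans (s≤s (ℕ.≤-reflexive (sym (ℕ.+-suc b b)))) (ℕ.+-mono-≤ lt lt)) h

-- Capitals are values of a first weight, small letters of a second, on two matchings; primes mark
-- the values after exchanging parts of the two. One matching is best for the first weight, the
-- other for the sum of both. What the one loses in either weight the other gains, so neither
-- inequality can be strict.
exchange-arith : ∀ {A A′ B B′ a a′ b b′} → A′ + B′ ≡ A + B → a′ + b′ ≡ a + b →
                 B′ + b′ ≤ B + b → b ≤ b′ → A′ ≤ A → A′ ≡ A × a′ ≡ a
exchange-arith {A} {A′} {B} {B′} {a} {a′} {b} {b′} p q r b≤b′ A′≤A =
  ℕ.+-cancelʳ-≡ B A′ A (trans (cong (_ +_) (sym B′≡B)) p) , ℕ.+-cancelʳ-≡ b a′ a (trans (cong (_ +_) (sym b′≡b)) q)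
  where
  B≤B′ : B ≤ B′
  B≤B′ = ℕ.+-cancelˡ-≤ A B B′ (ℕ.≤-trans (ℕ.≤-reflexive (sym p)) (ℕ.+-monoˡ-≤ B′ A′≤A))
  B′≡B : B′ ≡ B
  B′≡B = ℕ.≤-antisym (ℕ.+-cancelʳ-≤ b B′ B (ℕ.≤-trans (ℕ.+-monoʳ-≤ B′ b≤b′) r)) B≤B′
  b′≡b : b′ ≡ b
  b′≡b = ℕ.≤-antisym (ℕ.+-cancelˡ-≤ B b′ b (ℕ.≤-trans (ℕ.+-monoˡ-≤ b′ B≤B′) r)) b≤b′

module Duality {n m : ℕ} (Γ : Multigraph n m) where

  open Multigraph Γ

  open Matchings Γ

  Opt : (Fin m → ℕ) → ES → Set
  Opt w M = Mat M × (∀ N → Mat N → wt w N ≤ wt w M)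

  Opt-resp : ∀ {w} → Respects≗ (Opt w)
  Opt-resp {w} eq (a , b) = Mat-resp eq a , λ N mN → subst (wt w N ≤_) (wt-resp w eq) (b N mN)

  Opt? : ∀ w M → Dec (Opt w M)
  Opt? w M = Mat? M ×-dec allFun? (λ eq h mN → subst (_≤ wt w M) (wt-resp w eq) (h (Mat-resp (sym ∘ eq) mN)))
                                  (λ N → Mat? N →? (wt w N ℕ.≤? wt w M))

  Opt-exists : ∀ w → ∃ (Opt w)
  Opt-exists w = argmax Mat-resp Mat? (wt w) (wt-resp w) (∑ℕ w) (wt≤∑ w) ((λ _ → false) , λ v e f ())

  Pos : (Fin m → ℕ) → ES → Set
  Pos w M = ∀ e → M e ≡ true → 1 ≤ w e

  -- Weights will be lowered by truncated subtraction, which is exact only on edges of positive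
  -- weight. Deleting the edges of weight 0 from a matching preserves its weight before and after.
  pos : (Fin m → ℕ) → ES → ES
  pos w M e = M e ∧ ⌊ 1 ℕ.≤? w e ⌋

  pos-⊆ : ∀ w M e → pos w M e ≡ true → M e ≡ true
  pos-⊆ w M e p = proj₁ (∧-true p)

  pos-Pos : ∀ w M → Pos w (pos w M)
  pos-Pos w M e p = ⌊⌋⁻ (1 ℕ.≤? w e) (proj₂ (∧-true {M e} p))

  pos-wt : ∀ w w′ M → (∀ e → w e ≡ 0 → w′ e ≡ 0) → wt w′ (pos w M) ≡ wt w′ M
  pos-wt w w′ M h = ΣN.∑-cong pt
    where
    pt : ∀ e → χℕ (pos w M e) * w′ e ≡ χℕ (M e) * w′ e
    pt e with M e
    ... | false = refl
    ... | true with 1 ℕ.≤? w e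
    ... | yes _ = refl
    ... | no ¬p rewrite h e (ℕ.n<1⇒n≡0 (ℕ.≰⇒> ¬p)) = refl

  Opt-pos : ∀ {w M} → Opt w M → Opt w (pos w M)
  Opt-pos {w} {M} (a , b) = Mat-⊆ (pos-⊆ w M) a , λ N mN → subst (wt w N ≤_) (sym (pos-wt w w M (λ _ p → p))) (b N mN)

  -- Orthogonality to the possible ingredients of an optimal dual solution: vertex stars, and edge
  -- sets of odd sets that each optimum fills up to one vertex. On the support of `c` complementary
  -- slackness holds with equality.
  Balanced : (Fin m → ℕ) → (Fin m → ℤ) → Set
  Balanced w c = (∀ e → c e ≢ 0ℤ → ∃ λ M → Opt w M × M e ≡ true)
               × (∀ v → HZ.cut c (star v) ≡ 0ℤ)
               × (∀ U → (∀ M → Opt w M → cnt U ≡ 1 + (inM M U + inM M U)) → HZ.inner c U ≡ 0ℤ)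

  ⟪_,_⟫ : (Fin m → ℕ) → (Fin m → ℤ) → ℤ
  ⟪ w , c ⟫ = ∑ℤ (λ e → ℤ.+ w e ℤ.* c e)

  -- One dual ingredient `ξ` is peeled off the weight. Old optima remain optimal, so `c` stays
  -- balanced for `w′`. The decomposition is claimed only on the support of `c`, because truncation
  -- breaks it on edges of weight 0.
  record Reduction (w : Fin m → ℕ) (c : Fin m → ℤ) : Set where
    field
      w′      : Fin m → ℕ
      ξ       : ES
      opt     : ∀ M → Opt w M → Opt w′ M
      smaller : ∑ℕ w′ < ∑ℕ w
      split   : ∀ e → c e ≢ 0ℤ → w e ≡ w′ e + χℕ (ξ e)
      zeroξ   : ∑ℤ (λ e → c e ℤ.* χℤ (ξ e)) ≡ 0ℤ

  lower : (Fin m → ℕ) → ES → Fin m → ℕ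
  lower w ξ e = w e ∸ χℕ (ξ e)

  χ≤1 : ∀ b → χℕ b ≤ 1
  χ≤1 true  = ℕ.≤-refl
  χ≤1 false = z≤n

  lower-split : ∀ w ξ e → 1 ≤ w e → w e ≡ lower w ξ e + χℕ (ξ e)
  lower-split w ξ e p = sym (ℕ.m∸n+n≡m (ℕ.≤-trans (χ≤1 (ξ e)) p))

  lower-zero : ∀ w ξ e → w e ≡ 0 → lower w ξ e ≡ 0
  lower-zero w ξ e p rewrite p = ℕ.0∸n≡0 (χℕ (ξ e))

  lower-< : ∀ w ξ e → 1 ≤ w e → ξ e ≡ true → ∑ℕ (lower w ξ) < ∑ℕ w
  lower-< w ξ e p q = ∑ℕ-mono-< (λ i → ℕ.m∸n≤m (w i) (χℕ (ξ i))) e lt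
    where
    lt : lower w ξ e < w e
    lt rewrite q = ℕ.≤-reflexive (trans (ℕ.+-comm 1 _) (ℕ.m∸n+n≡m p))

  lower-wt : ∀ w ξ {M} → Pos w M → wt w M ≡ wt (lower w ξ) M + wt (χℕ ∘ ξ) M
  lower-wt w ξ {M} h = wt-+ (lower w ξ) (χℕ ∘ ξ) M (λ e p → lower-split w ξ e (h e p))

  -- The star of `u` is peeled off. An optimum then loses exactly 1, and a matching of smaller
  -- weight was already behind by 1, the weights being integers.
  module CoveredVertex (w : Fin m → ℕ) (u : Fin n) (cov : ∀ M → Opt w M → Cov M u)
                       (c : Fin m → ℤ) (bal : Balanced w c) where
    ξ = cross (star u)
    w′ = lower w ξ

    loses : ∀ M → Opt w M → wt w′ M + 1 ≡ wt w M
    loses M o = begin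
      wt w′ M + 1 ≡⟨ cong (_+ 1) (pos-wt w w′ M (lower-zero w ξ)) ⟨
      wt w′ (pos w M) + 1 ≡⟨ cong (wt w′ (pos w M) +_) (ℕ.≤-antisym (deg≥1 (cov _ (Opt-pos o))) (deg≤1 (proj₁ (Opt-pos o)) u)) ⟩
      wt w′ (pos w M) + cutM (pos w M) (star u) ≡⟨ lower-wt w ξ (pos-Pos w M) ⟨
      wt w (pos w M) ≡⟨ pos-wt w w M (λ _ p → p) ⟩
      wt w M ∎
      where open ≡-Reasoning

    bound : ∀ M → Opt w M → ∀ N → Mat N → wt w′ N + 1 ≤ wt w M
    bound M o N mN with Cov? (pos w N) u
    ... | yes cv = begin
      wt w′ N + 1 ≡⟨ cong (_+ 1) (pos-wt w w′ N (lower-zero w ξ)) ⟨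
      wt w′ (pos w N) + 1 ≤⟨ ℕ.+-monoʳ-≤ _ (deg≥1 cv) ⟩
      wt w′ (pos w N) + cutM (pos w N) (star u) ≡⟨ lower-wt w ξ (pos-Pos w N) ⟨
      wt w (pos w N) ≤⟨ proj₂ o _ (Mat-⊆ (pos-⊆ w N) mN) ⟩
      wt w M ∎
      where open ℕ.≤-Reasoning
    -- The positive part of `N` misses `u`, so `N` is no optimum; integrality supplies the 1 that it
    -- does not lose.
    ... | no ¬cv = ℕ.≤-trans (ℕ.≤-reflexive (ℕ.+-comm _ 1)) (ℕ.≤-trans (s≤s (∑ℕ-mono (λ e → ℕ.*-monoʳ-≤ (χℕ (N e)) (ℕ.m∸n≤m (w e) (χℕ (ξ e)))))) lt)
      where
      lt : wt w N < wt w M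
      lt = ℕ.≰⇒> λ le → ¬cv (cov _ (Opt-pos (mN , λ K mK → ℕ.≤-trans (proj₂ o K mK) le)))

    reduction : Reduction w c
    reduction = record
      { w′ = w′ ; ξ = ξ
      ; opt = λ M o → proj₁ o , λ N mN → ℕ.+-cancelʳ-≤ 1 _ _ (ℕ.≤-trans (bound M o N mN) (ℕ.≤-reflexive (sym (loses M o))))
      ; smaller = let M , o = Opt-exists w
                      e , p , q = cov _ (Opt-pos o)
                  in lower-< w ξ e (pos-Pos w M e p) (star-cross q)
      ; split = split
      ; zeroξ = proj₁ (proj₂ bal) u }
      where
      -- An optimum through `e` has no other edge at `u`, yet its positive part still covers `u`. So
      -- `e` has positive weight and the subtraction is exact there.
      split : ∀ e → c e ≢ 0ℤ → w e ≡ w′ e + χℕ (ξ e)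
      split e ne with proj₁ bal e ne | ξ e in eq
      ... | _ | false = sym (ℕ.+-identityʳ _)
      ... | M , o , Me | true with cov _ (Opt-pos o)
      ... | f , p , uf with proj₁ o u e f Me (pos-⊆ w M f p) (star-cross⁻ e eq) uf
      ... | refl = sym (ℕ.m∸n+n≡m (pos-Pos w M f p))

  -- The remaining case: each vertex is missed by some optimum. The ingredient to peel off is an odd
  -- set, the component `U` of `a` along edges of positive weight, which turns out to be filled up
  -- to one vertex by every optimum.
  module MissedVertices (w : Fin m → ℕ) (e₀ : Fin m) (w₀ : 1 ≤ w e₀)
                        (miss : ∀ u → ∃ λ M → Opt w M × ¬ Cov M u) where

    PosClosed : VS → Set
    PosClosed X = ∀ e → 1 ≤ w e → X (s e) ≡ X (t e)

    a : Fin n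
    a = s e₀

    opaque
      -- The component is defined as the intersection of all closed sets around `a`; induction along
      -- positive edges is then an instance of the definition (`U-least`).
      U? : ∀ v → Dec (∀ X → PosClosed X → X a ≡ true → X v ≡ true)
      U? v = allFun? (λ eq h cl p → trans (sym (eq v)) (h (λ e q → trans (eq _) (trans (cl e q) (sym (eq _)))) (trans (eq a) p)))
                     (λ X → all? (λ e → (1 ℕ.≤? w e) →? (X (s e) Bool.≟ X (t e))) →? ((X a Bool.≟ true) →? (X v Bool.≟ true)))

      U : VS
      U v = ⌊ U? v ⌋

      Ua : U a ≡ true
      Ua = ⌊⌋⁺ (U? a) (λ X cl p → p)

      U-closed : PosClosed U
      U-closed e p = iff→≡ (λ q → ⌊⌋⁺ (U? (t e)) λ X cl r → trans (sym (cl e p)) (⌊⌋⁻ (U? (s e)) q X cl r))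
                           (λ q → ⌊⌋⁺ (U? (s e)) λ X cl r → trans (cl e p) (⌊⌋⁻ (U? (t e)) q X cl r))

      U-least : ∀ X → PosClosed X → X a ≡ true → ∀ v → U v ≡ true → X v ≡ true
      U-least X cl p v q = ⌊⌋⁻ (U? v) q X cl p

    Q : ES → Set
    Q M = Mat M × Pos w M

    Q-resp : Respects≗ Q
    Q-resp eq (x , y) = Mat-resp eq x , λ e p → y e (trans (eq e) p)

    Q? : ∀ M → Dec (Q M)
    Q? M = Mat? M ×-dec all? (λ e → (M e Bool.≟ true) →? (1 ℕ.≤? w e))

    Q-pos : ∀ {M} → Mat M → Q (pos w M)
    Q-pos {M} mM = Mat-⊆ (pos-⊆ w M) mM , pos-Pos w M

    -- One end decides, since positive edges do not leave `U`; edges of weight 0 keep weight 0 under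
    -- truncation.
    ξ : ES
    ξ e = U (s e)

    w′ : Fin m → ℕ
    w′ = lower w ξ

    k : ES → ℕ
    k = wt (χℕ ∘ ξ)

    k-in : ∀ {M} → Pos w M → k M ≡ inM M U
    k-in {M} h = ΣN.∑-cong pt
      where
      pt : ∀ e → χℕ (M e) * χℕ (U (s e)) ≡ χℕ (M e) * χℕ (U (s e) ∧ U (t e))
      pt e with M e in eq
      ... | false = refl
      ... | true rewrite sym (U-closed e (h e eq)) with U (s e)
      ... | true = refl
      ... | false = refl

    U-noncross : ∀ {M} → Pos w M → Closed M U
    U-noncross h {e} p (inj₁ refl) (inj₁ refl) q = q
    U-noncross h {e} p (inj₁ refl) (inj₂ refl) q = trans (sym (U-closed e (h e p))) q
    U-noncross h {e} p (inj₂ refl) (inj₁ refl) q = trans (U-closed e (h e p)) q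
    U-noncross h {e} p (inj₂ refl) (inj₂ refl) q = q

    opaque
      best₁ : ∃ λ M → Q M × (∀ N → Q N → wt w′ N ≤ wt w′ M)
      best₁ = argmax Q-resp Q? (wt w′) (wt-resp w′) (∑ℕ w′) (wt≤∑ w′) ((λ _ → false) , (λ v e f ()) , λ e ())

      M₁ : ES
      M₁ = proj₁ best₁

      best₂ : ∃ λ M → (Q M × wt w′ M ≡ wt w′ M₁) × (∀ N → Q N × wt w′ N ≡ wt w′ M₁ → k N ≤ k M)
      best₂ = argmax (λ eq (x , y) → Q-resp eq x , trans (sym (wt-resp w′ eq)) y) (λ M → Q? M ×-dec (wt w′ M ℕ.≟ wt w′ M₁))
                     k (wt-resp _) (∑ℕ (χℕ ∘ ξ)) (wt≤∑ _) (M₁ , proj₁ (proj₂ best₁) , refl)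

      M₀ : ES
      M₀ = proj₁ best₂

      Q₀ : Q M₀
      Q₀ = proj₁ (proj₁ (proj₂ best₂))

      max₁ : ∀ N → Q N → wt w′ N ≤ wt w′ M₀
      max₁ N q = subst (wt w′ N ≤_) (sym (proj₂ (proj₁ (proj₂ best₂)))) (proj₂ (proj₂ best₁) N q)

      max₂ : ∀ N → Q N → wt w′ N ≡ wt w′ M₀ → k N ≤ k M₀
      max₂ N q e = proj₂ (proj₂ best₂) N (q , trans e (proj₂ (proj₁ (proj₂ best₂))))

    -- Lexicographic optima among matchings of positive edges: first `w′`, then the number `k` of
    -- edges in `U`. The second criterion is what lets the argument add an edge that gains nothing
    -- in `w′`.
    Best : ES → Set
    Best M = Q M × wt w′ M ≡ wt w′ M₀ × k M ≡ k M₀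

    Best-resp : Respects≗ Best
    Best-resp eq (x , y , z) = Q-resp eq x , trans (sym (wt-resp w′ eq)) y , trans (sym (wt-resp _ eq)) z

    -- The goal is that a best matching misses at most one vertex of `U`. It follows once this
    -- relation holds along positive edges and is transitive, because `U` is connected by such
    -- edges.
    Rel : Fin n → Fin n → Set
    Rel u v = u ≡ v ⊎ (∀ M → Best M → ¬ Cov M u → ¬ Cov M v → ⊥)

    Rel-sym : ∀ {u v} → Rel u v → Rel v u
    Rel-sym (inj₁ p) = inj₁ (sym p)
    Rel-sym (inj₂ h) = inj₂ λ M b x y → h M b y x

    Rel? : ∀ u v → Dec (Rel u v)
    Rel? u v = (u ≟ v) ⊎-dec allFun?
      (λ eq h b x y → h (Best-resp (sym ∘ eq) b) (x ∘ Cov-resp eq) (y ∘ Cov-resp eq))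
      (λ M → (Q? M ×-dec (wt w′ M ℕ.≟ wt w′ M₀) ×-dec (k M ℕ.≟ k M₀)) →? (¬? (Cov? M u) →? (¬? (Cov? M v) →? no λ ())))

    -- If both ends were missed, adding `e` would raise `k` without lowering `w′`.
    Rel-adj : ∀ e → 1 ≤ w e → U (s e) ≡ true → Rel (s e) (t e)
    Rel-adj e pe Us = inj₂ contra
      where
      contra : ∀ M → Best M → ¬ Cov M (s e) → ¬ Cov M (t e) → ⊥
      contra M ((mM , pM) , eqw , eqk) ¬s ¬t = ℕ.<-irrefl refl (ℕ.<-≤-trans kN (ℕ.≤-trans (max₂ N qN wN) (ℕ.≤-reflexive (sym eqk))))
        where
        N : ES
        N f = M f ∨ ⌊ e ≟ f ⌋
        Me : M e ≡ false
        Me = ¬true λ p → ¬s (e , p , inj₁ refl)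
        ¬both : ∀ {v} f → M f ≡ true → v ∈ₑ f → v ∈ₑ e → ⊥
        ¬both f p q (inj₁ refl) = ¬s (f , p , q)
        ¬both f p q (inj₂ refl) = ¬t (f , p , q)
        mN : Mat N
        mN v f g p q vf vg with ∨-true {M f} p | ∨-true {M g} q
        ... | inj₁ x | inj₁ y = mM v f g x y vf vg
        ... | inj₁ x | inj₂ y = ⊥-elim (¬both f x vf (subst (v ∈ₑ_) (sym (≟-true y)) vg))
        ... | inj₂ x | inj₁ y = ⊥-elim (¬both g y vg (subst (v ∈ₑ_) (sym (≟-true x)) vf))
        ... | inj₂ x | inj₂ y = trans (sym (≟-true x)) (≟-true y)
        pN : Pos w N
        pN f p with ∨-true {M f} p
        ... | inj₁ x = pM f x
        ... | inj₂ x = subst (λ z → 1 ≤ w z) (≟-true x) pe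
        qN : Q N
        qN = mN , pN
        wt-N : ∀ x → wt x N ≡ wt x M + x e
        wt-N x = trans (ΣN.∑-cong pt) (trans (ΣN.∑-+ _ _) (cong (wt x M +_) (ΣN.∑-pt e x)))
          where
          pt : ∀ f → χℕ (M f ∨ ⌊ e ≟ f ⌋) * x f ≡ χℕ (M f) * x f + x f * χℕ ⌊ e ≟ f ⌋
          pt f with e ≟ f
          ... | yes refl rewrite Me = trans (ℕ.+-identityʳ _) (sym (ℕ.*-identityʳ _))
          ... | no _ with M f
          ... | true = trans (sym (ℕ.+-identityʳ _)) (cong ((x f + 0) +_) (sym (ℕ.*-zeroʳ (x f))))
          ... | false = sym (ℕ.*-zeroʳ (x f))
        wN : wt w′ N ≡ wt w′ M₀
        wN = ℕ.≤-antisym (max₁ N qN) (subst (_≤ wt w′ N) eqw (subst (wt w′ M ≤_) (sym (wt-N w′)) (ℕ.m≤m+n _ _)))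
        kN : k M < k N
        kN = subst (k M <_) (sym (wt-N (χℕ ∘ ξ))) (subst (λ b → k M < k M + χℕ b) (sym Us) (ℕ.≤-reflexive (ℕ.+-comm 1 _)))

    -- Lovász's exchange argument: swap along the alternating path of M ∪ N starting at x.
    Rel-trans : ∀ {u x v} → U x ≡ true → Rel u x → Rel x v → Rel u v
    Rel-trans Ux (inj₁ refl) r = r
    Rel-trans Ux r (inj₁ refl) = r
    Rel-trans {u} {x} {v} Ux (inj₂ r₁) (inj₂ r₂) with u ≟ v
    ... | yes p = inj₁ p
    ... | no u≢v = inj₂ contra
      where
      contra : ∀ M → Best M → ¬ Cov M u → ¬ Cov M v → ⊥
      contra M bM@((mM , pM) , eqw , eqk) ¬u ¬v with Cov? M x
      ... | no ¬x = r₁ M bM ¬u ¬x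
      ... | yes cx with miss x
      ... | N* , oN* , ¬x* with alternating-path mM (proj₁ (Opt-pos oN*)) {x} (λ { (e , p , q) → ¬x* (e , pos-⊆ w N* e p , q) })
      ... | P , Px , cM , cN , z , zs = finish
        where
        N : ES
        N = pos w N*
        oN : Opt w N
        oN = Opt-pos oN*
        mN : Mat N
        mN = proj₁ oN
        pN : Pos w N
        pN = pos-Pos w N*
        ¬Nx : ¬ Cov N x
        ¬Nx (e , p , q) = ¬x* (e , pos-⊆ w N* e p , q)
        -- Positive edges do not leave `U`, so intersecting with it preserves closedness, and the
        -- edges inside `R` are among those counted by `k`.
        R : VS
        R y = P y ∧ U y
        Rx : R x ≡ true
        Rx = ∧-intro Px Ux
        R-closed : ∀ {K} → Pos w K → Closed K P → Closed K R
        R-closed pK cK p xe ye q = ∧-intro (cK p xe ye (proj₁ (∧-true q))) (U-noncross pK p xe ye (proj₂ (∧-true q)))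
        cM′ : Closed M R
        cM′ = R-closed pM cM
        cN′ : Closed N R
        cN′ = R-closed pN cN
        M′ N′ : ES
        M′ = swap R M N
        N′ = swap R N M
        ag : AgreeOnCut R M N
        ag = Closed→agree cM′ cN′
        ag′ : AgreeOnCut R N M
        ag′ = Closed→agree cN′ cM′
        swap-Pos : ∀ {A B} → Pos w A → Pos w B → Pos w (swap R A B)
        swap-Pos pA pB e p with R (s e)
        ... | true = pB e p
        ... | false = pA e p
        qM′ : Q M′
        qM′ = swap-Mat {R} ag mM mN , swap-Pos pM pN
        qN′ : Q N′
        qN′ = swap-Mat {R} ag′ mN mM , swap-Pos pN pM
        missed-z : ∀ y → R y ≡ true → ¬ Cov M y → y ≡ z
        missed-z y q ¬y with y ≟ z
        ... | yes p = p
        ... | no ne = ⊥-elim (¬y (zs y (proj₁ (∧-true q)) (λ { refl → ¬y cx }) ne))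
        noncross : ∀ {K} → Closed K R → ∀ e → K e ≡ true → cross R e ≡ false
        noncross cK e p = ¬true λ cr → let y , z , ye , ze , Ry , Rz = cross-elim R e cr in true≢false (cK p ye ze Ry) Rz
        -- `N` misses `x` in `R`, while `M` misses at most `z` there, so `M` has no fewer edges
        -- inside `R`.
        inN≤inM : inM N R ≤ inM M R
        inN≤inM = half-≤ (ℕ.≤-trans (ℕ.<⇒≤ (in< mN R Rx ¬Nx))
          (size≤ mM R (noncross cM′) λ p q ¬a ¬b → trans (missed-z _ p ¬a) (sym (missed-z _ q ¬b))))
        in-as : ∀ {K} → Closed K R → ∀ e → χℕ (K e) * χℕ (R (s e) ∧ R (t e)) ≡ χℕ (K e) * χℕ (R (s e))
        in-as {K} cK e with K e in eq | R (s e) in eq′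
        ... | false | _ = refl
        ... | true | false = refl
        ... | true | true rewrite cK eq (inj₁ refl) (inj₂ refl) eq′ = refl
        k-swap : k N′ + inM N R ≡ k N + inM M R
        k-swap = trans (sym (ΣN.∑-+ _ _)) (trans (ΣN.∑-cong pt) (ΣN.∑-+ _ _))
          where
          pt : ∀ e → χℕ (N′ e) * χℕ (U (s e)) + χℕ (N e) * χℕ (R (s e) ∧ R (t e))
                   ≡ χℕ (N e) * χℕ (U (s e)) + χℕ (M e) * χℕ (R (s e) ∧ R (t e))
          pt e rewrite in-as cM′ e | in-as cN′ e with P (s e) | U (s e)
          ... | true | true = ℕ.+-comm (χℕ (M e) * 1) _
          ... | true | false = cong₂ _+_ {x = χℕ (N e) * 0} refl (trans (ℕ.*-zeroʳ (χℕ (N e))) (sym (ℕ.*-zeroʳ (χℕ (M e)))))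
          ... | false | b = cong₂ _+_ {x = χℕ (N e) * χℕ b} refl (trans (ℕ.*-zeroʳ (χℕ (N e))) (sym (ℕ.*-zeroʳ (χℕ (M e)))))
        kN≤kN′ : k N ≤ k N′
        kN≤kN′ = ℕ.+-cancelʳ-≤ (inM N R) _ _ (ℕ.≤-trans (ℕ.+-monoʳ-≤ (k N) inN≤inM) (ℕ.≤-reflexive (sym k-swap)))
        eqs : wt w′ M′ ≡ wt w′ M × k M′ ≡ k M
        eqs = exchange-arith {B = wt w′ N} {wt w′ N′} {b = k N} {k N′} (swap-wt w′ R M N) (swap-wt (χℕ ∘ ξ) R M N)
          (ℕ.≤-trans (ℕ.≤-reflexive (sym (lower-wt w ξ (proj₂ qN′))))
            (ℕ.≤-trans (proj₂ oN N′ (proj₁ qN′)) (ℕ.≤-reflexive (lower-wt w ξ pN))))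
          kN≤kN′ (ℕ.≤-trans (max₁ M′ qM′) (ℕ.≤-reflexive (sym eqw)))
        bM′ : Best M′
        bM′ = qM′ , trans (proj₁ eqs) eqw , trans (proj₂ eqs) eqk
        ¬M′x : ¬ Cov M′ x
        ¬M′x (e , p , q) = ¬Nx (e , trans (sym (swap-in ag q Rx)) p , q)
        ¬M′ : ∀ {y} → R y ≡ false → ¬ Cov M y → ¬ Cov M′ y
        ¬M′ Ry ¬y (e , p , q) = ¬y (e , trans (sym (swap-out ag q Ry)) p , q)
        finish : ⊥
        -- Only `z` can be missed by `M` in `R`, so `u` or `v` lies outside. That one is still
        -- missed by the best matching `M′`, together with `x`.
        finish with R u in Ru | R v in Rv
        ... | false | _ = r₁ M′ bM′ (¬M′ Ru ¬u) ¬M′x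
        ... | true | false = r₂ M′ bM′ ¬M′x (¬M′ Rv ¬v)
        ... | true | true = u≢v (trans (missed-z u Ru ¬u) (sym (missed-z v Rv ¬v)))

    all-Rel : ∀ v → U v ≡ true → Rel a v
    all-Rel v Uv = ⌊⌋⁻ (Rel? a v) (proj₂ (∧-true {U v} (U-least X X-closed (∧-intro Ua (⌊⌋⁺ (Rel? a a) (inj₁ refl))) v Uv)))
      where
      X : VS
      X v = U v ∧ ⌊ Rel? a v ⌋
      X-closed : PosClosed X
      X-closed e pe = iff→≡ fwd bwd
        where
        fwd : X (s e) ≡ true → X (t e) ≡ true
        fwd p = let us , r = ∧-true {U (s e)} p
                in ∧-intro (trans (sym (U-closed e pe)) us)
                   (⌊⌋⁺ (Rel? a (t e)) (Rel-trans us (⌊⌋⁻ (Rel? a (s e)) r) (Rel-adj e pe us)))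
        bwd : X (t e) ≡ true → X (s e) ≡ true
        bwd p = let ut , r = ∧-true {U (t e)} p
                    us = trans (U-closed e pe) ut
                in ∧-intro us (⌊⌋⁺ (Rel? a (s e)) (Rel-trans ut (⌊⌋⁻ (Rel? a (t e)) r) (Rel-sym (Rel-adj e pe us))))

    U≤ : cnt U ≤ 1 + (k M₀ + k M₀)
    U≤ = subst (λ x → cnt U ≤ 1 + (x + x)) (sym (k-in (proj₂ Q₀)))
      (size≤ (proj₁ Q₀) U (λ e p → ¬true λ cr → let y , z , ye , ze , Uy , Uz = cross-elim U e cr in true≢false (U-noncross (proj₂ Q₀) p ye ze Uy) Uz)
        λ {u} {v} Uu Uv ¬u ¬v → uniq ¬u ¬v (Rel-trans Ua (Rel-sym (all-Rel u Uu)) (all-Rel v Uv)))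
      where
      uniq : ∀ {u v} → ¬ Cov M₀ u → ¬ Cov M₀ v → Rel u v → u ≡ v
      uniq ¬u ¬v (inj₁ p) = p
      uniq ¬u ¬v (inj₂ h) = ⊥-elim (h M₀ (Q₀ , refl , refl) ¬u ¬v)

    in-pos≤ : ∀ M → inM (pos w M) U ≤ inM M U
    in-pos≤ M = ∑ℕ-mono λ e → ℕ.*-monoˡ-≤ (χℕ (ins U e)) (χℕ-mono (pos-⊆ w M e))

    k₀≤ : ∀ M → Opt w M → k M₀ ≤ k (pos w M)
    k₀≤ M o = ℕ.+-cancelˡ-≤ (wt w′ M₀) _ _ (begin
      wt w′ M₀ + k M₀ ≡⟨ lower-wt w ξ (proj₂ Q₀) ⟨
      wt w M₀ ≤⟨ proj₂ (Opt-pos o) M₀ (proj₁ Q₀) ⟩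
      wt w (pos w M) ≡⟨ lower-wt w ξ (pos-Pos w M) ⟩
      wt w′ (pos w M) + k (pos w M) ≤⟨ ℕ.+-monoˡ-≤ _ (max₁ _ (Q-pos (proj₁ o))) ⟩
      wt w′ M₀ + k (pos w M) ∎)
      where open ℕ.≤-Reasoning

    k₀≤in : ∀ M → Opt w M → k M₀ ≤ inM M U
    k₀≤in M o = ℕ.≤-trans (k₀≤ M o) (ℕ.≤-trans (ℕ.≤-reflexive (k-in (pos-Pos w M))) (in-pos≤ M))

    -- Some optimum misses `a`, so twice its number of edges inside `U` stays below the size of `U`;
    -- and this number is at least `k M₀`.
    U-size : cnt U ≡ 1 + (k M₀ + k M₀)
    U-size = let M , o , ¬a = miss a
                 le = k₀≤in M o
             in ℕ.≤-antisym U≤ (ℕ.≤-trans (s≤s (ℕ.+-mono-≤ le le)) (in< (proj₁ o) U Ua ¬a))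

    in≡k₀ : ∀ M → Opt w M → inM M U ≡ k M₀
    in≡k₀ M o = ℕ.≤-antisym (half-≤ (ℕ.≤-trans (in≤ (proj₁ o) U) U≤)) (k₀≤in M o)

    k≡k₀ : ∀ M → Opt w M → k (pos w M) ≡ k M₀
    k≡k₀ M o = ℕ.≤-antisym (ℕ.≤-trans (ℕ.≤-reflexive (k-in (pos-Pos w M))) (ℕ.≤-trans (in-pos≤ M) (ℕ.≤-reflexive (in≡k₀ M o)))) (k₀≤ M o)

    U-tight : ∀ M → Opt w M → cnt U ≡ 1 + (inM M U + inM M U)
    U-tight M o rewrite in≡k₀ M o = U-size

    reduction : ∀ c → Balanced w c → Reduction w c
    reduction c (h₁ , h₂ , h₃) = record
      { w′ = w′ ; ξ = ins U ; opt = opt ; smaller = lower-< w ξ e₀ w₀ Ua ; split = split ; zeroξ = h₃ U U-tight }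
      where
      opt : ∀ M → Opt w M → Opt w′ M
      opt M o = proj₁ o , λ N mN → begin
        wt w′ N ≡⟨ pos-wt w w′ N (lower-zero w ξ) ⟨
        wt w′ (pos w N) ≤⟨ max₁ _ (Q-pos mN) ⟩
        wt w′ M₀ ≤⟨ ℕ.+-cancelʳ-≤ (k M₀) _ _ (begin
          wt w′ M₀ + k M₀ ≡⟨ lower-wt w ξ (proj₂ Q₀) ⟨
          wt w M₀ ≤⟨ proj₂ (Opt-pos o) M₀ (proj₁ Q₀) ⟩
          wt w (pos w M) ≡⟨ lower-wt w ξ (pos-Pos w M) ⟩
          wt w′ (pos w M) + k (pos w M) ≡⟨ cong (wt w′ (pos w M) +_) (k≡k₀ M o) ⟩
          wt w′ (pos w M) + k M₀ ∎) ⟩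
        wt w′ (pos w M) ≡⟨ pos-wt w w′ M (lower-zero w ξ) ⟩
        wt w′ M ∎
        where open ℕ.≤-Reasoning
      split : ∀ e → c e ≢ 0ℤ → w e ≡ w′ e + χℕ (ins U e)
      split e ne with 1 ℕ.≤? w e
      ... | yes p = trans (lower-split w ξ e p) (cong (λ b → w′ e + χℕ b) (sym (same (U (s e)) (U (t e)) (U-closed e p))))
        where
        same : ∀ x y → x ≡ y → x ∧ y ≡ x
        same true _ refl = refl
        same false _ refl = refl
      ... | no ¬p with ins U e in iU
      ... | false = trans (ℕ.n<1⇒n≡0 (ℕ.≰⇒> ¬p)) (sym (trans (ℕ.+-identityʳ _) (lower-zero w ξ e (ℕ.n<1⇒n≡0 (ℕ.≰⇒> ¬p)))))
      -- An edge of weight 0 inside `U` and in an optimum would be dropped by `pos`; but the optimum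
      -- and its positive part have the same number `k M₀` of edges inside `U`.
      ... | true with h₁ e ne
      ... | M , o , Me = ⊥-elim (ℕ.<-irrefl (trans (sym (k-in (pos-Pos w M))) (trans (k≡k₀ M o) (sym (in≡k₀ M o)))) in-lt)
        where
        in-lt : inM (pos w M) U < inM M U
        in-lt = ∑ℕ-mono-< (λ f → ℕ.*-monoˡ-≤ (χℕ (ins U f)) (χℕ-mono (pos-⊆ w M f))) e lt
          where
          lt : χℕ (pos w M e) * χℕ (ins U e) < χℕ (M e) * χℕ (ins U e)
          lt rewrite iU | Me with 1 ℕ.≤? w e
          ... | yes q = ⊥-elim (¬p q)
          ... | no _ = s≤s z≤n

  -- The Cunningham–Marsh formula in orthogonal form.
  duality : ∀ w c → Balanced w c → ⟪ w , c ⟫ ≡ 0ℤ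
  duality w c = go (∑ℕ w) w ℕ.≤-refl
    where
    go : ∀ b w → ∑ℕ w ≤ b → Balanced w c → ⟪ w , c ⟫ ≡ 0ℤ
    reduce : ∀ b w → ∑ℕ w ≤ b → Balanced w c → Reduction w c → ⟪ w , c ⟫ ≡ 0ℤ
    reduce zero w le bal r = ⊥-elim (ℕ.n≮0 (ℕ.<-≤-trans (Reduction.smaller r) le))
    reduce (suc b) w le (h₁ , h₂ , h₃) r = trans (trans (ΣZ.∑-cong pt) (ΣZ.∑-+ _ _)) (cong₂ ℤ._+_ ih zeroξ)
      where
      open Reduction r
      ih : ⟪ w′ , c ⟫ ≡ 0ℤ
      ih = go b w′ (ℕ.≤-pred (ℕ.≤-trans smaller le))
        ((λ e ne → let M , o , p = h₁ e ne in M , opt M o , p) , h₂ , λ U h → h₃ U (λ M o → h M (opt M o)))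
      pt : ∀ e → ℤ.+ w e ℤ.* c e ≡ ℤ.+ w′ e ℤ.* c e ℤ.+ c e ℤ.* χℤ (ξ e)
      pt e with c e ℤ.≟ 0ℤ
      ... | yes p rewrite p = trans (ℤ.*-zeroʳ (ℤ.+ w e)) (sym (trans (ℤ.+-identityʳ _) (ℤ.*-zeroʳ (ℤ.+ w′ e))))
      ... | no ne rewrite split e ne with ξ e
      ... | true = trans (ℤ.*-distribʳ-+ (c e) (ℤ.+ w′ e) (ℤ.+ 1)) (cong (λ x → ℤ.+ w′ e ℤ.* c e ℤ.+ x) (ℤ.*-comm (ℤ.+ 1) (c e)))
      ... | false rewrite ℕ.+-identityʳ (w′ e) = sym (trans (cong (λ x → ℤ.+ w′ e ℤ.* c e ℤ.+ x) (ℤ.*-zeroʳ (c e))) (ℤ.+-identityʳ _))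
    go b w le bal with any? (λ e → 1 ℕ.≤? w e)
    ... | no ¬p = ΣZ.∑-0 λ e → cong (ℤ._* c e) (cong ℤ.+_ (ℕ.n<1⇒n≡0 (ℕ.≰⇒> (λ q → ¬p (e , q)))))
    ... | yes (e₀ , w₀) with any? (λ u → ¬? (anyFun? {P = λ M → Opt w M × ¬ Cov M u} (λ eq (x , y) → Opt-resp eq x , y ∘ Cov-resp (sym ∘ eq))
                                                     (λ M → Opt? w M ×-dec ¬? (Cov? M u))))
    ... | yes (u , ¬e) = reduce b w le bal (CoveredVertex.reduction w u (λ M o → decidable-stable (Cov? M u) (λ ¬c → ¬e (M , o , ¬c))) c bal)
    ... | no ¬all = reduce b w le bal (MissedVertices.reduction w e₀ w₀
            (λ u → decidable-stable (anyFun? (λ eq (x , y) → Opt-resp eq x , y ∘ Cov-resp (sym ∘ eq)) (λ M → Opt? w M ×-dec ¬? (Cov? M u)))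
                                    (λ ¬e → ¬all (u , ¬e))) c bal)

-- Faces, tight sets and uncrossing

allFuns : ∀ k → List (Fin k → Bool)
allFuns zero = (λ ()) ∷ []
allFuns (suc k) = map (λ f → λ { zero → true ; (suc i) → f i }) (allFuns k) ++ map (λ f → λ { zero → false ; (suc i) → f i }) (allFuns k)

allFuns-complete : ∀ {k} (f : Fin k → Bool) → ∃ λ g → g ∈ allFuns k × g ≗ f
allFuns-complete {zero} f = _ , here refl , λ ()
allFuns-complete {suc k} f with allFuns-complete (f ∘ suc) | f zero in eq
... | g , g∈ , e | true  = _ , ∈-++⁺ˡ (∈-map⁺ _ g∈) , λ { zero → sym eq ; (suc i) → e i }
... | g , g∈ , e | false = _ , ∈-++⁺ʳ (map _ (allFuns k)) (∈-map⁺ _ g∈) , λ { zero → sym eq ; (suc i) → e i }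

par : ℕ → Bool
par zero    = false
par (suc k) = not (par k)

par-+ : ∀ a b → par (a + b) ≡ par a xor par b
par-+ zero b = refl
par-+ (suc a) b rewrite par-+ a b with par a
... | true = not-involutive (par b)
... | false = refl

par-double : ∀ a b → par (a + (b + b)) ≡ par a
par-double a b rewrite par-+ a (b + b) | par-+ b b with par a | par b
... | true | true = refl
... | true | false = refl
... | false | true = refl
... | false | false = refl

odd-split : ∀ x y d → x + y + (d + d) ≡ 2 → par x ≡ true → x ≡ 1 × y ≡ 1 × d ≡ 0
odd-split 1 y d e p with d
... | zero = refl , trans (sym (ℕ.+-identityʳ y)) (ℕ.suc-injective e) , refl
... | suc d′ = ⊥-elim (ℕ.<-irrefl (sym (ℕ.suc-injective e)) (ℕ.≤-trans (s≤s (ℕ.≤-trans (s≤s z≤n) (ℕ.m≤n+m (suc d′) d′))) (ℕ.m≤n+m _ y)))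
odd-split (suc (suc (suc x))) y d ()

subset-≥ : ∀ {k} {p q : Fin k → Bool} → (∀ i → p i ≡ true → q i ≡ true) → cnt q ≤ cnt p → ∀ i → q i ≡ true → p i ≡ true
subset-≥ {p = p} h le i qi with p i in eq
... | true = refl
... | false = ⊥-elim (ℕ.<⇒≱ (cnt-strict h i eq qi) le)

double≡0 : ∀ x → x ℤ.+ x ≡ 0ℤ → x ≡ 0ℤ
double≡0 (ℤ.+ zero) _ = refl

module Faces {n m : ℕ} (Γ : Multigraph n m) where

  open Multigraph Γ

  open Matchings Γ
  open Duality Γ using (⟪_,_⟫; duality; Opt; Balanced)

  Min : (Fin m → ℕ) → ES → Set
  Min W M = PM M × (∀ N → PM N → wt W M ≤ wt W N)

  Min-resp : ∀ {W} → Respects≗ (Min W)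
  Min-resp {W} eq (a , b) = PM-resp eq a , λ N pN → subst (_≤ wt W N) (wt-resp W eq) (b N pN)

  Min? : ∀ W M → Dec (Min W M)
  Min? W M = PM? M ×-dec allFun? (λ eq h pN → subst (wt W M ≤_) (wt-resp W eq) (h (PM-resp (sym ∘ eq) pN)))
                                 (λ N → PM? N →? (wt W M ℕ.≤? wt W N))

  Min-exists : ∀ W → ∃ PM → ∃ (Min W)
  Min-exists W e = argmin PM-resp PM? (wt W) (wt-resp W) e

  Min-wt : ∀ {W M N} → Min W M → Min W N → wt W M ≡ wt W N
  Min-wt (a , b) (c , d) = ℕ.≤-antisym (b _ c) (d _ a)

  Min-swap : ∀ {W} P {M N} → AgreeOnCut P M N → Min W M → Min W N → Min W (swap P M N)
  Min-swap {W} P {M} {N} ag mM mN = swap-PM {P} ag (proj₁ mM) (proj₁ mN) , λ K pK → ℕ.≤-trans le (proj₂ mM K pK)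
    where
    le : wt W (swap P M N) ≤ wt W M
    le = ℕ.+-cancelʳ-≤ (wt W N) _ _ (ℕ.≤-trans
      (ℕ.+-monoʳ-≤ _ (proj₂ mN _ (swap-PM {P} (λ e c → sym (ag e c)) (proj₁ mN) (proj₁ mM)))) (ℕ.≤-reflexive (swap-wt W P M N)))

  Tight : (Fin m → ℕ) → VS → Set
  Tight W S = ∀ M → Min W M → cutM M S ≡ 1

  cutM-resp : ∀ {M N} S → M ≗ N → cutM M S ≡ cutM N S
  cutM-resp S eq = ΣN.∑-cong (λ e → cong (λ b → χℕ b * χℕ (cross S e)) (eq e))

  cross-cong : ∀ {S T : VS} → S ≗ T → ∀ e → cross S e ≡ cross T e
  cross-cong eq e = cong₂ _xor_ (eq (s e)) (eq (t e))

  Tight-cong : ∀ {W S T} → S ≗ T → Tight W S → Tight W T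
  Tight-cong eq h M mM = trans (ΣN.∑-cong (λ e → cong (λ b → χℕ (M e) * χℕ b) (sym (cross-cong eq e)))) (h M mM)

  cut-cong : ∀ c {S T : VS} → S ≗ T → HZ.cut c S ≡ HZ.cut c T
  cut-cong c eq = ΣZ.∑-cong (λ e → cong (λ b → c e ℤ.* χℤ b) (cross-cong eq e))

  Tight? : ∀ W S → Dec (Tight W S)
  Tight? W S = allFun? (λ eq h mM → trans (sym (cutM-resp S eq)) (h (Min-resp (sym ∘ eq) mM)))
                       (λ M → Min? W M →? (cutM M S ℕ.≟ 1))

  Tight-star : ∀ {W} v → Tight W (star v)
  Tight-star v M ((mat , cov) , _) = ℕ.≤-antisym (deg≤1 mat v) (deg≥1 (cov v))

  crossing-edge : ∀ {M S} → cutM M S ≡ 1 → ∃ λ e → M e ≡ true × cross S e ≡ true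
  crossing-edge {M} {S} h with cnt-exists _ (subst (1 ≤_) (trans (sym h) (cutM-cnt M S)) ℕ.≤-refl)
  ... | e , p = e , ∧-true p

  crossing-unique : ∀ {M} S → cutM M S ≡ 1 → ∀ {e f} → M e ≡ true → cross S e ≡ true → M f ≡ true → cross S f ≡ true → e ≡ f
  crossing-unique {M} S h p q r u = cnt≤1→unique _ (ℕ.≤-reflexive (trans (sym (cutM-cnt M S)) h)) (∧-intro p q) (∧-intro r u)

  InFace : (Fin m → ℕ) → Fin m → Set
  InFace W e = ∃ λ M → Min W M × M e ≡ true

  InFace? : ∀ W e → Dec (InFace W e)
  InFace? W e = anyFun? (λ eq (a , b) → Min-resp eq a , trans (sym (eq e)) b) (λ M → Min? W M ×-dec (M e Bool.≟ true))

  Supported : (Fin m → ℕ) → (Fin m → ℤ) → Set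
  Supported W c = ∀ e → c e ≢ 0ℤ → InFace W e

  full : VS
  full _ = true

  -- Complementing the weight to `K ∸ W e` turns minimum perfect matchings into maximum matchings:
  -- an imperfect matching has an edge fewer and so loses `K`, which is at least the total of `W`.
  -- The constant `K` contributes nothing, because by the handshake identity `c` sums to 0 over all
  -- edges.
  orthogonal : ∀ W c → Supported W c → (∀ S → Tight W S → HZ.cut c S ≡ 0ℤ) → ⟪ W , c ⟫ ≡ 0ℤ
  orthogonal W c supp bal = begin
    ⟪ W , c ⟫ ≡⟨ ℤ.+-identityˡ _ ⟨
    0ℤ ℤ.+ ⟪ W , c ⟫ ≡⟨ cong (ℤ._+ ⟪ W , c ⟫) (duality w c balanced) ⟨
    ⟪ w , c ⟫ ℤ.+ ⟪ W , c ⟫ ≡⟨ ΣZ.∑-+ _ _ ⟨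
    ∑ℤ (λ e → ℤ.+ w e ℤ.* c e ℤ.+ ℤ.+ W e ℤ.* c e) ≡⟨ ΣZ.∑-cong pt ⟩
    ∑ℤ (λ e → ℤ.+ K ℤ.* (c e ℤ.* ℤ.+ 1)) ≡⟨ ΣZ.∑-* (ℤ.+ K) _ ⟩
    ℤ.+ K ℤ.* HZ.inner c full ≡⟨ cong (ℤ.+ K ℤ.*_) (inner≡0 full (ΣZ.∑-0 (λ e → ℤ.*-zeroʳ (c e)))) ⟩
    ℤ.+ K ℤ.* 0ℤ ≡⟨ ℤ.*-zeroʳ (ℤ.+ K) ⟩
    0ℤ ∎
    where
    open ≡-Reasoning
    K : ℕ
    K = ∑ℕ W
    w : Fin m → ℕ
    w e = K ∸ W e
    W≤K : ∀ e → W e ≤ K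
    W≤K = term≤∑ℕ W
    pt : ∀ e → ℤ.+ w e ℤ.* c e ℤ.+ ℤ.+ W e ℤ.* c e ≡ ℤ.+ K ℤ.* (c e ℤ.* ℤ.+ 1)
    pt e = trans (sym (ℤ.*-distribʳ-+ (c e) (ℤ.+ w e) (ℤ.+ W e)))
                 (cong₂ ℤ._*_ (cong ℤ.+_ (ℕ.m∸n+n≡m (W≤K e))) (sym (ℤ.*-identityʳ (c e))))
    inner≡0 : ∀ S → HZ.cut c S ≡ 0ℤ → HZ.inner c S ≡ 0ℤ
    inner≡0 S h = double≡0 _ (begin
      HZ.inner c S ℤ.+ HZ.inner c S ≡⟨ ℤ.+-identityˡ _ ⟨
      0ℤ ℤ.+ (HZ.inner c S ℤ.+ HZ.inner c S) ≡⟨ cong (ℤ._+ (HZ.inner c S ℤ.+ HZ.inner c S)) h ⟨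
      HZ.cut c S ℤ.+ (HZ.inner c S ℤ.+ HZ.inner c S) ≡⟨ HZ.handshake c S ⟨
      ∑ℤ (λ v → χℤ (S v) ℤ.* HZ.cut c (HZ.star v)) ≡⟨ ΣZ.∑-0 (λ v → trans (cong (χℤ (S v) ℤ.*_) (bal (star v) (Tight-star v))) (ℤ.*-zeroʳ (χℤ (S v)))) ⟩
      0ℤ ∎)
    total : ∀ N → wt w N + wt W N ≡ K * inM N full
    total N = trans (sym (ΣN.∑-+ _ _)) (trans (ΣN.∑-cong λ e → trans (sym (ℕ.*-distribˡ-+ (χℕ (N e)) (w e) (W e)))
      (trans (cong (χℕ (N e) *_) (ℕ.m∸n+n≡m (W≤K e))) (trans (ℕ.*-comm (χℕ (N e)) K) (cong (K *_) (sym (ℕ.*-identityʳ _)))))) (ΣN.∑-* K _))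
    size : ∀ {N} → PM N → cnt full ≡ inM N full + inM N full
    size {N} pN = trans (size-PM pN full) (cong (_+ (inM N full + inM N full)) (ΣN.∑-0 (λ e → ℕ.*-zeroʳ (χℕ (N e)))))
    halves : ∀ {a b} → a + a ≡ b + b → a ≡ b
    halves {a} {b} e = ℕ.≤-antisym (half-≤ (ℕ.≤-trans (ℕ.≤-reflexive e) (ℕ.n≤1+n _))) (half-≤ (ℕ.≤-trans (ℕ.≤-reflexive (sym e)) (ℕ.n≤1+n _)))
    Min⇒Opt : ∀ {M} → Min W M → Opt w M
    Min⇒Opt {M} (pM , hM) = proj₁ pM , λ N mN → cmp N mN
      where
      cmp : ∀ N → Mat N → wt w N ≤ wt w M
      cmp N mN with all? (Cov? N)
      ... | yes cov = ℕ.+-cancelʳ-≤ (wt W N) _ _ (ℕ.≤-trans (ℕ.≤-reflexive (trans (total N)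
              (trans (cong (K *_) (halves (trans (sym (size (mN , cov))) (size pM)))) (sym (total M))))) (ℕ.+-monoʳ-≤ (wt w M) (hM N (mN , cov))))
      ... | no ¬cov with any? (λ v → ¬? (Cov? N v))
      ...   | no ¬e = ⊥-elim (¬cov λ v → decidable-stable (Cov? N v) (λ ¬c → ¬e (v , ¬c)))
      ...   | yes (v , ¬c) = ℕ.+-cancelʳ-≤ K _ _ (ℕ.≤-trans (ℕ.+-monoˡ-≤ K (ℕ.≤-trans (ℕ.m≤m+n _ (wt W N)) (ℕ.≤-reflexive (total N))))
              (ℕ.≤-trans (ℕ.≤-reflexive (trans (ℕ.+-comm _ K) (sym (ℕ.*-suc K _))))
              (ℕ.≤-trans (ℕ.*-monoʳ-≤ K lt) (ℕ.≤-trans (ℕ.≤-reflexive (sym (total M))) (ℕ.+-monoʳ-≤ (wt w M) (wt≤∑ W M))))))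
        where
        lt : inM N full < inM M full
        lt = ℕ.≰⇒> λ le → ℕ.<⇒≱ (in< mN full {v} refl ¬c) (ℕ.≤-trans (ℕ.≤-reflexive (size pM)) (ℕ.+-mono-≤ le le))
    balanced : Balanced w c
    balanced = (λ e ne → let M , mM , Me = supp e ne in M , Min⇒Opt mM , Me)
             , (λ v → bal (star v) (Tight-star v))
             , λ U h → inner≡0 U (bal U λ M mM → ℕ.+-cancelʳ-≡ (inM M U + inM M U) _ _
                 (trans (sym (size-PM (proj₁ mM) U)) (h M (Min⇒Opt mM))))

  Lam : VS → VS → Set
  Lam S T = (∀ v → S v ≡ true → T v ≡ true) ⊎ (∀ v → T v ≡ true → S v ≡ true) ⊎ (∀ v → S v ≡ true → T v ≡ true → ⊥)

  Lam-sym : ∀ {S T} → Lam S T → Lam T S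
  Lam-sym (inj₁ a) = inj₂ (inj₁ a)
  Lam-sym (inj₂ (inj₁ a)) = inj₁ a
  Lam-sym (inj₂ (inj₂ a)) = inj₂ (inj₂ λ v x y → a v y x)

  Lam? : ∀ S T → Dec (Lam S T)
  Lam? S T = all? (λ v → (S v Bool.≟ true) →? (T v Bool.≟ true))
    ⊎-dec (all? (λ v → (T v Bool.≟ true) →? (S v Bool.≟ true))
    ⊎-dec all? (λ v → (S v Bool.≟ true) →? ((T v Bool.≟ true) →? no λ ())))

  infixr 7 _∩_ _∖_
  infixr 6 _∪_
  _∩_ _∪_ _∖_ : VS → VS → VS
  (S ∩ T) v = S v ∧ T v
  (S ∪ T) v = S v ∨ T v
  (S ∖ T) v = S v ∧ not (T v)

  compl : VS → VS
  compl S v = not (S v)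

  record Crossing (S T : VS) : Set where
    field
      {b x y} : Fin n
      Sb : S b ≡ true
      Tb : T b ≡ true
      Sx : S x ≡ true
      Tx : T x ≡ false
      Ty : T y ≡ true
      Sy : S y ≡ false

  crossing-sets : ∀ {S T} → ¬ Lam S T → Crossing S T
  crossing-sets {S} {T} h with any? (λ v → (S v Bool.≟ true) ×-dec (T v Bool.≟ true)) | any? (λ v → (S v Bool.≟ true) ×-dec (T v Bool.≟ false))
                             | any? (λ v → (T v Bool.≟ true) ×-dec (S v Bool.≟ false))
  ... | yes (_ , p , q) | yes (_ , p′ , q′) | yes (_ , p″ , q″) =
        record { Sb = p ; Tb = q ; Sx = p′ ; Tx = q′ ; Ty = p″ ; Sy = q″ }
  ... | no ¬e | _ | _ = ⊥-elim (h (inj₂ (inj₂ λ v p q → ¬e (v , p , q))))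
  ... | _ | no ¬e | _ = ⊥-elim (h (inj₁ λ v p → aux v p))
    where
    aux : ∀ v → S v ≡ true → T v ≡ true
    aux v p with T v in eq
    ... | true = refl
    ... | false = ⊥-elim (¬e (v , p , eq))
  ... | _ | _ | no ¬e = ⊥-elim (h (inj₂ (inj₁ λ v p → aux v p)))
    where
    aux : ∀ v → T v ≡ true → S v ≡ true
    aux v p with S v in eq
    ... | true = refl
    ... | false = ⊥-elim (¬e (v , p , eq))

  lam-∩ : ∀ {S T Y} → Lam S Y → Lam T Y → Lam (S ∩ T) Y
  lam-∩ (inj₁ a) _ = inj₁ λ v p → a v (proj₁ (∧-true p))
  lam-∩ {S} _ (inj₁ b) = inj₁ λ v p → b v (proj₂ (∧-true {S v} p))
  lam-∩ (inj₂ (inj₂ a)) _ = inj₂ (inj₂ λ v p → a v (proj₁ (∧-true p)))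
  lam-∩ {S} _ (inj₂ (inj₂ b)) = inj₂ (inj₂ λ v p → b v (proj₂ (∧-true {S v} p)))
  lam-∩ (inj₂ (inj₁ a)) (inj₂ (inj₁ b)) = inj₂ (inj₁ λ v p → ∧-intro (a v p) (b v p))

  lam-∪ : ∀ {S T Y} → Crossing S T → Lam S Y → Lam T Y → Lam (S ∪ T) Y
  lam-∪ {S} {T} {Y} c = go
    where
    open Crossing c
    either : ∀ {Z : Set} v → (S v ≡ true → Z) → (T v ≡ true → Z) → (S ∪ T) v ≡ true → Z
    either v f g p with ∨-true {S v} p
    ... | inj₁ q = f q
    ... | inj₂ q = g q
    go : Lam S Y → Lam T Y → Lam (S ∪ T) Y
    go (inj₁ p) (inj₁ q) = inj₁ λ v → either v (p v) (q v)
    go (inj₂ (inj₁ p)) _ = inj₂ (inj₁ λ v r → ∨-introˡ (p v r))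
    go _ (inj₂ (inj₁ q)) = inj₂ (inj₁ λ v r → ∨-introʳ {S v} (q v r))
    go (inj₂ (inj₂ p)) (inj₂ (inj₂ q)) = inj₂ (inj₂ λ v → either v (p v) (q v))
    go (inj₁ p) (inj₂ (inj₂ q)) = ⊥-elim (q b Tb (p b Sb))
    go (inj₂ (inj₂ p)) (inj₁ q) = ⊥-elim (p b Sb (q b Tb))

  lam-∖ : ∀ {S T Y} → Crossing S T → Lam S Y → Lam T Y → Lam (S ∖ T) Y
  lam-∖ {S} {T} {Y} c = go
    where
    open Crossing c
    notT : ∀ v → (S ∖ T) v ≡ true → T v ≡ true → ⊥
    notT v p q = true≢false (proj₂ (∧-true {S v} p)) (cong not q)
    go : Lam S Y → Lam T Y → Lam (S ∖ T) Y
    go (inj₁ p) _ = inj₁ λ v r → p v (proj₁ (∧-true r))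
    go (inj₂ (inj₂ p)) _ = inj₂ (inj₂ λ v r → p v (proj₁ (∧-true r)))
    go (inj₂ (inj₁ p)) (inj₁ q) = ⊥-elim (true≢false (p y (q y Ty)) Sy)
    go (inj₂ (inj₁ p)) (inj₂ (inj₁ q)) = inj₂ (inj₂ λ v r u → notT v r (q v u))
    go (inj₂ (inj₁ p)) (inj₂ (inj₂ q)) = inj₂ (inj₁ λ v u → ∧-intro (p v u) (cong not (¬true λ r → q v r u)))

  Crossing-sym : ∀ {S T} → Crossing S T → Crossing T S
  Crossing-sym c = record { Sb = Tb ; Tb = Sb ; Sx = Ty ; Tx = Sy ; Ty = Sx ; Sy = Tx }
    where open Crossing c

  par-cut : ∀ {M} → PM M → ∀ S → par (cutM M S) ≡ par (cnt S)
  par-cut {M} pM S = sym (trans (cong par (size-PM pM S)) (par-double (cutM M S) (inM M S)))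

  module Uncross (W : Fin m → ℕ) (c : Fin m → ℤ) (supp : Supported W c) where

    private
      -- The edges between the two set differences; twice their number is the defect in the
      -- submodularity of cuts.
      bad : VS → VS → ES
      bad S T e = (S (s e) ∧ not (T (s e)) ∧ not (S (t e)) ∧ T (t e)) ∨ (not (S (s e)) ∧ T (s e) ∧ S (t e) ∧ not (T (t e)))

      χ-id : ∀ a b a′ b′ → χℕ (a xor a′) + χℕ (b xor b′)
        ≡ χℕ ((a ∧ b) xor (a′ ∧ b′)) + χℕ ((a ∨ b) xor (a′ ∨ b′))
          + (χℕ ((a ∧ not b ∧ not a′ ∧ b′) ∨ (not a ∧ b ∧ a′ ∧ not b′)) + χℕ ((a ∧ not b ∧ not a′ ∧ b′) ∨ (not a ∧ b ∧ a′ ∧ not b′)))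
      χ-id true  true  true  true  = refl
      χ-id true  true  true  false = refl
      χ-id true  true  false true  = refl
      χ-id true  true  false false = refl
      χ-id true  false true  true  = refl
      χ-id true  false true  false = refl
      χ-id true  false false true  = refl
      χ-id true  false false false = refl
      χ-id false true  true  true  = refl
      χ-id false true  true  false = refl
      χ-id false true  false true  = refl
      χ-id false true  false false = refl
      χ-id false false true  true  = refl
      χ-id false false true  false = refl
      χ-id false false false true  = refl
      χ-id false false false false = refl

      +χ : ∀ b → ℤ.+ χℕ b ≡ χℤ b
      +χ true  = refl
      +χ false = refl

      cut-id : ∀ M S T → cutM M S + cutM M T ≡ cutM M (S ∩ T) + cutM M (S ∪ T) + (∑ℕ (λ e → χℕ (M e) * χℕ (bad S T e)) + ∑ℕ (λ e → χℕ (M e) * χℕ (bad S T e)))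
      cut-id M S T = trans (sym (ΣN.∑-+ _ _)) (trans (ΣN.∑-cong pt) (trans (ΣN.∑-+ _ _) (cong₂ _+_ (ΣN.∑-+ _ _) (ΣN.∑-+ _ _))))
        where
        pt : ∀ e → χℕ (M e) * χℕ (cross S e) + χℕ (M e) * χℕ (cross T e)
                 ≡ χℕ (M e) * χℕ (cross (S ∩ T) e) + χℕ (M e) * χℕ (cross (S ∪ T) e) + (χℕ (M e) * χℕ (bad S T e) + χℕ (M e) * χℕ (bad S T e))
        pt e with M e
        ... | false = refl
        ... | true = trans (cong₂ _+_ (ℕ.*-identityˡ (χℕ (cross S e))) (ℕ.*-identityˡ (χℕ (cross T e)))) (trans (χ-id (S (s e)) (T (s e)) (S (t e)) (T (t e)))
           (sym (cong₂ _+_ (cong₂ _+_ (ℕ.*-identityˡ (χℕ (cross (S ∩ T) e))) (ℕ.*-identityˡ (χℕ (cross (S ∪ T) e)))) (cong₂ _+_ (ℕ.*-identityˡ (χℕ (bad S T e))) (ℕ.*-identityˡ (χℕ (bad S T e)))))))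

    -- A minimiser has an odd cut at the odd intersection, and the cuts and the defect add up to 2.
    -- Both cuts are therefore 1, and no minimiser uses a bad edge. As `c` lives on edges of
    -- minimisers, its cuts have no defect either.
    uncross : ∀ S T → Tight W S → Tight W T → par (cnt (S ∩ T)) ≡ true →
              Tight W (S ∩ T) × Tight W (S ∪ T) × HZ.cut c S ℤ.+ HZ.cut c T ≡ HZ.cut c (S ∩ T) ℤ.+ HZ.cut c (S ∪ T)
    uncross S T tS tT odd = (λ M mM → proj₁ (facts M mM)) , (λ M mM → proj₁ (proj₂ (facts M mM))) ,
        trans (sym (ΣZ.∑-+ _ _)) (trans (ΣZ.∑-cong pt) (ΣZ.∑-+ _ _))
      where
      facts : ∀ M → Min W M → cutM M (S ∩ T) ≡ 1 × cutM M (S ∪ T) ≡ 1 × ∑ℕ (λ e → χℕ (M e) * χℕ (bad S T e)) ≡ 0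
      facts M mM = odd-split (cutM M (S ∩ T)) (cutM M (S ∪ T)) _ (trans (sym (cut-id M S T)) (cong₂ _+_ (tS M mM) (tT M mM)))
                             (trans (par-cut (proj₁ mM) (S ∩ T)) odd)
      pt : ∀ e → c e ℤ.* χℤ (cross S e) ℤ.+ c e ℤ.* χℤ (cross T e) ≡ c e ℤ.* χℤ (cross (S ∩ T) e) ℤ.+ c e ℤ.* χℤ (cross (S ∪ T) e)
      pt e with c e ℤ.≟ 0ℤ
      ... | yes p rewrite p = refl
      ... | no ne with supp e ne
      ... | M , mM , Me = trans (sym (ℤ.*-distribˡ-+ (c e) (χℤ (cross S e)) (χℤ (cross T e))))
                            (trans (cong (c e ℤ.*_) eqχ) (ℤ.*-distribˡ-+ (c e) (χℤ (cross (S ∩ T) e)) (χℤ (cross (S ∪ T) e))))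
        where
        nobad : χℕ (bad S T e) ≡ 0
        nobad = trans (sym (ℕ.*-identityˡ _)) (trans (cong (λ b → χℕ b * χℕ (bad S T e)) (sym Me)) (∑ℕ≡0 _ (proj₂ (proj₂ (facts M mM))) e))
        eqχ : χℤ (cross S e) ℤ.+ χℤ (cross T e) ≡ χℤ (cross (S ∩ T) e) ℤ.+ χℤ (cross (S ∪ T) e)
        eqχ = trans (cong₂ ℤ._+_ (sym (+χ (cross S e))) (sym (+χ (cross T e)))) (trans (cong ℤ.+_ (trans (χ-id (S (s e)) (T (s e)) (S (t e)) (T (t e)))
          (trans (cong₂ _+_ {x = χℕ (cross (S ∩ T) e) + χℕ (cross (S ∪ T) e)} refl (cong₂ _+_ nobad nobad)) (ℕ.+-identityʳ _)))) (cong₂ ℤ._+_ (+χ (cross (S ∩ T) e)) (+χ (cross (S ∪ T) e))))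

    cross-compl : ∀ S e → cross (compl S) e ≡ cross S e
    cross-compl S e with S (s e) | S (t e)
    ... | true | true = refl
    ... | true | false = refl
    ... | false | true = refl
    ... | false | false = refl

    Tight-cross : ∀ {S T} → (∀ e → cross S e ≡ cross T e) → Tight W S → Tight W T
    Tight-cross eq h M mM = trans (ΣN.∑-cong (λ e → cong (λ b → χℕ (M e) * χℕ b) (sym (eq e)))) (h M mM)

    cut-cross : ∀ {S T : VS} → (∀ e → cross S e ≡ cross T e) → HZ.cut c S ≡ HZ.cut c T
    cut-cross eq = ΣZ.∑-cong (λ e → cong (λ b → c e ℤ.* χℤ b) (eq e))

    -- This is `uncross` for `S` and the complement of `T`, which has the same cut as `T`. A
    -- minimiser crosses `S` once, so `S` is odd, and an even intersection leaves an odd difference.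
    uncross-∖ : ∀ S T → Tight W S → Tight W T → par (cnt (S ∩ T)) ≡ false → ∃ (Min W) →
              Tight W (S ∖ T) × Tight W (T ∖ S) × HZ.cut c S ℤ.+ HZ.cut c T ≡ HZ.cut c (S ∖ T) ℤ.+ HZ.cut c (T ∖ S)
    uncross-∖ S T tS tT even (M₀ , m₀) =
      let a , b , e = uncross S (compl T) tS (Tight-cross {T} {compl T} (sym ∘ cross-compl T) tT) odd
      in a , Tight-cross {S ∪ compl T} {T ∖ S} same b , trans (cong (λ z → HZ.cut c S ℤ.+ z) (sym (cut-cross {compl T} {T} (cross-compl T))))
           (trans e (cong (λ z → HZ.cut c (S ∖ T) ℤ.+ z) (cut-cross {S ∪ compl T} {T ∖ S} same)))
      where
      same : ∀ e → cross (S ∪ compl T) e ≡ cross (T ∖ S) e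
      same e with S (s e) | S (t e) | T (s e) | T (t e)
      ... | true | true | true | true = refl
      ... | true | true | true | false = refl
      ... | true | true | false | true = refl
      ... | true | true | false | false = refl
      ... | true | false | true | true = refl
      ... | true | false | true | false = refl
      ... | true | false | false | true = refl
      ... | true | false | false | false = refl
      ... | false | true | true | true = refl
      ... | false | true | true | false = refl
      ... | false | true | false | true = refl
      ... | false | true | false | false = refl
      ... | false | false | true | true = refl
      ... | false | false | true | false = refl
      ... | false | false | false | true = refl
      ... | false | false | false | false = refl
      odd : par (cnt (S ∖ T)) ≡ true
      odd = aux (par (cnt (S ∩ T))) (par (cnt (S ∖ T))) even (trans (sym (trans (cong par split) (par-+ (cnt (S ∩ T)) _))) oddS)
        where
        aux : ∀ a b → a ≡ false → a xor b ≡ true → b ≡ true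
        aux _ b refl p = p
        split : cnt S ≡ cnt (S ∩ T) + cnt (S ∖ T)
        split = cnt-+ (S ∩ T) (S ∖ T) S pt
          where
          pt : ∀ v → χℕ (S v) ≡ χℕ (S v ∧ T v) + χℕ (S v ∧ not (T v))
          pt v with S v | T v
          ... | true | true = refl
          ... | true | false = refl
          ... | false | _ = refl
        oddS : par (cnt S) ≡ true
        oddS = trans (sym (par-cut (proj₁ m₀) S)) (cong par (tS M₀ m₀))

  record MaxLaminar (W : Fin m → ℕ) (L : List VS) : Set where
    field
      tight   : ∀ {S} → S ∈ L → Tight W S
      lam     : ∀ {S T} → S ∈ L → T ∈ L → Lam S T
      maximal : ∀ S → Tight W S → (∀ {T} → T ∈ L → Lam S T) → ∃ λ T → T ∈ L × T ≗ S

  -- `Ls` holds the members of `L` that `S` may still cross. Uncrossing with one of them gives two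
  -- tight sets that no longer cross it and cross nothing in `L` that `S` did not; `isolate`
  -- recovers the cut at `S` from the other three.
  balanced-on-tight : ∀ {W L} → MaxLaminar W L → ∃ (Min W) → ∀ c → Supported W c →
    (∀ {T} → T ∈ L → HZ.cut c T ≡ 0ℤ) → ∀ S → Tight W S → HZ.cut c S ≡ 0ℤ
  balanced-on-tight {W} {L} ML nonempty c supp bal S tS = go L (λ p → p) S tS (λ p → inj₂ p)
    where
    open MaxLaminar ML
    open Uncross W c supp
    isolate : ∀ {a b x y} → a ℤ.+ b ≡ x ℤ.+ y → b ≡ 0ℤ → x ≡ 0ℤ → y ≡ 0ℤ → a ≡ 0ℤ
    isolate {a} e refl refl refl = trans (sym (ℤ.+-identityʳ a)) e
    go : ∀ Ls → (∀ {Y} → Y ∈ Ls → Y ∈ L) → ∀ S → Tight W S → (∀ {Y} → Y ∈ L → Lam S Y ⊎ Y ∈ Ls) → HZ.cut c S ≡ 0ℤ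
    go [] sub S tS h = let T , T∈ , eq = maximal S tS (λ p → lift (h p)) in trans (cut-cong c (sym ∘ eq)) (bal T∈)
      where
      lift : ∀ {Y} → Lam S Y ⊎ Y ∈ [] → Lam S Y
      lift (inj₁ p) = p
    go (T ∷ Ls) sub S tS h with Lam? S T
    ... | yes l = go Ls (sub ∘ there) S tS λ p → drop (h p)
      where
      drop : ∀ {Y} → Lam S Y ⊎ Y ∈ (T ∷ Ls) → Lam S Y ⊎ Y ∈ Ls
      drop (inj₁ p) = inj₁ p
      drop (inj₂ (here refl)) = inj₁ l
      drop (inj₂ (there p)) = inj₂ p
    ... | no ¬l = cases (par (cnt (S ∩ T))) refl
      where
      T∈L : T ∈ L
      T∈L = sub (here refl)
      cr : Crossing S T
      cr = crossing-sets ¬l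
      ih : ∀ X → Tight W X → Lam X T → (∀ {Y} → Lam S Y → Lam T Y → Lam X Y) → HZ.cut c X ≡ 0ℤ
      ih X tX lX tr = go Ls (sub ∘ there) X tX λ p → step p (h p)
        where
        step : ∀ {Y} → Y ∈ L → Lam S Y ⊎ Y ∈ (T ∷ Ls) → Lam X Y ⊎ Y ∈ Ls
        step Y∈ (inj₁ p) = inj₁ (tr p (lam T∈L Y∈))
        step Y∈ (inj₂ (here refl)) = inj₁ lX
        step Y∈ (inj₂ (there p)) = inj₂ p
      cases : ∀ p → par (cnt (S ∩ T)) ≡ p → HZ.cut c S ≡ 0ℤ
      cases true odd = let a , b , e = uncross S T tS (tight T∈L) odd in
        isolate e (bal T∈L) (ih (S ∩ T) a (inj₁ λ v p → proj₂ (∧-true {S v} p)) lam-∩)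
                            (ih (S ∪ T) b (inj₂ (inj₁ λ v p → ∨-introʳ {S v} p)) (lam-∪ cr))
      cases false even = let a , b , e = uncross-∖ S T tS (tight T∈L) even nonempty in
        isolate e (bal T∈L) (ih (S ∖ T) a (inj₂ (inj₂ λ v p q → true≢false (proj₂ (∧-true {S v} p)) (cong not q))) (lam-∖ cr))
                            (ih (T ∖ S) b (inj₁ λ v p → proj₁ (∧-true p)) (λ x y → lam-∖ (Crossing-sym cr) y x))

  -- Each subset is tried once. A set rejected for crossing a member stays rejected, since the
  -- family only grows.
  extend : ∀ W L → (∀ {S} → S ∈ L → Tight W S) → (∀ {S T} → S ∈ L → T ∈ L → Lam S T) →
           ∃ λ L′ → MaxLaminar W L′ × (∀ {S} → S ∈ L → S ∈ L′)
  extend W L tight lam with go (allFuns n) L tight lam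
    where
    Result : List VS → List VS → Set
    Result xs L = ∃ λ L′ → (∀ {S} → S ∈ L′ → Tight W S) × (∀ {S T} → S ∈ L′ → T ∈ L′ → Lam S T) × (∀ {S} → S ∈ L → S ∈ L′)
      × (∀ {S} → S ∈ xs → Tight W S → (∀ {T} → T ∈ L′ → Lam S T) → S ∈ L′)
    go : ∀ xs L → (∀ {S} → S ∈ L → Tight W S) → (∀ {S T} → S ∈ L → T ∈ L → Lam S T) → Result xs L
    go [] L ti la = L , ti , la , (λ p → p) , λ ()
    go (x ∷ xs) L ti la with Tight? W x ×-dec All.all? (Lam? x) L
    ... | yes (tx , lx) = let L′ , a , b , c , d = go xs (x ∷ L) ti′ la′ in L′ , a , b , (c ∘ there) , λ { (here refl) _ _ → c (here refl) ; (there p) → d p }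
      where
      ti′ : ∀ {S} → S ∈ (x ∷ L) → Tight W S
      ti′ (here refl) = tx
      ti′ (there p) = ti p
      la′ : ∀ {S T} → S ∈ (x ∷ L) → T ∈ (x ∷ L) → Lam S T
      la′ (here refl) (here refl) = inj₁ λ _ p → p
      la′ (here refl) (there q) = All.lookup lx q
      la′ (there p) (here refl) = Lam-sym (All.lookup lx p)
      la′ (there p) (there q) = la p q
    ... | no ¬p = let L′ , a , b , c , d = go xs L ti la in L′ , a , b , c , λ { (here refl) tx lx → ⊥-elim (¬p (tx , All.tabulate (λ q → lx (c q)))) ; (there p) → d p }
  ... | L′ , a , b , c , d = L′ , record { tight = a ; lam = b ; maximal = max } , c
    where
    Lam-cong : ∀ {S S′ T} → S ≗ S′ → Lam S T → Lam S′ T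
    Lam-cong eq (inj₁ p) = inj₁ λ v q → p v (trans (eq v) q)
    Lam-cong eq (inj₂ (inj₁ p)) = inj₂ (inj₁ λ v q → trans (sym (eq v)) (p v q))
    Lam-cong eq (inj₂ (inj₂ p)) = inj₂ (inj₂ λ v q → p v (trans (eq v) q))
    max : ∀ S → Tight W S → (∀ {T} → T ∈ L′ → Lam S T) → ∃ λ T → T ∈ L′ × T ≗ S
    max S tS h = let T , T∈ , eq = allFuns-complete S in T , d T∈ (Tight-cong (sym ∘ eq) tS) (λ q → Lam-cong (sym ∘ eq) (h q)) , eq

-- Moduli separating a list of vectors

bin : ℕ → ℕ → ℕ
bin _       zero    = 1
bin zero    (suc k) = 0
bin (suc n) (suc k) = bin n k + bin n (suc k)

absorb : ∀ n k → suc k * bin (suc n) (suc k) ≡ suc n * bin n k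
absorb zero zero = refl
absorb zero (suc k) = ℕ.*-zeroʳ (suc (suc k))
absorb (suc n) zero = trans (lemma (bin (suc n) 1)) (trans (cong (1 +_) (absorb n 0)) (lemma′ n))
  where
  lemma : ∀ x → 1 * (1 + x) ≡ 1 + 1 * x
  lemma = solve-ℕ
  lemma′ : ∀ n → 1 + suc n * 1 ≡ suc (suc n) * 1
  lemma′ = solve-ℕ
absorb (suc n) (suc k) = begin
  suc (suc k) * (P + Q)                ≡⟨ lemma k P Q ⟩
  (suc k * P + P) + suc (suc k) * Q    ≡⟨ cong₂ (λ x y → (x + P) + y) (absorb n k) (absorb n (suc k)) ⟩
  (suc n * p + P) + suc n * q          ≡⟨ lemma′ n p q ⟩
  suc (suc n) * (p + q)                ∎
  where
  open ≡-Reasoning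
  P = bin (suc n) (suc k)
  Q = bin (suc n) (suc (suc k))
  p = bin n k
  q = bin n (suc k)
  lemma : ∀ k P Q → suc (suc k) * (P + Q) ≡ (suc k * P + P) + suc (suc k) * Q
  lemma = solve-ℕ
  lemma′ : ∀ n p q → (suc n * p + (p + q)) + suc n * q ≡ suc (suc n) * (p + q)
  lemma′ = solve-ℕ

-- The step is the recursion 1/((k+1) C(t,k+1)) = 1/(k C(t−1,k)) − 1/(k C(t,k)) of the Leibniz harmonic triangle.
k*bin∣ : ∀ {N} k t → (∀ j → 1 ≤ j → j ≤ t → j ∣ N) → suc k ≤ t → suc k * bin t (suc k) ∣ N
k*bin∣ {N} zero t h le = subst (_∣ N) (sym (bin1 t le)) (h t le ℕ.≤-refl)
  where
  bin1 : ∀ t → 1 ≤ t → 1 * bin t 1 ≡ t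
  bin1 (suc t) _ = trans (absorb t 0) (ℕ.*-identityʳ (suc t))
k*bin∣ {N} (suc k) (suc p) h (s≤s le) = subst (_∣ N) (sym (absorb p (suc k))) (*-cancelˡ-∣ (suc k) (∣m+n∣m⇒∣n {m = j * (D * y)} d₁ d₂))
  where
  j = suc k
  P = bin p j
  C = bin (suc p) j
  D = suc p * P
  ihx : j * P ∣ N
  ihx = k*bin∣ k p (λ i a b → h i a (ℕ.m≤n⇒m≤1+n b)) le
  ihy : j * C ∣ N
  ihy = k*bin∣ k (suc p) h (ℕ.m≤n⇒m≤1+n le)
  x y : ℕ
  x = _∣_.quotient ihx
  y = _∣_.quotient ihy
  ex : N ≡ x * (j * P)
  ex = _∣_.equality ihx
  ey : N ≡ y * (j * C)
  ey = _∣_.equality ihy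
  C-eq : D + j * C ≡ suc p * C
  C-eq = trans (cong (D +_) (absorb p k)) (trans (sym (ℕ.*-distribˡ-+ (suc p) P (bin p k))) (cong (suc p *_) (ℕ.+-comm P (bin p k))))
  d₂ : j * D ∣ j * (D * y)
  d₂ = divides y (r j D y)
    where
    r : ∀ j D y → j * (D * y) ≡ y * (j * D)
    r = solve-ℕ
  eq : j * (D * y) + j * N ≡ x * (j * D)
  eq = begin
    j * (D * y) + j * N                ≡⟨ cong (λ z → j * (D * y) + j * z) ey ⟩
    j * (D * y) + j * (y * (j * C))    ≡⟨ r₁ j D y C ⟩
    y * j * (D + j * C)                ≡⟨ cong (y * j *_) C-eq ⟩
    y * j * (suc p * C)                ≡⟨ r₂ y j (suc p) C ⟩
    suc p * (y * (j * C))              ≡⟨ cong (suc p *_) (trans (sym ey) ex) ⟩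
    suc p * (x * (j * P))              ≡⟨ r₃ (suc p) x j P ⟩
    x * (j * D)                        ∎
    where
    open ≡-Reasoning
    r₁ : ∀ j D y C → j * (D * y) + j * (y * (j * C)) ≡ y * j * (D + j * C)
    r₁ = solve-ℕ
    r₂ : ∀ y j q C → y * j * (q * C) ≡ q * (y * (j * C))
    r₂ = solve-ℕ
    r₃ : ∀ q x j P → q * (x * (j * P)) ≡ x * (j * (q * P))
    r₃ = solve-ℕ
  d₁ : j * D ∣ j * (D * y) + j * N
  d₁ = divides x eq

central-bin : ∀ r → 2 ^ r ≤ bin (r + r) r
central-bin zero = ℕ.≤-refl
central-bin (suc r) rewrite ℕ.+-suc r r = ℕ.+-mono-≤ (ℕ.≤-trans (central-bin r) (left r))
    (ℕ.≤-trans (ℕ.≤-reflexive (ℕ.+-identityʳ _)) (ℕ.≤-trans (central-bin r) (ℕ.m≤m+n _ _)))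
  where
  left : ∀ r → bin (r + r) r ≤ bin (suc (r + r)) r
  left zero = ℕ.≤-refl
  left (suc r) = ℕ.m≤n+m _ (bin (suc (r + suc r)) r)

-- By `k*bin∣`, `N` is a multiple of `r` times the central binomial coefficient of row `r + r`.
2^≤common-multiple : ∀ r N → 1 ≤ N → 1 ≤ r → (∀ j → 1 ≤ j → j ≤ r + r → j ∣ N) → 2 ^ r ≤ N
2^≤common-multiple (suc r) N pos _ h = ℕ.≤-trans (central-bin (suc r)) (ℕ.≤-trans (ℕ.m≤m+n _ _)
    (∣⇒≤ {{ℕ.>-nonZero pos}} (k*bin∣ r (suc r + suc r) h (ℕ.m≤m+n _ _))))

product-∣ : ∀ {k x} xs → x ∈ xs → k ∣ x → k ∣ product xs
product-∣ (x ∷ xs) (here refl) d = ∣m⇒∣m*n (product xs) d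
product-∣ (x ∷ xs) (there p) d = ∣n⇒∣m*n x (product-∣ xs p d)

product-bounds : ∀ b xs → (∀ {x} → x ∈ xs → 1 ≤ x × x ≤ 2 ^ b) → 1 ≤ product xs × product xs ≤ 2 ^ (b * length xs)
product-bounds b [] h = ℕ.≤-refl , ℕ.≤-reflexive (sym (cong (2 ^_) (ℕ.*-zeroʳ b)))
product-bounds b (x ∷ xs) h =
  let l , u = h (here refl)
      l′ , u′ = product-bounds b xs (h ∘ there)
  in ℕ.*-mono-≤ l l′ , ℕ.≤-trans (ℕ.*-mono-≤ u u′) (ℕ.≤-reflexive (trans (sym (ℕ.^-distribˡ-+-* 2 b _)) (cong (2 ^_) (sym (ℕ.*-suc b _)))))

-- Otherwise each number from 2 to `t` divides an entry, hence the product of all entries, which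
-- would be at least `2 ^ r`; the sizes of the entries keep it smaller.
common-nondivisor : ∀ b r t xs → (∀ {x} → x ∈ xs → 1 ≤ x × x ≤ 2 ^ b) → b * length xs < r → r + r ≤ t →
  ∃ λ k → 2 ≤ k × k ≤ t × (∀ {x} → x ∈ xs → ¬ k ∣ x)
common-nondivisor b r t xs h lt le with ℕ.anyUpTo? (λ k → (2 ℕ.≤? k) ×-dec ¬? (Any.any? (k ∣?_) xs)) (suc t)
... | yes (k , k<t , k≥2 , ¬any) = k , k≥2 , ℕ.≤-pred k<t , λ x∈ d → ¬any (Any.map (λ { refl → d }) x∈)
... | no ¬ex = ⊥-elim (ℕ.<⇒≱ (ℕ.≤-<-trans (proj₂ bounds) (ℕ.^-monoʳ-< 2 (s≤s (s≤s z≤n)) lt))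
                 (2^≤common-multiple r (product xs) (proj₁ bounds) (ℕ.≤-trans (s≤s z≤n) lt) div))
  where
  bounds = product-bounds b xs h
  div : ∀ j → 1 ≤ j → j ≤ r + r → j ∣ product xs
  div j 1≤j j≤ with 2 ℕ.≤? j
  ... | no ¬2 = subst (_∣ product xs) (ℕ.≤-antisym 1≤j (ℕ.≤-pred (ℕ.≰⇒> ¬2))) (1∣ product xs)
  ... | yes 2≤j with Any.any? (j ∣?_) xs
  ... | yes any = let x , x∈ , d = find any in product-∣ xs x∈ d
  ... | no ¬any = ⊥-elim (¬ex (j , s≤s (ℕ.≤-trans j≤ le) , 2≤j , ¬any))

module Horner (B : ℕ) where

  horner : ∀ {m} → (Fin m → ℤ) → ℤ
  horner c = ∑ℤ (λ e → c e ℤ.* ℤ.+ (B ^ toℕ e))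

  opaque
    unfolding ΣZ.∑

    horner-suc : ∀ {m} (c : Fin (suc m) → ℤ) → horner c ≡ c zero ℤ.+ ℤ.+ B ℤ.* horner (c ∘ suc)
    horner-suc c = cong₂ ℤ._+_ (ℤ.*-identityʳ (c zero))
      (trans (ΣZ.∑-cong (λ e → step (c (suc e)) (B ^ toℕ e))) (ΣZ.∑-* (ℤ.+ B) (λ e → c (suc e) ℤ.* ℤ.+ (B ^ toℕ e))))
      where
      step : ∀ x p → x ℤ.* ℤ.+ (B * p) ≡ ℤ.+ B ℤ.* (x ℤ.* ℤ.+ p)
      step x p = trans (cong (x ℤ.*_) (ℤ.pos-* B p)) (trans (sym (ℤ.*-assoc x (ℤ.+ B) (ℤ.+ p)))
        (trans (cong (ℤ._* ℤ.+ p) (ℤ.*-comm x (ℤ.+ B))) (ℤ.*-assoc (ℤ.+ B) x (ℤ.+ p))))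

    horner-[] : ∀ (c : Fin 0 → ℤ) → horner c ≡ 0ℤ
    horner-[] c = refl

  horner-bound : ∀ {m} (c : Fin m → ℤ) → (∀ e → ∣ c e ∣ < B) → ∣ horner c ∣ < B ^ m
  horner-bound {zero} c h rewrite horner-[] c = ℕ.≤-refl
  horner-bound {suc m} c h rewrite horner-suc c = begin-strict
    ∣ c zero ℤ.+ ℤ.+ B ℤ.* H ∣      ≤⟨ ℤ.∣i+j∣≤∣i∣+∣j∣ (c zero) (ℤ.+ B ℤ.* H) ⟩
    ∣ c zero ∣ + ∣ ℤ.+ B ℤ.* H ∣    ≡⟨ cong (∣ c zero ∣ +_) (ℤ.abs-* (ℤ.+ B) H) ⟩
    ∣ c zero ∣ + B * ∣ H ∣          <⟨ ℕ.+-monoˡ-< (B * ∣ H ∣) (h zero) ⟩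
    B + B * ∣ H ∣                   ≡⟨ ℕ.*-suc B ∣ H ∣ ⟨
    B * suc ∣ H ∣                   ≤⟨ ℕ.*-monoʳ-≤ B (horner-bound (c ∘ suc) (h ∘ suc)) ⟩
    B * B ^ m                       ∎
    where
    open ℕ.≤-Reasoning
    H = horner (c ∘ suc)

  -- The lowest digit is a multiple of `B` and smaller than `B` in absolute value, so it vanishes,
  -- and so does the numeral formed by the rest. Signs of digits do not matter.
  horner≡0 : ∀ {m} (c : Fin m → ℤ) → (∀ e → ∣ c e ∣ < B) → horner c ≡ 0ℤ → ∀ e → c e ≡ 0ℤ
  horner≡0 {suc m} c h eq = λ { zero → c₀ ; (suc e) → horner≡0 (c ∘ suc) (h ∘ suc) H≡0 e }
    where
    H = horner (c ∘ suc)
    sum0 : c zero ℤ.+ ℤ.+ B ℤ.* H ≡ 0ℤ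
    sum0 = trans (sym (horner-suc c)) eq
    abs-eq : ∣ c zero ∣ ≡ B * ∣ H ∣
    abs-eq = trans (cong ∣_∣ (i≡-j (c zero) (ℤ.+ B ℤ.* H) sum0)) (trans (ℤ.∣-i∣≡∣i∣ (ℤ.+ B ℤ.* H)) (ℤ.abs-* (ℤ.+ B) H))
      where
      i≡-j : ∀ i j → i ℤ.+ j ≡ 0ℤ → i ≡ ℤ.- j
      i≡-j i j p = trans (sym (ℤ.+-identityʳ i)) (trans (cong (λ z → i ℤ.+ z) (sym (ℤ.+-inverseʳ j)))
        (trans (sym (ℤ.+-assoc i j (ℤ.- j))) (trans (cong (ℤ._+ ℤ.- j) p) (ℤ.+-identityˡ (ℤ.- j)))))
    H≡0 : H ≡ 0ℤ
    H≡0 with ∣ H ∣ in q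
    ... | zero = ℤ.∣i∣≡0⇒i≡0 q
    ... | suc k = ⊥-elim (ℕ.<⇒≱ (h zero) (subst (B ≤_) (sym (trans abs-eq (cong (B *_) q))) (ℕ.m≤m*n B (suc k))))
    c₀ : c zero ≡ 0ℤ
    c₀ = ℤ.∣i∣≡0⇒i≡0 (trans abs-eq (trans (cong (λ z → B * ∣ z ∣) H≡0) (ℕ.*-zeroʳ B)))

  -- The exponents start at 1, as in `wk`.
  shifted : ∀ {m} → (Fin m → ℤ) → ℤ
  shifted c = ∑ℤ (λ e → c e ℤ.* ℤ.+ (B ^ (toℕ e + 1)))

  shifted-horner : ∀ {m} (c : Fin m → ℤ) → shifted c ≡ ℤ.+ B ℤ.* horner c
  shifted-horner c = trans (ΣZ.∑-cong (λ e → step (c e) (toℕ e))) (ΣZ.∑-* (ℤ.+ B) (λ e → c e ℤ.* ℤ.+ (B ^ toℕ e)))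
    where
    step : ∀ x p → x ℤ.* ℤ.+ (B ^ (p + 1)) ≡ ℤ.+ B ℤ.* (x ℤ.* ℤ.+ (B ^ p))
    step x p rewrite ℕ.+-comm p 1 = trans (cong (x ℤ.*_) (ℤ.pos-* B (B ^ p))) (trans (sym (ℤ.*-assoc x (ℤ.+ B) (ℤ.+ (B ^ p))))
        (trans (cong (ℤ._* ℤ.+ (B ^ p)) (ℤ.*-comm x (ℤ.+ B))) (ℤ.*-assoc (ℤ.+ B) x (ℤ.+ (B ^ p)))))

  shifted-mod : ∀ {m} (c : Fin m → ℤ) k → ∑ℤ (λ e → c e ℤ.* ℤ.+ (B ^ (toℕ e + 1) % suc k)) ≡ 0ℤ → suc k ∣ ∣ shifted c ∣
  shifted-mod c k h = divides ∣ q ∣ (trans (cong ∣_∣ eq) (trans (ℤ.abs-* (ℤ.+ suc k) q) (ℕ.*-comm (suc k) ∣ q ∣)))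
    where
    q = ∑ℤ (λ e → c e ℤ.* ℤ.+ (B ^ (toℕ e + 1) / suc k))
    pt : ∀ x p → x ℤ.* ℤ.+ p ≡ x ℤ.* ℤ.+ (p % suc k) ℤ.+ ℤ.+ suc k ℤ.* (x ℤ.* ℤ.+ (p / suc k))
    pt x p = trans (cong (λ z → x ℤ.* ℤ.+ z) (trans (m≡m%n+[m/n]*n p (suc k)) (cong (p % suc k +_) (ℕ.*-comm (p / suc k) (suc k)))))
      (trans (ℤ.*-distribˡ-+ x (ℤ.+ (p % suc k)) (ℤ.+ (suc k * (p / suc k))))
        (cong (λ z → x ℤ.* ℤ.+ (p % suc k) ℤ.+ z)
          (trans (cong (x ℤ.*_) (ℤ.pos-* (suc k) (p / suc k))) (trans (sym (ℤ.*-assoc x (ℤ.+ suc k) (ℤ.+ (p / suc k))))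
            (trans (cong (ℤ._* ℤ.+ (p / suc k)) (ℤ.*-comm x (ℤ.+ suc k))) (ℤ.*-assoc (ℤ.+ suc k) x (ℤ.+ (p / suc k))))))))
    eq : shifted c ≡ ℤ.+ suc k ℤ.* q
    eq = trans (ΣZ.∑-cong (λ e → pt (c e) (B ^ (toℕ e + 1)))) (trans (ΣZ.∑-+ _ _)
      (trans (cong₂ ℤ._+_ h (ΣZ.∑-* (ℤ.+ suc k) (λ e → c e ℤ.* ℤ.+ (B ^ (toℕ e + 1) / suc k)))) (ℤ.+-identityˡ _)))

  separating-modulus : ∀ {m} b r t (Z : List (Fin m → ℤ)) → 1 ≤ B → (∀ {c} → c ∈ Z → ∀ e → ∣ c e ∣ < B) →
    B ^ suc m ≤ 2 ^ b → b * length Z < r → r + r ≤ t →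
    ∃ λ k → 2 ≤ suc k × suc k ≤ t ×
      (∀ {c} → c ∈ Z → ∑ℤ (λ e → c e ℤ.* ℤ.+ (B ^ (toℕ e + 1) % suc k)) ≡ 0ℤ → ∀ e → c e ≡ 0ℤ)
  separating-modulus {m} b r t Z 1≤B small big lt le
    with common-nondivisor b r t (map val Z) bnd (subst (λ l → b * l < r) (sym (length-map val Z)) lt) le
    where
    val : (Fin m → ℤ) → ℕ
    val c with shifted c ℤ.≟ 0ℤ
    -- A vanishing numeral is replaced by 1, which no modulus from 2 on divides; its vector is zero
    -- by `horner≡0` in any case.
    ... | yes _ = 1
    ... | no _ = ∣ shifted c ∣
    bnd : ∀ {x} → x ∈ map val Z → 1 ≤ x × x ≤ 2 ^ b
    bnd {x} x∈ with ∈-map⁻ val x∈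
    ... | c , c∈ , refl with shifted c ℤ.≟ 0ℤ
    ... | yes _ = ℕ.≤-refl , ℕ.m^n>0 2 b
    ... | no ne = ℕ.n≢0⇒n>0 (ne ∘ ℤ.∣i∣≡0⇒i≡0) , ℕ.≤-trans (subst (λ z → ∣ z ∣ ≤ B ^ suc m) (sym (shifted-horner c))
        (subst (_≤ B ^ suc m) (sym (ℤ.abs-* (ℤ.+ B) (horner c))) (ℕ.*-monoʳ-≤ B (ℕ.<⇒≤ (horner-bound c (small c∈)))))) big
  ... | suc k , k≥2 , k≤t , ¬div = k , k≥2 , k≤t , λ {c} c∈ h → conclude c c∈ h
    where
    conclude : ∀ c → c ∈ Z → ∑ℤ (λ e → c e ℤ.* ℤ.+ (B ^ (toℕ e + 1) % suc k)) ≡ 0ℤ → ∀ e → c e ≡ 0ℤ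
    conclude c c∈ h with shifted c ℤ.≟ 0ℤ | ¬div (∈-map⁺ _ c∈)
    ... | yes eq | _ = horner≡0 c (small c∈) (cancel (trans (sym (shifted-horner c)) eq))
      where
      cancel : ℤ.+ B ℤ.* horner c ≡ 0ℤ → horner c ≡ 0ℤ
      cancel p with ℤ.i*j≡0⇒i≡0∨j≡0 (ℤ.+ B) p
      ... | inj₁ q = ⊥-elim (ℕ.<⇒≢ 1≤B (sym (ℤ.+-injective q)))
      ... | inj₂ q = q
    ... | no ne | ¬d = ⊥-elim (¬d (shifted-mod c k h))

-- Alternating walks

length-cartesian : ∀ {A B C : Set} (f : A → B → C) xs ys → length (cartesianProductWith f xs ys) ≡ length xs * length ys
length-cartesian f [] ys = refl
length-cartesian f (x ∷ xs) ys = trans (length-++ (map (f x) ys)) (cong₂ _+_ (length-map (f x) ys) (length-cartesian f xs ys))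

∑ℤ-neg : ∀ {k} (f : Fin k → ℤ) → ∑ℤ (λ i → ℤ.- f i) ≡ ℤ.- ∑ℤ f
∑ℤ-neg f = trans (ΣZ.∑-cong (λ i → sym (ℤ.-1*i≡-i (f i)))) (trans (ΣZ.∑-* (ℤ.- (ℤ.+ 1)) f) (ℤ.-1*i≡-i (∑ℤ f)))

∑ℤ-minus : ∀ {k} (f g : Fin k → ℤ) → ∑ℤ (λ i → f i - g i) ≡ ∑ℤ f - ∑ℤ g
∑ℤ-minus f g = trans (ΣZ.∑-+ f _) (cong (λ z → ∑ℤ f ℤ.+ z) (∑ℤ-neg g))

*-distribˡ-minus : ∀ a b c → a ℤ.* (b - c) ≡ a ℤ.* b - a ℤ.* c
*-distribˡ-minus = solve-ℤ

anyList? : ∀ {k} {P : List (Fin k × Bool) → Set} → (∀ l → Dec (P l)) → ∀ b → Dec (∃ λ l → length l ≤ b × P l)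
anyList? {P = P} d zero = map′ (λ p → [] , z≤n , p) (λ { ([] , _ , p) → p }) (d [])
anyList? {k} {P} d (suc b) with d []
... | yes p = yes ([] , z≤n , p)
... | no ¬p with any? (λ e → anyList? {P = λ l → P ((e , true) ∷ l)} (λ l → d _) b) | any? (λ e → anyList? {P = λ l → P ((e , false) ∷ l)} (λ l → d _) b)
... | yes (e , l , le , p) | _ = yes (_ , s≤s le , p)
... | no _ | yes (e , l , le , p) = yes (_ , s≤s le , p)
... | no ¬t | no ¬f = no λ { ([] , _ , p) → ¬p p ; ((e , true) ∷ l , s≤s le , p) → ¬t (e , l , le , p) ; ((e , false) ∷ l , s≤s le , p) → ¬f (e , l , le , p) }

sgn : Bool → ℤ → ℤ
sgn true  x = x
sgn false x = ℤ.- x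

module _ {m : ℕ} where

  DE : Set
  DE = Fin m × Bool

  ev : List DE → Bool
  ev []       = true
  ev (d ∷ ds) = not (ev ds)

  alt : (Fin m → ℤ) → List DE → ℤ
  alt φ []       = 0ℤ
  alt φ (d ∷ ds) = φ (proj₁ d) - alt φ ds

  flip : DE → DE
  flip (e , b) = e , not b

  rev : List DE → List DE
  rev []       = []
  rev (d ∷ ds) = rev ds ++ [ flip d ]

  alt-++ : ∀ φ xs ys → alt φ (xs ++ ys) ≡ alt φ xs ℤ.+ sgn (ev xs) (alt φ ys)
  alt-++ φ [] ys = sym (ℤ.+-identityˡ _)
  alt-++ φ (x ∷ xs) ys rewrite alt-++ φ xs ys with ev xs
  ... | true = lemma (φ (proj₁ x)) (alt φ xs) (alt φ ys)
    where
    lemma : ∀ a b c → a - (b ℤ.+ c) ≡ (a - b) ℤ.+ ℤ.- c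
    lemma = solve-ℤ
  ... | false = lemma (φ (proj₁ x)) (alt φ xs) (alt φ ys)
    where
    lemma : ∀ a b c → a - (b ℤ.+ ℤ.- c) ≡ (a - b) ℤ.+ c
    lemma = solve-ℤ

  ev-++ : ∀ xs ys → ev (xs ++ ys) ≡ not (ev xs xor ev ys)
  ev-++ [] ys = sym (not-involutive _)
  ev-++ (x ∷ xs) ys rewrite ev-++ xs ys with ev xs | ev ys
  ... | true | true = refl
  ... | true | false = refl
  ... | false | true = refl
  ... | false | false = refl

  ev-rev : ∀ xs → ev (rev xs) ≡ ev xs
  ev-rev [] = refl
  ev-rev (x ∷ xs) rewrite ev-++ (rev xs) [ flip x ] | ev-rev xs with ev xs
  ... | true = refl
  ... | false = refl

  alt-rev : ∀ φ xs → alt φ (rev xs) ≡ ℤ.- sgn (ev xs) (alt φ xs)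
  alt-rev φ [] = refl
  alt-rev φ (x ∷ xs) rewrite alt-++ φ (rev xs) [ flip x ] | alt-rev φ xs | ev-rev xs with ev xs
  ... | true = lemma (alt φ xs) (φ (proj₁ x))
    where
    lemma : ∀ a b → ℤ.- a ℤ.+ (b - 0ℤ) ≡ ℤ.- (ℤ.- (b - a))
    lemma = solve-ℤ
  ... | false = lemma (alt φ xs) (φ (proj₁ x))
    where
    lemma : ∀ a b → ℤ.- (ℤ.- a) ℤ.+ ℤ.- (b - 0ℤ) ≡ ℤ.- (b - a)
    lemma = solve-ℤ

  alt-bound : ∀ φ → (∀ e → ∣ φ e ∣ ≤ 1) → ∀ ds → ∣ alt φ ds ∣ ≤ length ds
  alt-bound φ h [] = z≤n
  alt-bound φ h (d ∷ ds) = ℕ.≤-trans (ℤ.∣i-j∣≤∣i∣+∣j∣ (φ (proj₁ d)) (alt φ ds)) (ℕ.+-mono-≤ (h (proj₁ d)) (alt-bound φ h ds))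

  raw : Fin m → Fin m → ℤ
  raw g e = χℤ ⌊ e ≟ g ⌋

  alt-linear : ∀ φ ds → alt φ ds ≡ ∑ℤ (λ g → φ g ℤ.* alt (raw g) ds)
  alt-linear φ [] = sym (ΣZ.∑-0 (λ g → ℤ.*-zeroʳ (φ g)))
  alt-linear φ (d ∷ ds) = sym (trans (ΣZ.∑-cong (λ g → *-distribˡ-minus (φ g) (raw g (proj₁ d)) (alt (raw g) ds)))
      (trans (∑ℤ-minus _ _) (cong₂ _-_ (ΣZ.∑-pt (proj₁ d) φ) (sym (alt-linear φ ds)))))

module Walks {n m : ℕ} (s t : Fin m → Fin n) (nd : Fin n → Fin n → Bool)
             (nd-refl : ∀ v → nd v v ≡ true) (nd-eq : ∀ {u v} → nd u v ≡ true → nd u ≗ nd v)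
             (Al : Fin m → Set) where

  nd-sym : ∀ {u v} → nd u v ≡ true → nd v u ≡ true
  nd-sym {u} p = trans (sym (nd-eq p u)) (nd-refl u)

  nd-trans : ∀ {u v w} → nd u v ≡ true → nd v w ≡ true → nd u w ≡ true
  nd-trans {w = w} p q = trans (nd-eq p w) q

  sz : Fin n → ℕ
  sz v = cnt (nd v)

  sz-eq : ∀ {u v} → nd u v ≡ true → sz u ≡ sz v
  sz-eq p = cnt-cong (nd-eq p)

  sz≥1 : ∀ v → 1 ≤ sz v
  sz≥1 v = cnt-pos (nd v) v (nd-refl v)

  tail head : DE {m} → Fin n
  tail (e , true)  = s e
  tail (e , false) = t e
  head (e , true)  = t e
  head (e , false) = s e

  tail-flip : ∀ d → tail (flip d) ≡ head d
  tail-flip (e , true)  = refl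
  tail-flip (e , false) = refl

  head-flip : ∀ d → head (flip d) ≡ tail d
  head-flip (e , true)  = refl
  head-flip (e , false) = refl

  Wk : Fin n → List DE → Fin n → Set
  Wk u []       v = nd u v ≡ true
  Wk u (d ∷ ds) v = nd u (tail d) ≡ true × Al (proj₁ d) × Wk (head d) ds v

  -- Omitting the starting node makes the weight additive and counts each visit of a closed walk
  -- once. Reversal then trades one end node for the other (`wtw-rev`).
  wtw : List DE → ℕ
  wtw []       = 0
  wtw (d ∷ ds) = sz (head d) + wtw ds

  Wk-start : ∀ {u u′} ds {v} → nd u u′ ≡ true → Wk u ds v → Wk u′ ds v
  Wk-start []       p w = nd-trans (nd-sym p) w
  Wk-start (d ∷ ds) p (a , b) = nd-trans (nd-sym p) a , b

  Wk-++ : ∀ {u v w} xs ys → Wk u xs v → Wk v ys w → Wk u (xs ++ ys) w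
  Wk-++ [] ys p q = Wk-start ys (nd-sym p) q
  Wk-++ (x ∷ xs) ys (a , b , p) q = a , b , Wk-++ xs ys p q

  Wk-split : ∀ {u w} xs ys → Wk u (xs ++ ys) w → ∃ λ v → Wk u xs v × Wk v ys w
  Wk-split {u} [] ys p = u , nd-refl u , p
  Wk-split (x ∷ xs) ys (a , b , p) = let v , q , r = Wk-split xs ys p in v , (a , b , q) , r

  Wk-rev : ∀ {u v} ds → Wk u ds v → Wk v (rev ds) u
  Wk-rev [] p = nd-sym p
  Wk-rev {u} (d ∷ ds) (a , b , p) = Wk-++ (rev ds) [ flip d ] (Wk-rev ds p)
    (subst (λ x → nd (head d) x ≡ true) (sym (tail-flip d)) (nd-refl _) , b , subst (λ x → nd x u ≡ true) (sym (head-flip d)) (nd-sym a))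

  wtw-++ : ∀ xs ys → wtw (xs ++ ys) ≡ wtw xs + wtw ys
  wtw-++ [] ys = refl
  wtw-++ (x ∷ xs) ys = trans (cong (sz (head x) +_) (wtw-++ xs ys)) (sym (ℕ.+-assoc (sz (head x)) _ _))

  wtw-rev : ∀ {u v} ds → Wk u ds v → wtw (rev ds) + sz v ≡ wtw ds + sz u
  wtw-rev [] p = sym (sz-eq p)
  wtw-rev {u} {v} (d ∷ ds) (a , b , p) = begin
    wtw (rev ds ++ [ flip d ]) + sz v           ≡⟨ cong (_+ sz v) (wtw-++ (rev ds) [ flip d ]) ⟩
    wtw (rev ds) + (sz (head (flip d)) + 0) + sz v ≡⟨ cong (λ x → wtw (rev ds) + x + sz v) (trans (ℕ.+-identityʳ _) (trans (cong sz (head-flip d)) (sym (sz-eq a)))) ⟩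
    wtw (rev ds) + sz u + sz v                  ≡⟨ ℕ.+-assoc (wtw (rev ds)) _ _ ⟩
    wtw (rev ds) + (sz u + sz v)                ≡⟨ cong (wtw (rev ds) +_) (ℕ.+-comm (sz u) _) ⟩
    wtw (rev ds) + (sz v + sz u)                ≡⟨ ℕ.+-assoc (wtw (rev ds)) _ _ ⟨
    wtw (rev ds) + sz v + sz u                  ≡⟨ cong (_+ sz u) (wtw-rev ds p) ⟩
    wtw ds + sz (head d) + sz u                 ≡⟨ cong (_+ sz u) (ℕ.+-comm (wtw ds) _) ⟩
    sz (head d) + wtw ds + sz u                 ∎
    where open ≡-Reasoning

  length≤wtw : ∀ ds → length ds ≤ wtw ds
  length≤wtw [] = z≤n
  length≤wtw (d ∷ ds) = ℕ.+-mono-≤ (sz≥1 (head d)) (length≤wtw ds)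

  Good : ℕ → Set
  Good l = ∀ u ds → Wk u ds u → ev ds ≡ true → wtw ds ≤ l → ∀ g → alt (raw g) ds ≡ 0ℤ

  Good-all : ∀ {l} → Good l → ∀ u ds → Wk u ds u → ev ds ≡ true → wtw ds ≤ l → ∀ φ → alt φ ds ≡ 0ℤ
  Good-all good u ds w e le φ = trans (alt-linear φ ds) (ΣZ.∑-0 λ g → trans (cong (φ g ℤ.*_) (good u ds w e le g)) (ℤ.*-zeroʳ (φ g)))

  module Counting (Al? : ∀ e → Dec (Al e)) {l : ℕ} (good : Good l) where

    -- Going along `xs` and back along `ys` is a closed even walk, which cancels.
    arc-eq : ∀ {u v} xs ys → Wk u xs v → Wk u ys v → ev xs ≡ ev ys → wtw xs + wtw (rev ys) ≤ l → ∀ φ → alt φ xs ≡ alt φ ys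
    arc-eq {u} xs ys wx wy e le φ = cancel (ev xs) (trans (sym (trans (alt-++ φ xs (rev ys)) (cong (λ z → alt φ xs ℤ.+ sgn (ev xs) z)
        (trans (alt-rev φ ys) (cong (λ b → ℤ.- sgn b (alt φ ys)) (sym e))))))
        (Good-all good u (xs ++ rev ys) (Wk-++ xs (rev ys) wx (Wk-rev ys wy)) even
          (ℕ.≤-trans (ℕ.≤-reflexive (wtw-++ xs (rev ys))) le) φ))
      where
      even : ev (xs ++ rev ys) ≡ true
      even rewrite ev-++ xs (rev ys) | ev-rev ys | e with ev ys
      ... | true = refl
      ... | false = refl
      cancel : ∀ {a b} p → a ℤ.+ sgn p (ℤ.- sgn p b) ≡ 0ℤ → a ≡ b
      cancel {a} {b} true h = ℤ.i-j≡0⇒i≡j a b h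
      cancel {a} {b} false h = ℤ.i-j≡0⇒i≡j a b (trans (cong (λ z → a ℤ.+ z) (sym (ℤ.neg-involutive (ℤ.- b)))) h)

    -- The start node is included in the half budget: one such piece forward and another backward
    -- then weigh at most `l` together.
    Mid : DE → DE → Bool → List DE → Set
    Mid e f p mid = Wk (head e) mid (tail f) × ev mid ≡ p × (sz (head e) + wtw mid) + (sz (head e) + wtw mid) ≤ l

    Wk? : ∀ u ds v → Dec (Wk u ds v)
    Wk? u [] v = nd u v Bool.≟ true
    Wk? u (d ∷ ds) v = (nd u (tail d) Bool.≟ true) ×-dec (Al? (proj₁ d) ×-dec Wk? (head d) ds v)

    Mid? : ∀ e f p → Dec (∃ λ mid → length mid ≤ l × Mid e f p mid)
    Mid? e f p = anyList? (λ mid → Wk? (head e) mid (tail f) ×-dec ((ev mid Bool.≟ p) ×-dec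
      ((sz (head e) + wtw mid) + (sz (head e) + wtw mid) ℕ.≤? l))) l

    infix 4 _≈_
    record _≈_ (xs ys : List (DE {m})) : Set where
      constructor _,_
      field
        ev-≡  : ev xs ≡ ev ys
        alt-≡ : ∀ φ → alt φ xs ≡ alt φ ys
    open _≈_ public

    ≈-++ : ∀ {xs xs′ ys ys′} → xs ≈ xs′ → ys ≈ ys′ → (xs ++ ys) ≈ (xs′ ++ ys′)
    ≈-++ {xs} {xs′} {ys} {ys′} (a , b) (c , d) =
        trans (ev-++ xs ys) (trans (cong₂ (λ p q → not (p xor q)) a c) (sym (ev-++ xs′ ys′)))
      , λ φ → trans (alt-++ φ xs ys) (trans (cong₂ ℤ._+_ (b φ) (cong₂ sgn a (d φ))) (sym (alt-++ φ xs′ ys′)))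

    -- By `arc-eq` a piece is determined, up to `≈`, by its first edge, its last edge and its
    -- parity, so any one piece represents all.
    rep : DE → DE × Bool → List DE
    rep e (f , p) with Mid? e f p
    ... | yes (mid , _) = e ∷ mid ++ [ f ]
    ... | no _          = []

    bools : List Bool
    bools = true ∷ false ∷ []

    ∈-bools : ∀ b → b ∈ bools
    ∈-bools true  = here refl
    ∈-bools false = there (here refl)

    des : List DE
    des = cartesianProductWith _,_ (allFin m) bools

    ∈-des : ∀ d → d ∈ des
    ∈-des (e , b) = ∈-cartesianProductWith⁺ _,_ (∈-allFin e) (∈-bools b)

    blocks : List (List DE)
    -- The empty block pads walks that need fewer blocks.
    blocks = [] ∷ map [_] des ++ cartesianProductWith rep des (cartesianProductWith _,_ des bools)

    candidates : ℕ → List (List DE)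
    candidates zero    = [ [] ]
    candidates (suc k) = cartesianProductWith _++_ blocks (candidates k)

    length-des : length des ≡ m * 2
    length-des = trans (length-cartesian _,_ (allFin m) bools) (cong (_* 2) (length-tabulate {n = m} _))

    length-blocks : length blocks ≡ 1 + (m * 2 + (m * 2) * ((m * 2) * 2))
    length-blocks = cong suc (trans (length-++ (map [_] des)) (cong₂ _+_ (trans (length-map [_] des) length-des)
      (trans (length-cartesian rep des _) (cong₂ _*_ length-des (trans (length-cartesian _,_ des bools) (cong (_* 2) length-des))))))

    length-candidates : ∀ k → length (candidates k) ≡ length blocks ^ k
    length-candidates zero = refl
    length-candidates (suc k) = trans (length-cartesian _++_ blocks (candidates k)) (cong (length blocks *_) (length-candidates k))

    block-short : ∀ {r} → r ∈ blocks → length r ≤ 2 + l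
    block-short (here refl) = z≤n
    block-short (there r∈) with ∈-++⁻ (map [_] des) r∈
    ... | inj₁ p with ∈-map⁻ [_] p
    ...   | d , _ , refl = s≤s z≤n
    block-short (there r∈) | inj₂ p with ∈-cartesianProductWith⁻ rep des _ p
    ... | e , (f , b) , _ , _ , refl with Mid? e f b
    ... | no _ = z≤n
    ... | yes (mid , le , _) = s≤s (ℕ.≤-trans (ℕ.≤-reflexive (trans (length-++ mid) (ℕ.+-comm (length mid) 1))) (s≤s le))

    candidate-short : ∀ k {r} → r ∈ candidates k → length r ≤ k * (2 + l)
    candidate-short zero (here refl) = z≤n
    candidate-short (suc k) r∈ with ∈-cartesianProductWith⁻ _++_ blocks (candidates k) r∈
    ... | x , y , x∈ , y∈ , refl = ℕ.≤-trans (ℕ.≤-reflexive (length-++ x)) (ℕ.+-mono-≤ (block-short x∈) (candidate-short k y∈))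

    block-rep : ∀ {u v} xs f → Wk u (xs ++ [ f ]) v → wtw xs + wtw xs ≤ l → ∃ λ r → r ∈ blocks × r ≈ (xs ++ [ f ])
    block-rep [] f w le = [ f ] , there (∈-++⁺ˡ (∈-map⁺ [_] (∈-des f))) , refl , λ φ → refl
    block-rep (e ∷ mid) f (_ , _ , w) le with Wk-split mid [ f ] w
    ... | x , wm , wf@(xf , _ , _) = rep e (f , ev mid)
        , there (∈-++⁺ʳ (map [_] des) (∈-cartesianProductWith⁺ rep (∈-des e) (∈-cartesianProductWith⁺ _,_ (∈-des f) (∈-bools (ev mid))))) , good-rep
      where
      wm′ : Wk (head e) mid (tail f)
      wm′ = subst (λ z → Wk (head e) z (tail f)) (++-identityʳ mid) (Wk-++ mid [] wm xf)
      good-rep : rep e (f , ev mid) ≈ (e ∷ mid ++ [ f ])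
      good-rep with Mid? e f (ev mid)
      ... | no ¬h = ⊥-elim (¬h (mid , ℕ.≤-trans (length≤wtw mid) (ℕ.≤-trans (ℕ.m≤n+m _ (sz (head e))) (ℕ.≤-trans (ℕ.m≤m+n _ _) le)) , wm′ , refl , le))
      ... | yes (mid′ , _ , w′ , p , le′) = cong not (ev-≡ core) , λ φ → cong (λ z → φ (proj₁ e) - z) (alt-≡ core φ)
        where
        half : ∀ {a b} → a + a ≤ l → b + b ≤ l → a + b ≤ l
        half {a} {b} x y with ℕ.≤-total a b
        ... | inj₁ q = ℕ.≤-trans (ℕ.+-monoˡ-≤ b q) y
        ... | inj₂ q = ℕ.≤-trans (ℕ.+-monoʳ-≤ a q) x
        bound : wtw mid′ + wtw (rev mid) ≤ l
        bound = ℕ.≤-trans (ℕ.+-mono-≤ (ℕ.m≤n+m (wtw mid′) (sz (head e)))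
                  (ℕ.≤-trans (ℕ.m≤m+n _ _) (ℕ.≤-trans (ℕ.≤-reflexive (wtw-rev mid wm′)) (ℕ.≤-reflexive (ℕ.+-comm (wtw mid) _)))))
                (half {sz (head e) + wtw mid′} {sz (head e) + wtw mid} le′ le)
        core : (mid′ ++ [ f ]) ≈ (mid ++ [ f ])
        core = ≈-++ {mid′} {mid} (p , arc-eq mid′ mid w′ wm′ p bound) (refl , λ φ → refl)

    -- `a` is the weight already entered. The block ends with the first edge that exceeds half the
    -- budget, so only the last block of a walk can be light, and without that last edge a block
    -- fits `Mid`.
    take-block : ∀ a d ds → a + a ≤ l → ∃ λ xs → ∃ λ f → ∃ λ rest →
      d ∷ ds ≡ (xs ++ [ f ]) ++ rest × (a + wtw xs) + (a + wtw xs) ≤ l ×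
      (rest ≡ [] ⊎ l < (a + wtw (xs ++ [ f ])) + (a + wtw (xs ++ [ f ])))
    take-block a d [] le = [] , d , [] , refl , subst (λ z → z + z ≤ l) (sym (ℕ.+-identityʳ a)) le , inj₁ refl
    take-block a d (d′ ∷ ds) le with (a + sz (head d)) + (a + sz (head d)) ℕ.≤? l
    ... | no ¬p = [] , d , d′ ∷ ds , refl , subst (λ z → z + z ≤ l) (sym (ℕ.+-identityʳ a)) le
                , inj₂ (subst (λ z → l < (a + z) + (a + z)) (sym (ℕ.+-identityʳ (sz (head d)))) (ℕ.≰⇒> ¬p))
    ... | yes p with take-block (a + sz (head d)) d′ ds p
    ... | xs , f , rest , eq , b , c = d ∷ xs , f , rest , cong (d ∷_) eq
          , subst (λ z → z + z ≤ l) (ℕ.+-assoc a (sz (head d)) (wtw xs)) b , big c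
      where
      big : rest ≡ [] ⊎ l < ((a + sz (head d)) + wtw (xs ++ [ f ])) + ((a + sz (head d)) + wtw (xs ++ [ f ])) → _
      big (inj₁ q) = inj₁ q
      big (inj₂ q) = inj₂ (subst (λ z → l < z + z) (ℕ.+-assoc a (sz (head d)) (wtw (xs ++ [ f ]))) q)

    -- Each block followed by another one uses up more than half of `l`; a walk of weight `2 * l`
    -- therefore has at most four.
    represent : ∀ k {u v} ds → Wk u ds v → wtw ds + wtw ds ≤ k * l → ∃ λ r → r ∈ candidates k × r ≈ ds
    represent zero [] w le = [] , here refl , refl , λ φ → refl
    represent zero (d ∷ ds) w le = ⊥-elim (ℕ.n≮0 (ℕ.≤-trans (sz≥1 (head d)) (ℕ.≤-trans (ℕ.m≤m+n _ (wtw ds)) (ℕ.≤-trans (ℕ.m≤m+n _ _) le))))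
    represent (suc k) {u} {v} [] w le =
      let r , r∈ , p = represent k {u} {v} [] w z≤n
      in r , ∈-cartesianProductWith⁺ _++_ {xs = blocks} (here refl) r∈ , p
    represent (suc k) {u} {v} (d ∷ ds) w le with take-block 0 d ds z≤n
    ... | xs , f , rest , eq , b , c with Wk-split (xs ++ [ f ]) rest (subst (λ z → Wk u z v) eq w)
    ... | x , w₁ , w₂ =
      let r , r∈ , p = block-rep xs f w₁ b
          r′ , r′∈ , p′ = represent k rest w₂ (rest≤ c)
      in r ++ r′ , ∈-cartesianProductWith⁺ _++_ r∈ r′∈ , subst (λ z → (r ++ r′) ≈ z) (sym eq) (≈-++ {r} {xs ++ [ f ]} p p′)
      where
      Y = wtw (xs ++ [ f ])
      le′ : (Y + wtw rest) + (Y + wtw rest) ≤ l + k * l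
      le′ = subst (λ z → z + z ≤ l + k * l) (trans (cong wtw eq) (wtw-++ (xs ++ [ f ]) rest)) le
      rest≤ : rest ≡ [] ⊎ l < Y + Y → wtw rest + wtw rest ≤ k * l
      rest≤ (inj₁ refl) = z≤n
      rest≤ (inj₂ q) = ℕ.+-cancelˡ-≤ l _ _ (ℕ.≤-trans (ℕ.+-monoˡ-≤ _ (ℕ.<⇒≤ q)) (ℕ.≤-trans (ℕ.≤-reflexive (ΣN.interchange Y Y (wtw rest) (wtw rest))) le′))

    opaque
      few-walks : ∃ λ Cs → length Cs ≡ (1 + (m * 2 + (m * 2) * ((m * 2) * 2))) ^ 4
                × (∀ {r} → r ∈ Cs → length r ≤ 4 * (2 + l))
                × (∀ {u v} ds → Wk u ds v → wtw ds + wtw ds ≤ 4 * l → ∃ λ r → r ∈ Cs × r ≈ ds)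
      few-walks = candidates 4 , trans (length-candidates 4) (cong (_^ 4) length-blocks) , candidate-short 4 , represent 4

-- Walks through contracted nodes

-- A partition of the vertices into contractible tight nodes, with the edges that walks may use.
record NodeSystem {n m : ℕ} (Γ : Multigraph n m) (W : Fin m → ℕ) : Set₁ where
  open Multigraph Γ
  open Matchings Γ using (cross; ins)
  open Faces Γ using (Tight; Min; InFace)
  field
    nd       : Fin n → Fin n → Bool
    nd-refl  : ∀ v → nd v v ≡ true
    nd-eq    : ∀ {u v} → nd u v ≡ true → nd u ≗ nd v
    nd-tight : ∀ v → Tight W (nd v)
    nd-contr : ∀ v {M N} → Min W M → Min W N → ∀ {e} → M e ≡ true → N e ≡ true → cross (nd v) e ≡ true → ∀ g → ins (nd v) g ≡ true → M g ≡ N g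
    Al       : Fin m → Set
    Al-face  : ∀ {e} → Al e → InFace W e
    Al-sep   : ∀ {e} → Al e → nd (s e) (t e) ≡ false

module Nodes {n m : ℕ} (Γ : Multigraph n m) (W : Fin m → ℕ) (sys : NodeSystem Γ W) where

  open Multigraph Γ
  open NodeSystem sys
  open Matchings Γ
  open Faces Γ
  open Walks s t nd nd-refl nd-eq Al

  Wk-end : ∀ {u v v′} ds → nd v v′ ≡ true → Wk u ds v → Wk u ds v′
  Wk-end [] p w = nd-trans w p
  Wk-end (d ∷ ds) p (a , b , w) = a , b , Wk-end ds p w

  -- Every matching of the face through e agrees with this one on the nodes at the ends of e.
  opaque
    pick : Fin m → ES
    pick e with InFace? W e
    ... | yes (M , _) = M
    ... | no _ = λ _ → false

    pick-min : ∀ {e} → Al e → Min W (pick e) × pick e e ≡ true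
    pick-min {e} a with InFace? W e
    ... | yes (M , p) = p
    ... | no ¬p = ⊥-elim (¬p (Al-face a))

  tch : VS → ES
  tch A g = A (s g) ∨ A (t g)

  -- Column `e` completes the edge by the matching inside the nodes at its ends. Nodes being tight,
  -- `pick e` leaves them only along `e`, so touching a node means lying inside it or being `e`.
  vec : Fin m → Fin m → ℤ
  vec g e = χℤ (pick e g ∧ (tch (nd (s e)) g ∨ tch (nd (t e)) g))

  half : ES → Fin n → Fin m → ℤ
  half N v g = χℤ (N g ∧ ins (nd v) g)

  half-cong : ∀ N {u v} → nd u v ≡ true → ∀ g → half N u g ≡ half N v g
  half-cong N p g = cong (λ b → χℤ (N g ∧ b)) (cong₂ _∧_ (nd-eq p (s g)) (nd-eq p (t g)))

  Separated : Fin m → Set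
  Separated e = nd (s e) (t e) ≡ false

  sep-ends : ∀ {e x y} → x ∈ₑ e → y ∈ₑ e → nd x y ≡ false → Separated e
  sep-ends {e} (inj₁ refl) (inj₁ refl) p = ⊥-elim (true≢false (nd-refl _) p)
  sep-ends {e} (inj₂ refl) (inj₂ refl) p = ⊥-elim (true≢false (nd-refl _) p)
  sep-ends {e} (inj₁ refl) (inj₂ refl) p = p
  sep-ends {e} (inj₂ refl) (inj₁ refl) p = ¬true λ q → true≢false (nd-sym q) p

  sep-cross : ∀ {e v} → cross (nd v) e ≡ true → Separated e
  sep-cross {e} {v} c with cross-elim (nd v) e c
  ... | x , y , xe , ye , p , q = sep-ends xe ye (¬true λ r → true≢false (nd-trans p r) q)

  sep-not-ins : ∀ {e} v → Separated e → ins (nd v) e ≡ false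
  sep-not-ins {e} v p = ¬true λ q → true≢false (nd-trans (nd-sym (proj₁ (∧-true {nd v (s e)} q))) (proj₂ (∧-true {nd v (s e)} q))) p

  half-sep : ∀ N v {e} → Separated e → half N v e ≡ 0ℤ
  half-sep N v {e} p rewrite sep-not-ins v p with N e
  ... | true = refl
  ... | false = refl

  own-cross : ∀ {e v} → Separated e → v ∈ₑ e → cross (nd v) e ≡ true
  own-cross {e} sep (inj₁ refl) = cross-intro {nd (s e)} (inj₁ refl) (inj₂ refl) (nd-refl _) sep
  own-cross {e} sep (inj₂ refl) = cross-intro {nd (t e)} (inj₂ refl) (inj₁ refl) (nd-refl _) (¬true λ q → true≢false (nd-sym q) sep)

  touch-cross : ∀ {A g} → tch A g ≡ true → ins A g ≡ false → cross A g ≡ true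
  touch-cross {A} {g} p q with A (s g) | A (t g)
  ... | true | false = refl
  ... | false | true = refl

  ins-touch : ∀ {A g} → ins A g ≡ true → tch A g ≡ true
  ins-touch {A} {g} p = ∨-introˡ {A (s g)} (proj₁ (∧-true {A (s g)} p))

  -- Contractibility lets any minimiser through `e` replace the chosen one, which is what allows
  -- consecutive edges of a walk to be completed by a common matching.
  vec-split : ∀ {e N} → Al e → Min W N → N e ≡ true → ∀ g → vec g e ≡ half N (s e) g ℤ.+ raw g e ℤ.+ half N (t e) g
  vec-split {e} {N} al mN Ne g = go
    where
    M = pick e
    A = nd (s e)
    B = nd (t e)
    mM : Min W M
    mM = proj₁ (pick-min al)
    Me : M e ≡ true
    Me = proj₂ (pick-min al)
    sep : Separated e
    sep = Al-sep al
    cA : cross A e ≡ true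
    cA = own-cross sep (inj₁ refl)
    cB : cross B e ≡ true
    cB = own-cross sep (inj₂ refl)
    contact : ∀ v → cross (nd v) e ≡ true → M g ≡ true → tch (nd v) g ≡ true → ins (nd v) g ≡ false → e ≡ g
    contact v c p q r = crossing-unique (nd v) (nd-tight v M mM) Me c p (touch-cross {nd v} q r)
    disj : ∀ {x} → A x ≡ true → B x ≡ true → ⊥
    disj p q = true≢false (nd-trans p (nd-sym q)) sep
    go : vec g e ≡ half N (s e) g ℤ.+ raw g e ℤ.+ half N (t e) g
    go with e ≟ g
    ... | yes refl rewrite half-sep N (s e) sep | half-sep N (t e) sep | Me | nd-refl (s e) = refl
    ... | no ne with bool (ins A g) | bool (ins B g)
    ...   | inj₁ p | inj₁ q = ⊥-elim (disj (proj₁ (∧-true p)) (proj₁ (∧-true q)))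
    ...   | inj₁ p | inj₂ q rewrite p | q | ins-touch {A} {g} p | nd-contr (s e) mM mN Me Ne cA g p with N g
    ...     | true = refl
    ...     | false = refl
    go | no ne | inj₂ p | inj₁ q rewrite p | q | ins-touch {B} {g} q | nd-contr (t e) mM mN Me Ne cB g q with N g | tch A g
    ...     | true | true = refl
    ...     | true | false = refl
    ...     | false | _ = refl
    go | no ne | inj₂ p | inj₂ q rewrite p | q with M g in eM | tch A g in tA | tch B g in tB
    ... | true | true | _ = ⊥-elim (ne (contact (s e) cA eM tA p))
    ... | true | false | true = ⊥-elim (ne (contact (t e) cB eM tB q))
    ... | true | false | false = zero-halves
      where
      zero-halves : 0ℤ ≡ χℤ (N g ∧ false) ℤ.+ 0ℤ ℤ.+ χℤ (N g ∧ false)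
      zero-halves with N g
      ... | true = refl
      ... | false = refl
    ... | false | _ | _ = zero-halves
      where
      zero-halves : 0ℤ ≡ χℤ (N g ∧ false) ℤ.+ 0ℤ ℤ.+ χℤ (N g ∧ false)
      zero-halves with N g
      ... | true = refl
      ... | false = refl

  vec-dir : ∀ d {N} → Al (proj₁ d) → Min W N → N (proj₁ d) ≡ true → ∀ g →
            vec g (proj₁ d) ≡ half N (tail d) g ℤ.+ raw g (proj₁ d) ℤ.+ half N (head d) g
  vec-dir (e , true) al mN Ne g = vec-split al mN Ne g
  vec-dir (e , false) {N} al mN Ne g = trans (vec-split al mN Ne g) (lemma (half N (s e) g) (raw g e) (half N (t e) g))
    where
    lemma : ∀ a b c → a ℤ.+ b ℤ.+ c ≡ c ℤ.+ b ℤ.+ a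
    lemma = solve-ℤ

  vec-raw : ∀ {e g} → Al e → Separated g → vec g e ≡ raw g e
  vec-raw {e} {g} al sep = trans (vec-split al (proj₁ (pick-min al)) (proj₂ (pick-min al)) g)
    (trans (cong₂ (λ x y → x ℤ.+ raw g e ℤ.+ y) (half-sep (pick e) (s e) sep) (half-sep (pick e) (t e) sep))
      (trans (ℤ.+-identityʳ _) (ℤ.+-identityˡ _)))

  vec≤1 : ∀ g e → ∣ vec g e ∣ ≤ 1
  vec≤1 g e with pick e g ∧ (tch (nd (s e)) g ∨ tch (nd (t e)) g)
  ... | true = ℕ.≤-refl
  ... | false = z≤n

  alt-cong-Wk : ∀ {φ ψ u v} ds → Wk u ds v → (∀ {e} → Al e → φ e ≡ ψ e) → alt φ ds ≡ alt ψ ds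
  alt-cong-Wk [] w h = refl
  alt-cong-Wk (d ∷ ds) (_ , a , w) h = cong₂ _-_ (h a) (alt-cong-Wk ds w h)

  direct : ∀ {e x y} → x ∈ₑ e → y ∈ₑ e → x ≢ y → ∃ λ d → proj₁ d ≡ e × tail d ≡ x × head d ≡ y
  direct {e} (inj₁ refl) (inj₁ refl) ne = ⊥-elim (ne refl)
  direct {e} (inj₂ refl) (inj₂ refl) ne = ⊥-elim (ne refl)
  direct {e} (inj₁ refl) (inj₂ refl) ne = (e , true) , refl , refl , refl
  direct {e} (inj₂ refl) (inj₁ refl) ne = (e , false) , refl , refl , refl

  role : Bool → ES → ES → ES
  role b N₁ N₂ = if b then N₂ else N₁

  role-not : ∀ b N₁ N₂ e → role b N₂ N₁ e ≡ role (not b) N₁ N₂ e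
  role-not true  N₁ N₂ e = refl
  role-not false N₁ N₂ e = refl

  UnionOfNodes : VS → Set
  UnionOfNodes P = ∀ {x y} → nd x y ≡ true → P x ≡ P y

  -- Following the edges of N₂ and N₁ alternately through the nodes of R, starting at the node of v₀,
  -- which N₁ leaves along e₀, until the walk closes up at e₀ or leaves R.
  module Follow (R : VS) (R-nodes : UnionOfNodes R)
                (R-alive : ∀ {N e} → Min W N → N e ≡ true → ins R e ≡ true → Separated e → Al e)
                (e₀ : Fin m) (sep₀ : Separated e₀) (v₀ : Fin n) where

    weightless : Fin m → ℤ → ℤ
    weightless g x = χℤ (not ⌊ e₀ ≟ g ⌋) ℤ.* x

    -- `P` and `Q` are the unions of the nodes visited before and after. `role (ev ds) N₁ N₂` is the
    -- matching that would leave the last node next, along `f`. By `formula`, apart from the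
    -- completions at the first and last node, the walk adds up to the difference of the matchings
    -- on the edges inside `Q` but not inside `P`. The edge `e₀` is masked, as it is not traversed.
    record Followed (N₁ N₂ : ES) (a : Fin n) (P : VS) : Set where
      field
        ds : List DE
        z : Fin n
        Q : VS
        f : Fin m
        walk : Wk a ds z
        P⊆Q : ∀ v → P v ≡ true → Q v ≡ true
        Q⊆R : ∀ v → Q v ≡ true → R v ≡ true
        Q-nodes : UnionOfNodes Q
        Qz : Q z ≡ true
        weight-≡ : wtw ds + cnt P ≡ cnt Q
        exit : role (ev ds) N₁ N₂ f ≡ true
        exit-cross : cross (nd z) f ≡ true
        exit-where : f ≡ e₀ ⊎ cross R f ≡ true
        closed₁ : ∀ h → role (ev ds) N₂ N₁ h ≡ true → cross Q h ≡ true → h ≡ e₀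
        closed₂ : ∀ h → role (ev ds) N₁ N₂ h ≡ true → cross Q h ≡ true → h ≡ e₀ ⊎ h ≡ f
        away : ds ≡ [] ⊎ nd z v₀ ≡ false
        formula : ∀ g → alt (vec g) ds ≡ half N₂ a g - sgn (ev ds) (half (role (ev ds) N₁ N₂) z g)
                        ℤ.+ weightless g ((χℤ (N₂ g) - χℤ (N₁ g)) ℤ.* (χℤ (ins Q g) - χℤ (ins P g)))

    -- The invariants are those of `alternating-path` with nodes in place of vertices and `e₀` as
    -- the only exception. Tight nodes are left by exactly one edge of each matching, so the next
    -- edge always exists.
    follow : ∀ k N₁ N₂ → Min W N₁ → Min W N₂ → ∀ a P → UnionOfNodes P → P a ≡ true → P v₀ ≡ true →
             (∀ v → P v ≡ true → R v ≡ true) →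
             (∀ h → N₁ h ≡ true → cross P h ≡ true → h ≡ e₀) →
             (∀ h → N₂ h ≡ true → cross (P ∖ nd a) h ≡ true → h ≡ e₀) →
             cnt R ≤ cnt P + k → Followed N₁ N₂ a P
    follow k N₁ N₂ m₁ m₂ a P Pn Pa Pv P⊆R i₁ i₂ fuel with crossing-edge {N₂} {nd a} (nd-tight a N₂ m₂)
    ... | f , N₂f , fc = decide (f ≟ e₀) (bool (cross R f))
      where
      stop : f ≡ e₀ ⊎ cross R f ≡ true → Followed N₁ N₂ a P
      stop w = record
        { ds = [] ; z = a ; Q = P ; f = f ; walk = nd-refl a ; P⊆Q = λ _ p → p ; Q⊆R = P⊆R ; Q-nodes = Pn ; Qz = Pa
        ; weight-≡ = refl ; exit = N₂f ; exit-cross = fc ; exit-where = w ; closed₁ = i₁ ; closed₂ = c₂ ; away = inj₁ refl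
        ; formula = λ g → sym (lemma (half N₂ a g) (χℤ (not ⌊ e₀ ≟ g ⌋)) (χℤ (N₂ g) - χℤ (N₁ g)) (χℤ (ins P g))) }
        where
        lemma : ∀ h ε x y → h - h ℤ.+ ε ℤ.* (x ℤ.* (y - y)) ≡ 0ℤ
        lemma = solve-ℤ
        c₂ : ∀ h → N₂ h ≡ true → cross P h ≡ true → h ≡ e₀ ⊎ h ≡ f
        c₂ h p c with cross-elim P h c
        ... | x , y , xh , yh , Px , Py with bool (nd a x)
        ... | inj₁ q = inj₂ (crossing-unique (nd a) (nd-tight a N₂ m₂) p
                (cross-intro {nd a} xh yh q (¬true λ r → true≢false (trans (sym (Pn (nd-trans (nd-sym q) r))) Px) Py)) N₂f fc)
        ... | inj₂ q = inj₁ (i₂ h p (cross-intro {P ∖ nd a} xh yh (∧-intro Px (cong not q)) (cong (_∧ not (nd a y)) Py)))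
      module Step (f≢e₀ : f ≢ e₀) (inside : cross R f ≡ false) where
        elim = cross-elim (nd a) f fc
        x = proj₁ elim
        b = proj₁ (proj₂ elim)
        xf : x ∈ₑ f
        xf = proj₁ (proj₂ (proj₂ elim))
        bf : b ∈ₑ f
        bf = proj₁ (proj₂ (proj₂ (proj₂ elim)))
        ax : nd a x ≡ true
        ax = proj₁ (proj₂ (proj₂ (proj₂ (proj₂ elim))))
        ab : nd a b ≡ false
        ab = proj₂ (proj₂ (proj₂ (proj₂ (proj₂ elim))))
        Px : P x ≡ true
        Px = trans (sym (Pn ax)) Pa
        ¬Pb : P b ≡ false
        ¬Pb = ¬true λ p → f≢e₀ (i₂ f N₂f (cross-intro {P ∖ nd a} bf xf (∧-intro p (cong not ab))
                (trans (cong (λ c → P x ∧ not c) ax) (∧-false (P x)))))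
          where
          ∧-false : ∀ c → c ∧ false ≡ false
          ∧-false true  = refl
          ∧-false false = refl
        Rb : R b ≡ true
        Rb = not-cross R inside xf bf (P⊆R x Px)
        Q′ : VS
        Q′ = P ∪ nd b
        toP : ∀ {v} → P v ≡ true → Q′ v ≡ true
        toP = ∨-introˡ
        toB : ∀ {v} → nd b v ≡ true → Q′ v ≡ true
        toB {v} = ∨-introʳ {P v}
        ¬PB : ∀ {v} → P v ≡ true → nd b v ≡ true → ⊥
        ¬PB p q = true≢false (trans (Pn q) p) ¬Pb
        Q′-nodes : UnionOfNodes Q′
        Q′-nodes {u} {v} p = cong₂ _∨_ (Pn p) (iff→≡ (λ q → nd-trans q p) (λ q → nd-trans q (nd-sym p)))
        Q′⊆R : ∀ v → Q′ v ≡ true → R v ≡ true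
        Q′⊆R v p with ∨-true {P v} p
        ... | inj₁ q = P⊆R v q
        ... | inj₂ q = trans (sym (R-nodes q)) Rb
        x≢b : x ≢ b
        x≢b p = true≢false (subst (λ y → nd a y ≡ true) p ax) ab
        ends-f : ∀ {y} → y ∈ₑ f → Q′ y ≡ true
        ends-f yf with two-ends xf bf x≢b yf
        ... | inj₁ refl = toP Px
        ... | inj₂ refl = toB (nd-refl b)
        fb : cross (nd b) f ≡ true
        fb = cross-intro {nd b} bf xf (nd-refl b) (¬true λ p → true≢false (nd-trans ax (nd-sym p)) ab)
        j₁ : ∀ h → N₂ h ≡ true → cross Q′ h ≡ true → h ≡ e₀
        j₁ h p c with cross-elim Q′ h c
        ... | u , v , uh , vh , Qu , Qv with bool (nd b u) | bool (nd a u)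
        ... | inj₁ q | _ with crossing-unique (nd b) (nd-tight b N₂ m₂) p
                (cross-intro {nd b} uh vh q (¬true λ r → true≢false (toB r) Qv)) N₂f fb
        ...   | refl = ⊥-elim (true≢false (ends-f vh) Qv)
        j₁ h p c | u , v , uh , vh , Qu , Qv | inj₂ _ | inj₁ q with crossing-unique (nd a) (nd-tight a N₂ m₂) p
                (cross-intro {nd a} uh vh q (¬true λ r → true≢false (toP (trans (sym (Pn r)) Pa)) Qv)) N₂f fc
        ...   | refl = ⊥-elim (true≢false (ends-f vh) Qv)
        j₁ h p c | u , v , uh , vh , Qu , Qv | inj₂ ¬b | inj₂ ¬a with ∨-true {P u} Qu
        ... | inj₂ q = ⊥-elim (true≢false q ¬b)
        ... | inj₁ Pu = i₂ h p (cross-intro {P ∖ nd a} uh vh (∧-intro Pu (cong not ¬a))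
                          (¬true λ r → true≢false (toP (proj₁ (∧-true r))) Qv))
        j₂ : ∀ h → N₁ h ≡ true → cross (Q′ ∖ nd b) h ≡ true → h ≡ e₀
        j₂ h p c with cross-elim (Q′ ∖ nd b) h c
        ... | u , v , uh , vh , Qu , Qv with ∧-true {Q′ u} Qu
        ... | q , ¬b with ∨-true {P u} q
        ... | inj₂ r = ⊥-elim (true≢false ¬b (cong not r))
        ... | inj₁ Pu = i₁ h p (cross-intro {P} uh vh Pu (¬true λ r → true≢false (∧-intro (toP r) (cong not (¬true λ w → ¬PB r w))) Qv))
        al : Al f
        al = R-alive m₂ N₂f (ins-intro {R} (λ yf → Q′⊆R _ (ends-f yf))) (sep-cross fc)
        cntQ : cnt Q′ ≡ cnt P + sz b
        cntQ = cnt-+ P (nd b) Q′ pt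
          where
          pt : ∀ v → χℕ (P v ∨ nd b v) ≡ χℕ (P v) + χℕ (nd b v)
          pt v with P v in p | nd b v in q
          ... | true | true = ⊥-elim (¬PB p q)
          ... | true | false = refl
          ... | false | _ = refl
        -- Adding the node of `b` gains exactly `f` and the differences inside that node. Any other
        -- edge between it and `P` would be a second `N₂`-edge leaving the node, or an `N₁`-edge
        -- leaving `P` besides `e₀`.
        key : ∀ g → raw g f ℤ.+ half N₂ b g - half N₁ b g ≡ weightless g ((χℤ (N₂ g) - χℤ (N₁ g)) ℤ.* (χℤ (ins Q′ g) - χℤ (ins P g)))
        key g with e₀ ≟ g
        ... | yes refl rewrite half-sep N₂ b sep₀ | half-sep N₁ b sep₀ | ≟-false f≢e₀ = refl
        ... | no g≢e₀ with bool (ins (nd b) g)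
        ...   | inj₁ p = trans (cong₂ (λ c d → χℤ c ℤ.+ χℤ (N₂ g ∧ d) - χℤ (N₁ g ∧ d)) (≟-false f≢g) p)
                   (trans (lemma (N₂ g) (N₁ g)) (sym (cong₂ (λ c d → ℤ.+ 1 ℤ.* ((χℤ (N₂ g) - χℤ (N₁ g)) ℤ.* (χℤ c - χℤ d))) insQ ¬insP)))
          where
          f≢g : f ≢ g
          f≢g refl = true≢false p (sep-not-ins b (sep-cross fc))
          insQ : ins Q′ g ≡ true
          insQ = ins-intro {Q′} (λ yg → toB (ins-elim {nd b} p yg))
          ¬insP : ins P g ≡ false
          ¬insP = ¬true λ q → ¬PB (proj₁ (∧-true q)) (proj₁ (∧-true p))
          lemma : ∀ x y → 0ℤ ℤ.+ χℤ (x ∧ true) - χℤ (y ∧ true) ≡ ℤ.+ 1 ℤ.* ((χℤ x - χℤ y) ℤ.* ℤ.+ 1)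
          lemma true true = refl
          lemma true false = refl
          lemma false true = refl
          lemma false false = refl
        ...   | inj₂ p with f ≟ g
        ...     | yes refl = trans (cong (λ d → ℤ.+ 1 ℤ.+ χℤ (N₂ g ∧ d) - χℤ (N₁ g ∧ d)) p)
                    (trans (cong₂ (λ x y → ℤ.+ 1 ℤ.+ χℤ (x ∧ false) - χℤ (y ∧ false)) N₂f ¬N₁)
                      (sym (trans (cong₂ (λ x y → ℤ.+ 1 ℤ.* ((χℤ x - χℤ y) ℤ.* (χℤ (ins Q′ g) - χℤ (ins P g)))) N₂f ¬N₁)
                                  (cong₂ (λ c d → ℤ.+ 1 ℤ.* (ℤ.+ 1 ℤ.* (χℤ c - χℤ d))) (ins-intro {Q′} ends-f) ¬insP))))
          where
          ¬insP : ins P g ≡ false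
          ¬insP = ¬true λ q → true≢false (ins-elim {P} q bf) ¬Pb
          ¬N₁ : N₁ g ≡ false
          ¬N₁ = ¬true λ q → f≢e₀ (i₁ g q (cross-intro {P} xf bf Px ¬Pb))
        ...     | no f≢g = trans (cong (λ d → 0ℤ ℤ.+ χℤ (N₂ g ∧ d) - χℤ (N₁ g ∧ d)) p) (trans (lemma (N₂ g) (N₁ g)) (sym vanish))
          where
          lemma : ∀ x y → 0ℤ ℤ.+ χℤ (x ∧ false) - χℤ (y ∧ false) ≡ 0ℤ
          lemma true true = refl
          lemma true false = refl
          lemma false true = refl
          lemma false false = refl
          zeroʳ′ : ∀ a → ℤ.+ 1 ℤ.* (a ℤ.* 0ℤ) ≡ 0ℤ
          zeroʳ′ = solve-ℤ
          mixed : ∀ {u v} → u ∈ₑ g → v ∈ₑ g → P u ≡ true → P v ≡ false → ins Q′ g ≡ true → N₁ g ≡ false × N₂ g ≡ false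
          mixed {u} {v} ug vg Pu Pv iq with ∨-true {P v} (ins-elim {Q′} iq vg)
          ... | inj₁ q = ⊥-elim (true≢false q Pv)
          ... | inj₂ q = (¬true λ r → g≢e₀ (sym (i₁ g r (cross-intro {P} ug vg Pu Pv))))
                       , (¬true λ r → f≢g (crossing-unique (nd b) (nd-tight b N₂ m₂) N₂f fb r (cross-intro {nd b} vg ug q (¬true λ w → ¬PB Pu w))))
          vanish : ℤ.+ 1 ℤ.* ((χℤ (N₂ g) - χℤ (N₁ g)) ℤ.* (χℤ (ins Q′ g) - χℤ (ins P g))) ≡ 0ℤ
          vanish with bool (ins Q′ g)
          ... | inj₂ iq = trans (cong₂ (λ c d → ℤ.+ 1 ℤ.* ((χℤ (N₂ g) - χℤ (N₁ g)) ℤ.* (χℤ c - χℤ d))) iq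
                            (¬true λ q → true≢false (ins-intro {Q′} (λ yg → toP (ins-elim {P} q yg))) iq)) (zeroʳ′ (χℤ (N₂ g) - χℤ (N₁ g)))
          ... | inj₁ iq with bool (P (s g)) | bool (P (t g))
          ...   | inj₁ ps | inj₁ pt = trans (cong₂ (λ c d → ℤ.+ 1 ℤ.* ((χℤ (N₂ g) - χℤ (N₁ g)) ℤ.* (χℤ c - χℤ d))) iq (∧-intro ps pt)) (zeroʳ′ (χℤ (N₂ g) - χℤ (N₁ g)))
          ...   | inj₁ ps | inj₂ pt = let a₁ , a₂ = mixed (inj₁ refl) (inj₂ refl) ps pt iq in
                  cong₂ (λ c d → ℤ.+ 1 ℤ.* ((χℤ c - χℤ d) ℤ.* (χℤ (ins Q′ g) - χℤ (ins P g)))) a₂ a₁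
          ...   | inj₂ ps | inj₁ pt = let a₁ , a₂ = mixed (inj₂ refl) (inj₁ refl) pt ps iq in
                  cong₂ (λ c d → ℤ.+ 1 ℤ.* ((χℤ c - χℤ d) ℤ.* (χℤ (ins Q′ g) - χℤ (ins P g)))) a₂ a₁
          ...   | inj₂ ps | inj₂ pt = ⊥-elim (true≢false p′ p)
            where
            p′ : ins (nd b) g ≡ true
            p′ with ∨-true {P (s g)} (ins-elim {Q′} iq (inj₁ refl)) | ∨-true {P (t g)} (ins-elim {Q′} iq (inj₂ refl))
            ... | inj₁ q | _ = ⊥-elim (true≢false q ps)
            ... | inj₂ _ | inj₁ q = ⊥-elim (true≢false q pt)
            ... | inj₂ q | inj₂ r = ∧-intro q r

        combine : Followed N₂ N₁ b Q′ → Followed N₁ N₂ a P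
        combine r with direct xf bf x≢b
        ... | d , refl , dt , dh = record
          { ds = d ∷ F.ds ; z = F.z ; Q = F.Q ; f = F.f
          ; walk = subst (λ y → nd a y ≡ true) (sym dt) ax , al , subst (λ y → Wk y F.ds F.z) (sym dh) F.walk
          ; P⊆Q = λ v p → F.P⊆Q v (toP p) ; Q⊆R = F.Q⊆R ; Q-nodes = F.Q-nodes ; Qz = F.Qz
          ; weight-≡ = wgt
          ; exit = trans (sym (role-not (ev F.ds) N₁ N₂ F.f)) F.exit
          ; exit-cross = F.exit-cross ; exit-where = F.exit-where
          ; closed₁ = λ h p → F.closed₁ h (trans (role-not (ev F.ds) N₂ N₁ h) p)
          ; closed₂ = λ h p → F.closed₂ h (trans (role-not (ev F.ds) N₁ N₂ h) p)
          ; away = inj₂ (aw F.away)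
          ; formula = form }
          where
          module F = Followed r
          wgt : sz (head d) + wtw F.ds + cnt P ≡ cnt F.Q
          wgt = trans (trans (cong (λ y → sz y + wtw F.ds + cnt P) dh) (rearr (sz b) (wtw F.ds) (cnt P)))
                      (trans (cong (wtw F.ds +_) (sym cntQ)) F.weight-≡)
            where
            rearr : ∀ a b c → a + b + c ≡ b + (c + a)
            rearr a b c = trans (cong (_+ c) (ℕ.+-comm a b)) (trans (ℕ.+-assoc b a c) (cong (b +_) (ℕ.+-comm a c)))
          aw : F.ds ≡ [] ⊎ nd F.z v₀ ≡ false → nd F.z v₀ ≡ false
          aw (inj₂ p) = p
          aw (inj₁ p) = ¬true λ q → ¬PB Pv (nd-trans (subst (λ l → Wk b l F.z) p F.walk) q)
          half-role : ∀ g → half (role (ev F.ds) N₂ N₁) F.z g ≡ half (role (not (ev F.ds)) N₁ N₂) F.z g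
          half-role g = cong (λ c → χℤ (c ∧ ins (nd F.z) g)) (role-not (ev F.ds) N₁ N₂ g)
          form : ∀ g → vec g (proj₁ d) - alt (vec g) F.ds ≡ half N₂ a g - sgn (not (ev F.ds)) (half (role (not (ev F.ds)) N₁ N₂) F.z g)
                 ℤ.+ weightless g ((χℤ (N₂ g) - χℤ (N₁ g)) ℤ.* (χℤ (ins F.Q g) - χℤ (ins P g)))
          form g = begin
            vec g (proj₁ d) - alt (vec g) F.ds
              ≡⟨ cong₂ _-_ (vec-dir d al m₂ N₂f g) (F.formula g) ⟩
            (half N₂ (tail d) g ℤ.+ raw g (proj₁ d) ℤ.+ half N₂ (head d) g) - (half N₁ b g - sgn (ev F.ds) (half (role (ev F.ds) N₂ N₁) F.z g) ℤ.+ ε ℤ.* ((y - x′) ℤ.* (q - q′)))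
              ≡⟨ cong₂ (λ i j → (i ℤ.+ raw g (proj₁ d) ℤ.+ j) - (half N₁ b g - sgn (ev F.ds) (half (role (ev F.ds) N₂ N₁) F.z g) ℤ.+ ε ℤ.* ((y - x′) ℤ.* (q - q′))))
                   (trans (cong (λ w → half N₂ w g) dt) (sym (half-cong N₂ ax g))) (cong (λ w → half N₂ w g) dh) ⟩
            (half N₂ a g ℤ.+ raw g (proj₁ d) ℤ.+ half N₂ b g) - (half N₁ b g - sgn (ev F.ds) (half (role (ev F.ds) N₂ N₁) F.z g) ℤ.+ ε ℤ.* ((y - x′) ℤ.* (q - q′)))
              ≡⟨ r₁ (half N₂ a g) (raw g (proj₁ d)) (half N₂ b g) (half N₁ b g) (sgn (ev F.ds) (half (role (ev F.ds) N₂ N₁) F.z g)) ε y x′ q q′ ⟩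
            (half N₂ a g ℤ.+ sgn (ev F.ds) (half (role (ev F.ds) N₂ N₁) F.z g)) ℤ.+ ((raw g (proj₁ d) ℤ.+ half N₂ b g - half N₁ b g) ℤ.+ ε ℤ.* ((x′ - y) ℤ.* (q - q′)))
              ≡⟨ cong₂ (λ i j → (half N₂ a g ℤ.+ i) ℤ.+ (j ℤ.+ ε ℤ.* ((x′ - y) ℤ.* (q - q′)))) (trans (cong (sgn (ev F.ds)) (half-role g)) (sgn-not (ev F.ds) _)) (key g) ⟩
            (half N₂ a g - sgn (not (ev F.ds)) (half (role (not (ev F.ds)) N₁ N₂) F.z g)) ℤ.+ (ε ℤ.* ((x′ - y) ℤ.* (q′ - p′)) ℤ.+ ε ℤ.* ((x′ - y) ℤ.* (q - q′)))
              ≡⟨ cong (λ w → (half N₂ a g - sgn (not (ev F.ds)) (half (role (not (ev F.ds)) N₁ N₂) F.z g)) ℤ.+ w) (r₂ ε x′ y p′ q q′) ⟩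
            _ ∎
            where
            open ≡-Reasoning
            ε = χℤ (not ⌊ e₀ ≟ g ⌋)
            x′ = χℤ (N₂ g)
            y = χℤ (N₁ g)
            q = χℤ (ins F.Q g)
            q′ = χℤ (ins Q′ g)
            p′ = χℤ (ins P g)
            sgn-not : ∀ b x → sgn b x ≡ ℤ.- sgn (not b) x
            sgn-not true x = sym (ℤ.neg-involutive x)
            sgn-not false x = refl
            r₁ : ∀ A r B C S ε y x q q′ → (A ℤ.+ r ℤ.+ B) - (C - S ℤ.+ ε ℤ.* ((y - x) ℤ.* (q - q′))) ≡ (A ℤ.+ S) ℤ.+ ((r ℤ.+ B - C) ℤ.+ ε ℤ.* ((x - y) ℤ.* (q - q′)))
            r₁ = solve-ℤ
            r₂ : ∀ ε x y p q q′ → ε ℤ.* ((x - y) ℤ.* (q′ - p)) ℤ.+ ε ℤ.* ((x - y) ℤ.* (q - q′)) ≡ ε ℤ.* ((x - y) ℤ.* (q - p))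
            r₂ = solve-ℤ

        next : ∀ k → cnt R ≤ cnt P + k → Followed N₁ N₂ a P
        next zero fuel = ⊥-elim (ℕ.<⇒≱ (ℕ.≤-<-trans fuel (subst (cnt P + 0 <_) (sym cntQ) (ℕ.+-monoʳ-< (cnt P) (sz≥1 b)))) (cnt-mono Q′⊆R))
        next (suc k) fuel = combine (follow k N₂ N₁ m₂ m₁ b Q′ Q′-nodes (toB (nd-refl b)) (toP Pv) Q′⊆R j₁ j₂
          (ℕ.≤-trans fuel (ℕ.≤-trans (ℕ.≤-reflexive (trans (ℕ.+-suc (cnt P) k) (cong (_+ k) (ℕ.+-comm 1 (cnt P)))))
            (ℕ.+-monoˡ-≤ k (ℕ.≤-trans (ℕ.+-monoʳ-≤ (cnt P) (sz≥1 b)) (ℕ.≤-reflexive (sym cntQ)))))))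
      decide : Dec (f ≡ e₀) → cross R f ≡ true ⊎ cross R f ≡ false → Followed N₁ N₂ a P
      decide (yes p) _ = stop (inj₁ p)
      decide (no _) (inj₁ c) = stop (inj₂ c)
      decide (no f≢e₀) (inj₂ inside) = Step.next f≢e₀ inside k fuel

  one-end : ∀ {R : VS} {e x y} → cross R e ≡ true → x ∈ₑ e → y ∈ₑ e → R x ≡ true → R y ≡ true → x ≡ y
  one-end {R} {e} {x} {y} c xe ye p q with cross-elim R e c
  ... | u , v , ue , ve , Ru , Rv = trans (isU xe p) (sym (isU ye q))
    where
    isU : ∀ {w} → w ∈ₑ e → R w ≡ true → w ≡ u
    isU we Rw with two-ends ue ve (λ { refl → true≢false Ru Rv }) we
    ... | inj₁ r = r
    ... | inj₂ refl = ⊥-elim (true≢false Rw Rv)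

  -- A component of M △ M′ inside R is a closed alternating walk; exchanging M and M′ on it stays in the face.
  module Region (W′ : Fin m → ℕ) (sub : ∀ {M} → Min W′ M → Min W M) (ω : ℕ)
    (vanish : ∀ u ds → Wk u ds u → ev ds ≡ true → wtw ds ≤ ω → ∀ {M N} → Min W′ M → Min W′ N →
              (∀ g → alt (vec g) ds ≡ χℤ (N g) - χℤ (M g)) → ∀ g → alt (raw g) ds ≡ 0ℤ)
    (R : VS) (R-nodes : UnionOfNodes R)
    (R-alive : ∀ {N e} → Min W N → N e ≡ true → ins R e ≡ true → Separated e → Al e)
    (small : cnt R ≤ ω) where

    -- The walk from `t e₀` cannot stop at the boundary of `R`, where the matchings agree, so it
    -- comes back to `e₀`. Closed up by `e₀`, its vector is `N − M` for the exchanged matching `N`,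
    -- whose entry -1 at `e₀` contradicts `vanish`.
    no-diff : ∀ {M M′ e₀} → Min W′ M → Min W′ M′ → AgreeOnCut R M M′ →
              M e₀ ≡ true → M′ e₀ ≡ false → ins R e₀ ≡ true → Separated e₀ → ⊥
    no-diff {M} {M′} {e₀} mM mM′ agree Me M′e inR sep = conclude start
      where
      u₀ = s e₀
      v₀ = t e₀
      open Follow R R-nodes R-alive e₀ sep v₀
      P₀-nodes : UnionOfNodes (nd v₀)
      P₀-nodes p = iff→≡ (λ q → nd-trans q p) (λ q → nd-trans q (nd-sym p))
      Rv : R v₀ ≡ true
      Rv = ins-elim {R} inR (inj₂ refl)
      start : Followed M M′ v₀ (nd v₀)
      start = follow (cnt R) M M′ (sub mM) (sub mM′) v₀ (nd v₀) P₀-nodes (nd-refl v₀) (nd-refl v₀)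
        (λ v p → trans (sym (R-nodes p)) Rv)
        (λ h p c → crossing-unique (nd v₀) (nd-tight v₀ M (sub mM)) p c Me (own-cross sep (inj₂ refl)))
        (λ h p c → let x , _ , _ , _ , q , _ = cross-elim (nd v₀ ∖ nd v₀) h c
                       a , b = ∧-true {nd v₀ x} q in ⊥-elim (true≢false b (cong not a)))
        (ℕ.m≤n+m _ _)
      conclude : Followed M M′ v₀ (nd v₀) → ⊥
      conclude r = Odd.absurd (parity (ev ds) refl)
        where
        open Followed r
        exit-end : ∃ λ y → y ∈ₑ f × nd z y ≡ true
        exit-end = let x , _ , xf , _ , p , _ = cross-elim (nd z) f exit-cross in x , xf , p
        f≡e₀ : f ≡ e₀
        f≡e₀ with exit-where
        ... | inj₁ p = p
        ... | inj₂ c with cross-elim R f c | exit-end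
        ... | x , y , xf , yf , Rx , Ry | w , wf , zw = closed₁ f (both (ev ds) exit)
                (cross-intro {Q} wf yf (trans (sym (Q-nodes zw)) Qz) (¬true λ q → true≢false (Q⊆R y q) Ry))
          where
          both : ∀ b → role b M M′ f ≡ true → role b M′ M f ≡ true
          both true p = trans (agree f c) p
          both false p = trans (sym (agree f c)) p
        parity : ∀ b → ev ds ≡ b → ev ds ≡ false
        parity false p = p
        -- After an even walk the exit would belong to `M′`, which does not contain `e₀`.
        parity true p = ⊥-elim (true≢false (trans (cong (λ b → role b M M′ e₀) (sym p)) (subst (λ h → role (ev ds) M M′ h ≡ true) f≡e₀ exit)) M′e)
        module Odd (odd : ev ds ≡ false) where
          zv : nd z v₀ ≡ false
          zv with away
          ... | inj₂ p = p
          ... | inj₁ p = ⊥-elim (true≢false (cong ev p) odd)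
          zu : nd z u₀ ≡ true
          zu with exit-end
          ... | y , yf , zy with subst (y ∈ₑ_) f≡e₀ yf
          ... | inj₁ refl = zy
          ... | inj₂ refl = ⊥-elim (true≢false zy zv)
          Qu : Q u₀ ≡ true
          Qu = trans (sym (Q-nodes zu)) Qz
          Qv : Q v₀ ≡ true
          Qv = P⊆Q v₀ (nd-refl v₀)
          e₀-ends : ∀ {y} → y ∈ₑ e₀ → Q y ≡ true
          e₀-ends (inj₁ refl) = Qu
          e₀-ends (inj₂ refl) = Qv
          ¬e₀ : ∀ {h} → cross Q h ≡ true → h ≡ e₀ → ⊥
          ¬e₀ {h} c refl = let x , y , xh , yh , Qx , Qy = cross-elim Q h c in true≢false (e₀-ends yh) Qy
          noM : ∀ h → cross Q h ≡ true → M h ≡ false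
          noM h c = ¬true λ p → case (closed₂ h (trans (cong (λ b → role b M M′ h) odd) p) c)
            where
            case : h ≡ e₀ ⊎ h ≡ f → ⊥
            case (inj₁ q) = ¬e₀ c q
            case (inj₂ q) = ¬e₀ c (trans q f≡e₀)
          noM′ : ∀ h → cross Q h ≡ true → M′ h ≡ false
          noM′ h c = ¬true λ p → ¬e₀ c (closed₁ h (trans (cong (λ b → role b M′ M h) odd) p) c)
          N : ES
          N = swap Q M M′
          mN : Min W′ N
          mN = Min-swap Q (λ h c → trans (noM h c) (sym (noM′ h c))) mM mM′
          Ne : N e₀ ≡ false
          Ne = trans (cong (λ b → if b then M′ e₀ else M e₀) Qu) M′e
          cyc : List DE
          cyc = ds ++ [ (e₀ , true) ]
          closedWalk : Wk v₀ cyc v₀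
          closedWalk = Wk-++ ds [ (e₀ , true) ] walk (zu , R-alive (sub mM) Me inR sep , nd-refl v₀)
          even : ev cyc ≡ true
          even = trans (ev-++ ds [ (e₀ , true) ]) (cong (λ b → not (b xor false)) odd)
          light : wtw cyc ≤ ω
          light = ℕ.≤-trans (ℕ.≤-reflexive (trans (wtw-++ ds [ (e₀ , true) ]) (trans (cong (wtw ds +_) (ℕ.+-identityʳ _)) weight-≡)))
                            (ℕ.≤-trans (cnt-mono Q⊆R) small)
          al₀ : Al e₀
          al₀ = R-alive (sub mM) Me inR sep
          value : ∀ g → alt (vec g) cyc ≡ χℤ (N g) - χℤ (M g)
          value g = begin
            alt (vec g) cyc ≡⟨ alt-++ (vec g) ds [ (e₀ , true) ] ⟩
            alt (vec g) ds ℤ.+ sgn (ev ds) (vec g e₀ - 0ℤ) ≡⟨ cong₂ (λ b w → w ℤ.+ sgn b (vec g e₀ - 0ℤ)) odd (formula g) ⟩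
            (half M′ v₀ g - sgn (ev ds) (half (role (ev ds) M M′) z g) ℤ.+ X) ℤ.+ ℤ.- (vec g e₀ - 0ℤ)
              ≡⟨ cong₂ (λ b w → (half M′ v₀ g - sgn b (half (role b M M′) z g) ℤ.+ X) ℤ.+ ℤ.- (w - 0ℤ)) odd (vec-split al₀ (sub mM) Me g) ⟩
            (half M′ v₀ g - ℤ.- half M z g ℤ.+ X) ℤ.+ ℤ.- ((half M u₀ g ℤ.+ raw g e₀ ℤ.+ half M v₀ g) - 0ℤ)
              ≡⟨ cong (λ w → (half M′ v₀ g - ℤ.- w ℤ.+ X) ℤ.+ ℤ.- ((half M u₀ g ℤ.+ raw g e₀ ℤ.+ half M v₀ g) - 0ℤ)) (half-cong M zu g) ⟩
            (half M′ v₀ g - ℤ.- half M u₀ g ℤ.+ X) ℤ.+ ℤ.- ((half M u₀ g ℤ.+ raw g e₀ ℤ.+ half M v₀ g) - 0ℤ)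
              ≡⟨ r₁ (half M′ v₀ g) (half M u₀ g) X (raw g e₀) (half M v₀ g) ⟩
            half M′ v₀ g - half M v₀ g - raw g e₀ ℤ.+ X ≡⟨ final ⟩
            χℤ (N g) - χℤ (M g) ∎
            where
            open ≡-Reasoning
            X = weightless g ((χℤ (M′ g) - χℤ (M g)) ℤ.* (χℤ (ins Q g) - χℤ (ins (nd v₀) g)))
            r₁ : ∀ a b X r c → (a - ℤ.- b ℤ.+ X) ℤ.+ ℤ.- ((b ℤ.+ r ℤ.+ c) - 0ℤ) ≡ a - c - r ℤ.+ X
            r₁ = solve-ℤ
            D = χℤ (M′ g) - χℤ (M g)
            table : ∀ x y i q → χℤ (x ∧ i) - χℤ (y ∧ i) - 0ℤ ℤ.+ ℤ.+ 1 ℤ.* ((χℤ x - χℤ y) ℤ.* (χℤ q - χℤ i)) ≡ (χℤ x - χℤ y) ℤ.* χℤ q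
            table x y i q = trans (cong₂ (λ a b → a - b - 0ℤ ℤ.+ ℤ.+ 1 ℤ.* ((χℤ x - χℤ y) ℤ.* (χℤ q - χℤ i))) (ΣZ.χ-∧ x i) (ΣZ.χ-∧ y i))
              (ring (χℤ x) (χℤ y) (χℤ i) (χℤ q))
              where
              ring : ∀ x y i q → x ℤ.* i - y ℤ.* i - 0ℤ ℤ.+ ℤ.+ 1 ℤ.* ((x - y) ℤ.* (q - i)) ≡ (x - y) ℤ.* q
              ring = solve-ℤ
            z₁ : ∀ a b → a ℤ.* 0ℤ ≡ b - b
            z₁ = solve-ℤ
            z₂ : ∀ a → a ℤ.* ℤ.+ 1 ≡ a
            z₂ = solve-ℤ
            side : Q (s g) ≡ true ⊎ Q (s g) ≡ false → cross Q g ≡ true ⊎ cross Q g ≡ false → D ℤ.* χℤ (ins Q g) ≡ χℤ (N g) - χℤ (M g)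
            side (inj₂ q) _ = trans (cong (λ b → D ℤ.* χℤ (b ∧ Q (t g))) q) (trans (z₁ D (χℤ (M g)))
              (cong (λ b → χℤ b - χℤ (M g)) (sym (cong (λ b → if b then M′ g else M g) q))))
            side (inj₁ q) (inj₁ c) = trans (cong₂ (λ x y → (χℤ x - χℤ y) ℤ.* χℤ (ins Q g)) (noM′ g c) (noM g c))
              (sym (cong₂ (λ x y → χℤ x - χℤ y) (trans (cong (λ b → if b then M′ g else M g) q) (noM′ g c)) (noM g c)))
            side (inj₁ q) (inj₂ c) = trans (cong (λ b → D ℤ.* χℤ b) (∧-intro q (not-cross Q {g} c (inj₁ refl) (inj₂ refl) q)))
              (trans (z₂ D) (cong (λ b → χℤ b - χℤ (M g)) (sym (cong (λ b → if b then M′ g else M g) q))))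
            E : Bool → ℤ
            E b = half M′ v₀ g - half M v₀ g - χℤ b ℤ.+ χℤ (not b) ℤ.* (D ℤ.* (χℤ (ins Q g) - χℤ (ins (nd v₀) g)))
            final′ : Dec (e₀ ≡ g) → E ⌊ e₀ ≟ g ⌋ ≡ χℤ (N g) - χℤ (M g)
            final′ (yes p) = trans (cong E (trans (cong (λ x → ⌊ e₀ ≟ x ⌋) (sym p)) (≟-refl e₀)))
              (trans (cong₂ (λ a c → a - c - ℤ.+ 1 ℤ.+ 0ℤ ℤ.* (D ℤ.* (χℤ (ins Q g) - χℤ (ins (nd v₀) g))))
                       (half-sep M′ v₀ (subst Separated p sep)) (half-sep M v₀ (subst Separated p sep)))
                (sym (cong₂ (λ a c → χℤ a - χℤ c) (subst (λ x → N x ≡ false) p Ne) (subst (λ x → M x ≡ true) p Me))))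
            final′ (no ne) = trans (cong E (≟-false ne)) (trans (table (M′ g) (M g) (ins (nd v₀) g) (ins Q g)) (side (bool (Q (s g))) (bool (cross Q g))))
            final : half M′ v₀ g - half M v₀ g - raw g e₀ ℤ.+ X ≡ χℤ (N g) - χℤ (M g)
            final = final′ (e₀ ≟ g)
          absurd : ⊥
          absurd = minus-one (trans (sym (cong₂ (λ b c → χℤ b - χℤ c) Ne Me)) (trans (sym (value e₀)) (trans (alt-cong-Wk cyc closedWalk (λ al → vec-raw al sep))
                     (vanish v₀ cyc closedWalk even light mM mN value e₀))))
            where
            minus-one : χℤ false - χℤ true ≡ 0ℤ → ⊥
            minus-one ()

    -- A difference inside a contractible node makes the matchings leave this node along different
    -- edges; that is a difference between nodes.
    no-diff-inside : ∀ {M M′} → Min W′ M → Min W′ M′ → AgreeOnCut R M M′ → ∀ g → ins R g ≡ true → M g ≡ true → M′ g ≡ false → ⊥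
    no-diff-inside {M} {M′} mM mM′ agree g iR Mg M′g with bool (nd (s g) (t g))
    ... | inj₂ sep = no-diff mM mM′ agree Mg M′g iR sep
    ... | inj₁ same with crossing-edge {M} {nd (s g)} (nd-tight (s g) M (sub mM))
    ... | e , Me , ce with bool (M′ e)
    ...   | inj₁ M′e = true≢false (trans (sym (nd-contr (s g) (sub mM) (sub mM′) Me M′e ce g (∧-intro (nd-refl (s g)) same))) Mg) M′g
    ...   | inj₂ M′e with cross-elim (nd (s g)) e ce
    ...     | x , y , xe , ye , gx , gy with bool (cross R e)
    ...       | inj₁ c = true≢false (trans (sym (agree e c)) Me) M′e
    ...       | inj₂ c = no-diff mM mM′ agree Me M′e (ins-intro {R} (λ we → not-cross R c xe we Rx)) (sep-cross ce)
      where
      Rx : R x ≡ true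
      Rx = trans (sym (R-nodes gx)) (proj₁ (∧-true iR))

    region : ∀ {M M′} → Min W′ M → Min W′ M′ → AgreeOnCut R M M′ → ∀ g → ins R g ≡ true → M g ≡ M′ g
    region {M} {M′} mM mM′ agree g iR with M g in p | M′ g in q
    ... | true | true = refl
    ... | false | false = refl
    ... | true | false = ⊥-elim (no-diff-inside mM mM′ agree g iR p q)
    ... | false | true = ⊥-elim (no-diff-inside mM′ mM (λ e c → sym (agree e c)) g iR q p)

  -- One visit of a new node `R`, entered along `e₀` and left along `f₀`, is refined to a walk
  -- through the old nodes inside `R` by following minimisers that contain these edges. Its weight
  -- fits into what the new node contributes.
  module Path (W′ : Fin m → ℕ) (sub : ∀ {M} → Min W′ M → Min W M)
    (R : VS) (R-nodes : UnionOfNodes R)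
    (R-alive : ∀ {N e} → Min W N → N e ≡ true → ins R e ≡ true → Separated e → Al e)
    (R-tight : Tight W′ R)
    (R-contr : ∀ {M N} → Min W′ M → Min W′ N → ∀ {e} → M e ≡ true → N e ≡ true → cross R e ≡ true → ∀ g → ins R g ≡ true → M g ≡ N g)
    {M M′ : ES} (mM : Min W′ M) (mM′ : Min W′ M′)
    {e₀ f₀ : Fin m} (Me : M e₀ ≡ true) (ce : cross R e₀ ≡ true) (M′f : M′ f₀ ≡ true) (cf : cross R f₀ ≡ true)
    {v₀ y₀ : Fin n} (ve : v₀ ∈ₑ e₀) (Rv : R v₀ ≡ true) (yf : y₀ ∈ₑ f₀) (Ry : R y₀ ≡ true) where

    path : ∃ λ ds → Wk v₀ ds y₀ × ev ds ≡ true × wtw ds + sz v₀ ≤ cnt R ×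
           (∀ g → alt (vec g) ds ≡ half M v₀ g - half M′ y₀ g ℤ.+ (χℤ (M′ g ∧ ins R g) - χℤ (M g ∧ ins R g)))
    path = conclude start
      where
      sep : Separated e₀
      sep with cross-elim R e₀ ce
      ... | x , y , xe , ye , Rx , Ry′ = sep-ends xe ye (¬true λ p → true≢false (trans (sym (R-nodes p)) Rx) Ry′)
      open Follow R R-nodes R-alive e₀ sep v₀
      P₀-nodes : UnionOfNodes (nd v₀)
      P₀-nodes p = iff→≡ (λ q → nd-trans q p) (λ q → nd-trans q (nd-sym p))
      start : Followed M M′ v₀ (nd v₀)
      start = follow (cnt R) M M′ (sub mM) (sub mM′) v₀ (nd v₀) P₀-nodes (nd-refl v₀) (nd-refl v₀)
        (λ v p → trans (sym (R-nodes p)) Rv)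
        (λ h p c → crossing-unique (nd v₀) (nd-tight v₀ M (sub mM)) p c Me (own-cross sep ve))
        (λ h p c → let x , _ , _ , _ , q , _ = cross-elim (nd v₀ ∖ nd v₀) h c
                       a , b = ∧-true {nd v₀ x} q in ⊥-elim (true≢false b (cong not a)))
        (ℕ.m≤n+m _ _)
      conclude : Followed M M′ v₀ (nd v₀) → ∃ λ ds → Wk v₀ ds y₀ × ev ds ≡ true × wtw ds + sz v₀ ≤ cnt R ×
           (∀ g → alt (vec g) ds ≡ half M v₀ g - half M′ y₀ g ℤ.+ (χℤ (M′ g ∧ ins R g) - χℤ (M g ∧ ins R g)))
      conclude r = finish (parity (ev ds) refl)
        where
        open Followed r
        exit-R : cross R f ≡ true
        exit-R = case exit-where
          where
          case : f ≡ e₀ ⊎ cross R f ≡ true → cross R f ≡ true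
          case (inj₁ p) = subst (λ h → cross R h ≡ true) (sym p) ce
          case (inj₂ c) = c
        exit-end : ∃ λ y → y ∈ₑ f × nd z y ≡ true
        exit-end = let x , _ , xf , _ , p , _ = cross-elim (nd z) f exit-cross in x , xf , p
        R-of : ∀ {y} → nd z y ≡ true → R y ≡ true
        R-of p = trans (sym (R-nodes p)) (Q⊆R z Qz)
        parity : ∀ b → ev ds ≡ b → ev ds ≡ true
        parity true p = p
        -- An odd walk would leave `R` along `M`, hence along `e₀` and from the node of `v₀`; but a
        -- nonempty walk ends elsewhere (`away`).
        parity false p = ⊥-elim (case away)
          where
          f≡e₀ : f ≡ e₀
          f≡e₀ = crossing-unique R (R-tight M mM) (trans (cong (λ b → role b M M′ f) (sym p)) exit) exit-R Me ce
          case : ds ≡ [] ⊎ nd z v₀ ≡ false → ⊥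
          case (inj₁ q) = true≢false (cong ev q) p
          case (inj₂ zv) = let y , yf′ , zy = exit-end in
            true≢false (subst (λ w → nd z w ≡ true) (one-end {R} ce (subst (y ∈ₑ_) f≡e₀ yf′) ve (R-of zy) Rv) zy) zv
        finish : ev ds ≡ true → _
        finish even = ds , Wk-end ds zy₀ walk , even , ℕ.≤-trans (ℕ.≤-reflexive weight-≡) (cnt-mono Q⊆R) , value
          where
          f≡f₀ : f ≡ f₀
          f≡f₀ = crossing-unique R (R-tight M′ mM′) (trans (cong (λ b → role b M M′ f) (sym even)) exit) exit-R M′f cf
          zy₀ : nd z y₀ ≡ true
          zy₀ = let y , yf′ , zy = exit-end in subst (λ w → nd z w ≡ true) (one-end {R} cf (subst (y ∈ₑ_) f≡f₀ yf′) yf (R-of zy) Ry) zy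
          Qv : Q v₀ ≡ true
          Qv = P⊆Q v₀ (nd-refl v₀)
          Qy : Q y₀ ≡ true
          Qy = trans (sym (Q-nodes zy₀)) Qz
          rest : VS
          rest = R ∖ Q
          closedM : ∀ h → M h ≡ true → cross Q h ≡ true → h ≡ e₀
          closedM h p = closed₁ h (trans (cong (λ b → role b M′ M h) even) p)
          closedM′ : ∀ h → M′ h ≡ true → cross Q h ≡ true → h ≡ e₀ ⊎ h ≡ f₀
          closedM′ h p c with closed₂ h (trans (cong (λ b → role b M M′ h) even) p) c
          ... | inj₁ q = inj₁ q
          ... | inj₂ q = inj₂ (trans q f≡f₀)
          ¬end : ∀ {h x₀ p} → cross R h ≡ true → x₀ ∈ₑ h → R x₀ ≡ true → Q x₀ ≡ true → p ∈ₑ h → rest p ≡ true → ⊥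
          ¬end {h} {x₀} {p} c xh Rx Qx ph rp = let Rp , ¬Qp = ∧-true {R p} rp in
            true≢false (subst (λ w → Q w ≡ true) (one-end {R} c xh ph Rx Rp) Qx) (not-true ¬Qp)
            where
            not-true : ∀ {b} → not b ≡ true → b ≡ false
            not-true {false} _ = refl
          sides : ∀ {h} → cross rest h ≡ true → ∃ λ p → p ∈ₑ h × rest p ≡ true × (cross R h ≡ true ⊎ cross Q h ≡ true)
          sides {h} c with cross-elim rest h c
          ... | p , q , ph , qh , rp , rq with bool (R q) | bool (Q q)
          ...   | inj₂ ¬Rq | _ = p , ph , rp , inj₁ (cross-intro {R} ph qh (proj₁ (∧-true {R p} rp)) ¬Rq)
          ...   | inj₁ Rq | inj₂ ¬Qq = ⊥-elim (true≢false (∧-intro Rq (cong not ¬Qq)) rq)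
          ...   | inj₁ Rq | inj₁ Qq = p , ph , rp , inj₂ (cross-intro {Q} qh ph Qq (¬true λ r → true≢false (proj₂ (∧-true {R p} rp)) (cong not r)))
          noM : ∀ h → cross rest h ≡ true → M h ≡ false
          noM h c = ¬true λ Mh → case Mh (sides c)
            where
            case : M h ≡ true → _ → ⊥
            case Mh (p , ph , rp , inj₁ cR) with crossing-unique R (R-tight M mM) Mh cR Me ce
            ... | refl = ¬end ce ve Rv Qv ph rp
            case Mh (p , ph , rp , inj₂ cQ) with closedM h Mh cQ
            ... | refl = ¬end ce ve Rv Qv ph rp
          noM′ : ∀ h → cross rest h ≡ true → M′ h ≡ false
          noM′ h c = ¬true λ Mh → case Mh (sides c)
            where
            case : M′ h ≡ true → _ → ⊥
            case Mh (p , ph , rp , inj₁ cR) with crossing-unique R (R-tight M′ mM′) Mh cR M′f cf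
            ... | refl = ¬end cf yf Ry Qy ph rp
            case Mh (p , ph , rp , inj₂ cQ) with closedM′ h Mh cQ
            ... | inj₁ refl = ¬end ce ve Rv Qv ph rp
            ... | inj₂ refl = ¬end cf yf Ry Qy ph rp
          agree : AgreeOnCut rest M′ M
          agree h c = trans (noM′ h c) (sym (noM h c))
          -- Replacing `M′` by `M` on the unvisited part of `R` stays in the face and keeps the exit
          -- `f₀`. Contractibility of `R` then says that nothing has changed.
          same : ∀ g → ins rest g ≡ true → M g ≡ M′ g
          same g ir = trans (sym (swap-in {rest} agree {s g} {g} (inj₁ refl) (ins-elim {rest} ir (inj₁ refl))))
            (R-contr (Min-swap rest agree mM′ mM) mM′ (trans (swap-out {rest} agree yf (trans (cong (λ b → R y₀ ∧ not b) Qy) (∧-false (R y₀)))) M′f) M′f cf g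
              (ins-intro {R} (λ ye → proj₁ (∧-true (ins-elim {rest} ir ye)))))
            where
            ∧-false : ∀ c → c ∧ false ≡ false
            ∧-false true  = refl
            ∧-false false = refl
          value : ∀ g → alt (vec g) ds ≡ half M v₀ g - half M′ y₀ g ℤ.+ (χℤ (M′ g ∧ ins R g) - χℤ (M g ∧ ins R g))
          value g = begin
            alt (vec g) ds ≡⟨ formula g ⟩
            half M′ v₀ g - sgn (ev ds) (half (role (ev ds) M M′) z g) ℤ.+ X
              ≡⟨ cong (λ b → half M′ v₀ g - sgn b (half (role b M M′) z g) ℤ.+ X) even ⟩
            half M′ v₀ g - half M′ z g ℤ.+ X ≡⟨ cong (λ w → half M′ v₀ g - w ℤ.+ X) (half-cong M′ zy₀ g) ⟩
            half M′ v₀ g - half M′ y₀ g ℤ.+ X ≡⟨ final ⟩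
            half M v₀ g - half M′ y₀ g ℤ.+ (χℤ (M′ g ∧ ins R g) - χℤ (M g ∧ ins R g)) ∎
            where
            open ≡-Reasoning
            X = weightless g ((χℤ (M′ g) - χℤ (M g)) ℤ.* (χℤ (ins Q g) - χℤ (ins (nd v₀) g)))
            ¬insR : ins R e₀ ≡ false
            ¬insR = ¬true λ p → let x , y , xe , ye , Rx , Ry′ = cross-elim R e₀ ce in true≢false (ins-elim {R} p ye) Ry′
            D = χℤ (M′ g) - χℤ (M g)
            Y = χℤ (M′ g ∧ ins R g) - χℤ (M g ∧ ins R g)
            E : Bool → ℤ
            E b = half M′ v₀ g - half M′ y₀ g ℤ.+ χℤ (not b) ℤ.* (D ℤ.* (χℤ (ins Q g) - χℤ (ins (nd v₀) g)))
            final : half M′ v₀ g - half M′ y₀ g ℤ.+ X ≡ half M v₀ g - half M′ y₀ g ℤ.+ Y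
            final = final′ (e₀ ≟ g)
              where
              final-yes : e₀ ≡ g → E ⌊ e₀ ≟ g ⌋ ≡ half M v₀ g - half M′ y₀ g ℤ.+ Y
              final-yes p = trans (cong E (trans (cong (λ x → ⌊ e₀ ≟ x ⌋) (sym p)) (≟-refl e₀)))
                (trans (cong (λ a → a - half M′ y₀ g ℤ.+ 0ℤ) (half-sep M′ v₀ (subst Separated p sep)))
                  (trans (tab (M′ g) (M g) (half M′ y₀ g))
                    (sym (cong₂ (λ a b → a - half M′ y₀ g ℤ.+ (χℤ (M′ g ∧ b) - χℤ (M g ∧ b))) (half-sep M v₀ (subst Separated p sep)) (subst (λ x → ins R x ≡ false) p ¬insR)))))
                where
                tab : ∀ x y h → 0ℤ - h ℤ.+ 0ℤ ≡ 0ℤ - h ℤ.+ (χℤ (x ∧ false) - χℤ (y ∧ false))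
                tab true true h = refl
                tab true false h = refl
                tab false true h = refl
                tab false false h = refl
              final-no : e₀ ≢ g → E ⌊ e₀ ≟ g ⌋ ≡ half M v₀ g - half M′ y₀ g ℤ.+ Y
              final-no ne = trans (cong E (≟-false ne)) (trans (cong (λ w → half M′ v₀ g - half M′ y₀ g ℤ.+ w) (r₀ D (χℤ (ins Q g)) (χℤ (ins (nd v₀) g))))
                   (trans (cong (λ w → half M′ v₀ g - half M′ y₀ g ℤ.+ (w - D ℤ.* χℤ (ins (nd v₀) g))) (QR (bool (ins R g))))
                     (trans (cong₂ (λ a b → a - half M′ y₀ g ℤ.+ (b - D ℤ.* χℤ (ins (nd v₀) g))) (tab (M′ g) (ins (nd v₀) g)) (tab₂ (M′ g) (M g) (ins R g)))
                       (trans (r₁ (χℤ (M′ g)) (χℤ (M g)) (χℤ (ins (nd v₀) g)) (half M′ y₀ g) Y)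
                         (cong (λ a → a - half M′ y₀ g ℤ.+ Y) (sym (tab (M g) (ins (nd v₀) g))))))))
                where
                r₀ : ∀ d q i → ℤ.+ 1 ℤ.* (d ℤ.* (q - i)) ≡ d ℤ.* q - d ℤ.* i
                r₀ = solve-ℤ
                r₁ : ∀ x y i h w → x ℤ.* i - h ℤ.+ (w - (x - y) ℤ.* i) ≡ y ℤ.* i - h ℤ.+ w
                r₁ = solve-ℤ
                tab : ∀ x i → χℤ (x ∧ i) ≡ χℤ x ℤ.* χℤ i
                tab = ΣZ.χ-∧
                tab₂ : ∀ x y r → (χℤ x - χℤ y) ℤ.* χℤ r ≡ χℤ (x ∧ r) - χℤ (y ∧ r)
                tab₂ x y r = trans (ring (χℤ x) (χℤ y) (χℤ r)) (sym (cong₂ _-_ (ΣZ.χ-∧ x r) (ΣZ.χ-∧ y r)))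
                  where
                  ring : ∀ x y r → (x - y) ℤ.* r ≡ x ℤ.* r - y ℤ.* r
                  ring = solve-ℤ
                eq0 : ∀ a b c → (a - a) ℤ.* b ≡ (a - a) ℤ.* c
                eq0 = solve-ℤ
                agreeing : M′ g ≡ M g → (χℤ (M′ g) - χℤ (M g)) ℤ.* χℤ (ins Q g) ≡ (χℤ (M′ g) - χℤ (M g)) ℤ.* χℤ (ins R g)
                agreeing p = trans (cong (λ a → (χℤ a - χℤ (M g)) ℤ.* χℤ (ins Q g)) p) (trans (eq0 (χℤ (M g)) (χℤ (ins Q g)) (χℤ (ins R g))) (sym (cong (λ a → (χℤ a - χℤ (M g)) ℤ.* χℤ (ins R g)) p)))
                QR : ins R g ≡ true ⊎ ins R g ≡ false → (χℤ (M′ g) - χℤ (M g)) ℤ.* χℤ (ins Q g) ≡ (χℤ (M′ g) - χℤ (M g)) ℤ.* χℤ (ins R g)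
                QR (inj₂ ¬r) = cong (λ b → (χℤ (M′ g) - χℤ (M g)) ℤ.* χℤ b) (trans (¬true λ q → true≢false (ins-intro {R} (λ ye → Q⊆R _ (ins-elim {Q} q ye))) ¬r) (sym ¬r))
                QR (inj₁ r) with bool (ins Q g)
                ... | inj₁ q = cong (λ b → (χℤ (M′ g) - χℤ (M g)) ℤ.* χℤ b) (trans q (sym r))
                ... | inj₂ ¬q with bool (cross Q g)
                ...   | inj₁ c = agreeing (trans (¬true λ p → case p (closedM′ g p c)) (sym (¬true λ p → ne (sym (closedM g p c)))))
                  where
                  case : M′ g ≡ true → g ≡ e₀ ⊎ g ≡ f₀ → ⊥
                  case p (inj₁ w) = ne (sym w)
                  case p (inj₂ refl) = let x , y , xe , ye , Rx , Ry′ = cross-elim R g cf in true≢false (ins-elim {R} r ye) Ry′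
                ...   | inj₂ nc = agreeing (sym (same g (ins-intro {rest} λ ye → ∧-intro (ins-elim {R} r ye)
                          (cong not (¬true λ q → true≢false (ins-intro {Q} (λ we → not-cross Q nc ye we q)) ¬q)))))
              final′ : Dec (e₀ ≡ g) → E ⌊ e₀ ≟ g ⌋ ≡ half M v₀ g - half M′ y₀ g ℤ.+ Y
              final′ (yes p) = final-yes p
              final′ (no ne) = final-no ne

-- Laminar families and contraction levels

module Laminar {n m : ℕ} (Γ : Multigraph n m) where

  open Multigraph Γ

  open Matchings Γ
  open Faces Γ

  Contr : (Fin m → ℕ) → VS → Set
  Contr W S = ∀ {M N} → Min W M → Min W N → ∀ {e} → M e ≡ true → N e ≡ true → cross S e ≡ true → ∀ g → ins S g ≡ true → M g ≡ N g

  agree-tight : ∀ {W S M N} → Tight W S → Min W M → Min W N → ∀ {e} → M e ≡ true → N e ≡ true → cross S e ≡ true → AgreeOnCut S M N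
  agree-tight {W} {S} {M} {N} tS mM mN {e} Me Ne c h ch = iff→≡
    (λ p → subst (λ x → N x ≡ true) (crossing-unique S (tS M mM) Me c p ch) Ne)
    (λ p → subst (λ x → M x ≡ true) (crossing-unique S (tS N mN) Ne c p ch) Me)

  -- Exchange the two matchings inside S only.
  contr-subset : ∀ {W S A} → Tight W S → Tight W A → (∀ v → S v ≡ true → A v ≡ true) → Contr W A → Contr W S
  contr-subset {W} {S} {A} tS tA S⊆A cA {M} {N} mM mN {e} Me Ne ce g ig = trans (sym (cA {K} {M} mK mM Kh Mh ch g igA)) KN
    where
    agree : AgreeOnCut S M N
    agree = agree-tight {S = S} tS mM mN Me Ne ce
    K : ES
    K = swap S M N
    mK : Min W K
    mK = Min-swap S agree mM mN
    edge : ∃ λ h → M h ≡ true × cross A h ≡ true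
    edge = crossing-edge {M} {A} (tA M mM)
    h : Fin m
    h = proj₁ edge
    Mh : M h ≡ true
    Mh = proj₁ (proj₂ edge)
    ch : cross A h ≡ true
    ch = proj₂ (proj₂ edge)
    Kh : K h ≡ true
    Kh with cross-elim A h ch
    ... | x , y , xh , yh , Ax , Ay with bool (S x)
    ...   | inj₂ Sx = trans (swap-out {S} agree xh Sx) Mh
    ...   | inj₁ Sx = trans (swap-in {S} agree xh Sx) (trans (sym (agree h (cross-intro {S} xh yh Sx (¬true λ Sy → true≢false (S⊆A y Sy) Ay)))) Mh)
    igA : ins A g ≡ true
    igA = ins-intro {A} (λ xg → S⊆A _ (ins-elim {S} ig xg))
    KN : K g ≡ N g
    KN = swap-in {S} agree {s g} {g} (inj₁ refl) (ins-elim {S} ig (inj₁ refl))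

  Lams : List VS → Set
  Lams L = ∀ {S T} → S ∈ L → T ∈ L → Lam S T

  Singles : List VS → Set
  Singles L = ∀ v → ∃ λ S → S ∈ L × S ≗ star v

  -- Members of a laminar family that pairwise meet form a chain.
  largest : ∀ {L} (Q : VS → Set) (Q? : ∀ S → Dec (Q S)) → Lams L →
    (∀ {S T} → S ∈ L → T ∈ L → Q S → Q T → ∃ λ v → S v ≡ true × T v ≡ true) →
    (∀ {S} → S ∈ L → ¬ Q S) ⊎ ∃ λ S → S ∈ L × Q S × (∀ {T} → T ∈ L → Q T → ∀ v → T v ≡ true → S v ≡ true)
  largest {[]} Q Q? lam meet = inj₁ λ ()
  largest {T ∷ L} Q Q? lam meet with largest {L} Q Q? (λ p q → lam (there p) (there q)) (λ p q → meet (there p) (there q)) | Q? T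
  ... | inj₁ none | no ¬q = inj₁ λ { (here refl) → ¬q ; (there p) → none p }
  ... | inj₁ none | yes q = inj₂ (T , here refl , q , λ { (here refl) _ v x → x ; (there p) r → ⊥-elim (none p r) })
  ... | inj₂ (S , S∈ , qS , max) | no ¬q = inj₂ (S , there S∈ , qS , λ { (here refl) r → ⊥-elim (¬q r) ; (there p) r → max p r })
  ... | inj₂ (S , S∈ , qS , max) | yes q with lam (there S∈) (here refl)
  ...   | inj₁ S⊆T = inj₂ (T , here refl , q , λ { (here refl) _ v x → x ; (there p) r v x → S⊆T v (max p r v x) })
  ...   | inj₂ (inj₁ T⊆S) = inj₂ (S , there S∈ , qS , λ { (here refl) _ v x → T⊆S v x ; (there p) r → max p r })
  ...   | inj₂ (inj₂ disj) = let v , a , b = meet (there S∈) (here refl) qS q in ⊥-elim (disj v a b)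

  -- The nodes at level κ: the maximal members of L with at most κ vertices.
  module Level (L : List VS) (lam : Lams L) (single : Singles L) (κ : ℕ) (1≤κ : 1 ≤ κ) where

    star-size : ∀ v → cnt (star v) ≤ 1
    star-size v = unique→cnt≤1 (star v) λ p q → trans (≟-true p) (sym (≟-true q))

    opaque
      node : ∀ v → ∃ λ S → S ∈ L × (S v ≡ true × cnt S ≤ κ) × (∀ {T} → T ∈ L → T v ≡ true × cnt T ≤ κ → ∀ u → T u ≡ true → S u ≡ true)
      node v with largest {L} (λ S → S v ≡ true × cnt S ≤ κ) (λ S → (S v Bool.≟ true) ×-dec (cnt S ℕ.≤? κ)) lam
                          (λ _ _ p q → v , proj₁ p , proj₁ q)
      ... | inj₂ r = r
      ... | inj₁ none = let S , S∈ , eq = single v in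
            ⊥-elim (none S∈ (trans (eq v) (star-self v) , ℕ.≤-trans (ℕ.≤-reflexive (cnt-cong eq)) (ℕ.≤-trans (star-size v) 1≤κ)))

    nd : Fin n → VS
    nd v = proj₁ (node v)

    nd-∈ : ∀ v → nd v ∈ L
    nd-∈ v = proj₁ (proj₂ (node v))

    nd-refl : ∀ v → nd v v ≡ true
    nd-refl v = proj₁ (proj₁ (proj₂ (proj₂ (node v))))

    nd-size : ∀ v → cnt (nd v) ≤ κ
    nd-size v = proj₂ (proj₁ (proj₂ (proj₂ (node v))))

    nd-max : ∀ {T v} → T ∈ L → T v ≡ true → cnt T ≤ κ → ∀ u → T u ≡ true → nd v u ≡ true
    nd-max {T} {v} T∈ Tv le u = proj₂ (proj₂ (proj₂ (node v))) T∈ (Tv , le) u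

    nd-eq : ∀ {u v} → nd u v ≡ true → nd u ≗ nd v
    nd-eq {u} {v} p x = iff→≡ (λ q → incl x q) (λ q → nd-max (nd-∈ v) (incl u (nd-refl u)) (nd-size v) x q)
      where
      incl : ∀ x → nd u x ≡ true → nd v x ≡ true
      incl = nd-max (nd-∈ u) p (nd-size u)

    big-union : ∀ {S} → S ∈ L → κ < cnt S → ∀ {x y} → nd x y ≡ true → S x ≡ S y
    big-union {S} S∈ big {x} {y} p with lam (nd-∈ x) S∈
    ... | inj₁ sub = trans (sub x (nd-refl x)) (sym (sub y p))
    ... | inj₂ (inj₁ sup) = ⊥-elim (ℕ.<⇒≱ big (ℕ.≤-trans (cnt-mono sup) (nd-size x)))
    ... | inj₂ (inj₂ disj) = trans (¬true λ q → disj x (nd-refl x) q) (sym (¬true λ q → disj y p q))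

    -- Avoiding the cuts of larger members makes completed walks balanced on them (`cut-big`).
    Alive : (Fin m → ℕ) → Fin m → Set
    Alive W e = InFace W e × nd (s e) (t e) ≡ false × (∀ {Y} → Y ∈ L → κ < cnt Y → cross Y e ≡ false)

    Alive? : ∀ W e → Dec (Alive W e)
    Alive? W e = InFace? W e ×-dec (nd (s e) (t e) Bool.≟ false) ×-dec
      map′ (λ a {Y} p → All.lookup a p) (λ h → All.tabulate (λ {Y} p → h {Y} p)) (All.all? (λ Y → (κ ℕ.<? cnt Y) →? (cross Y e Bool.≟ false)) L)

  module System (L : List VS) (lam : Lams L) (single : Singles L) (κ : ℕ) (1≤κ : 1 ≤ κ)
                (W : Fin m → ℕ) (tight : ∀ {S} → S ∈ L → Tight W S) (contr : ∀ {S} → S ∈ L → cnt S ≤ κ → Contr W S) where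

    open Level L lam single κ 1≤κ

    sys : NodeSystem Γ W
    sys = record
      { nd = nd ; nd-refl = nd-refl ; nd-eq = nd-eq ; nd-tight = λ v → tight (nd-∈ v)
      ; nd-contr = λ v {M} {N} → contr (nd-∈ v) (nd-size v) {M} {N}
      ; Al = Alive W ; Al-face = proj₁ ; Al-sep = λ a → proj₁ (proj₂ a) }

    open Nodes Γ W sys public
    open Walks s t nd nd-refl nd-eq (Alive W) public

    raw-vanishes : ∀ {u v} ds → Wk u ds v → (∀ g → alt (vec g) ds ≡ 0ℤ) → ∀ g → alt (raw g) ds ≡ 0ℤ
    raw-vanishes ds w h g with bool (nd (s g) (t g))
    ... | inj₂ sep = trans (sym (alt-cong-Wk ds w (λ al → vec-raw al sep))) (h g)
    ... | inj₁ same = trans (alt-cong-Wk ds w (λ {e} al → cong χℤ (≟-false {u = e} λ { refl → true≢false same (proj₁ (proj₂ al)) }))) (alt-zero ds)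
      where
      alt-zero : ∀ ds → alt (λ _ → 0ℤ) ds ≡ 0ℤ
      alt-zero [] = refl
      alt-zero (d ∷ ds) = cong (λ z → 0ℤ - z) (alt-zero ds)

    module Kill {l : ℕ} (good : Good l) where

      open Counting (Alive? W) good public

      toVector : List DE → Fin m → ℤ
      toVector r g = alt (vec g) r

      vectors : List (Fin m → ℤ)
      vectors = map toVector (proj₁ few-walks)

      vectors-length : length vectors ≡ (1 + (m * 2 + (m * 2) * ((m * 2) * 2))) ℕ.^ 4
      vectors-length = trans (length-map toVector (proj₁ few-walks)) (proj₁ (proj₂ few-walks))

      vectors-bound : ∀ {c} → c ∈ vectors → ∀ e → ∣ c e ∣ ≤ 4 * (2 + l)
      vectors-bound c∈ e =
        let r , r∈ , eq = ∈-map⁻ toVector c∈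
        in subst (λ c → ∣ c e ∣ ≤ 4 * (2 + l)) (sym eq) (ℕ.≤-trans (alt-bound (vec e) (vec≤1 e) r) (proj₁ (proj₂ (proj₂ few-walks)) r∈))

      find-vector : ∀ {u v} ds → Wk u ds v → wtw ds ≤ l + l → ∃ λ c → c ∈ vectors × (∀ g → c g ≡ alt (vec g) ds)
      find-vector ds w le =
        let r , r∈ , eq = proj₂ (proj₂ (proj₂ few-walks)) ds w (ℕ.≤-trans (ℕ.+-mono-≤ le le) (ℕ.≤-reflexive (four l)))
        in toVector r , ∈-map⁺ toVector r∈ , λ g → alt-≡ eq (vec g)
        where
        four : ∀ l → l + l + (l + l) ≡ 4 * l
        four l = trans (ℕ.+-assoc l l (l + l)) (cong (λ x → l + (l + (l + x))) (sym (ℕ.+-identityʳ l)))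

  -- In both cases the newly added weight is orthogonal to the vector, and the modulus was chosen to
  -- be orthogonal to no nonzero vector of `Z`. For `diff` the reason is equal weights of
  -- minimisers, for `ortho` it is duality.
  record Kills (W W′ : Fin m → ℕ) (Z : List (Fin m → ℤ)) : Set where
    field
      sub   : ∀ {M} → Min W′ M → Min W M
      diff  : ∀ {c} → c ∈ Z → ∀ {M N} → Min W′ M → Min W′ N → (∀ g → c g ≡ χℤ (N g) - χℤ (M g)) → ∀ g → c g ≡ 0ℤ
      ortho : ∀ {c} → c ∈ Z → Supported W′ c → (∀ S → Tight W′ S → HZ.cut c S ≡ 0ℤ) → ∀ g → c g ≡ 0ℤ

  record Inv (W : Fin m → ℕ) (l : ℕ) : Set where
    field
      L       : List VS
      ML      : MaxLaminar W L
      1≤l     : 1 ≤ l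
      single  : Singles L
      contr   : ∀ {S} → S ∈ L → cnt S ≤ l → Contr W S
      good    : System.Good L (MaxLaminar.lam ML) single l 1≤l W (MaxLaminar.tight ML) contr l

  singles : ∀ {W L} → MaxLaminar W L → Singles L
  singles ML v = MaxLaminar.maximal ML (star v) (Tight-star v) (λ {T} _ → lam-star T)
    where
    lam-star : ∀ T → Lam (star v) T
    lam-star T with bool (T v)
    ... | inj₁ p = inj₁ λ u q → subst (λ x → T x ≡ true) (sym (≟-true q)) p
    ... | inj₂ p = inj₂ (inj₂ λ u q r → true≢false (subst (λ x → T x ≡ true) (≟-true q) r) p)

  -- Sets with one vertex have no edges inside, and a nonempty even walk enters at least two nodes,
  -- so it weighs at least 2.
  initial : ∀ W → Inv W 1
  initial W with extend W [] (λ ()) (λ ())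
  ... | L , ML , _ = record { L = L ; ML = ML ; 1≤l = ℕ.≤-refl ; single = singles ML ; contr = contr ; good = good }
    where
    contr : ∀ {S} → S ∈ L → cnt S ≤ 1 → Contr W S
    contr {S} S∈ le mM mN Me Ne c g ig = ⊥-elim (s≢t g (cnt≤1→unique S le (proj₁ (∧-true ig)) (proj₂ (∧-true {S (s g)} ig))))
    open System L (MaxLaminar.lam ML) (singles ML) 1 ℕ.≤-refl W (MaxLaminar.tight ML) contr using (Good; sz≥1; head)
    good : Good 1
    good u [] w e le g = refl
    good u (d ∷ []) w () le g
    good u (d ∷ d′ ∷ ds) w e le g = ⊥-elim (ℕ.<⇒≱ (ℕ.+-mono-≤ (sz≥1 (head d)) (ℕ.≤-trans (sz≥1 (head d′)) (ℕ.m≤m+n _ _))) le)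

  -- The whole vertex set serves as region: its cut is empty, and no tight set is too large to be
  -- crossed.
  final : ∀ {W l} → Inv W l → n ≤ l → ∀ {M N} → Min W M → Min W N → M ≗ N
  final {W} {l} inv n≤l {M} {N} mM mN g =
    Region.region W (λ p → p) l (λ u ds w e le _ _ _ → good u ds w e le) full (λ _ → refl) alive (ℕ.≤-trans (cnt≤k full) n≤l) mM mN none g refl
    where
    open Inv inv
    open Level L (MaxLaminar.lam ML) single l 1≤l using (Alive)
    open System L (MaxLaminar.lam ML) single l 1≤l W (MaxLaminar.tight ML) contr using (Separated; module Region)
    alive : ∀ {N e} → Min W N → N e ≡ true → ins full e ≡ true → Separated e → Alive W e
    alive {N} mN Ne _ sep = (N , mN , Ne) , sep , λ {Y} _ big → ⊥-elim (ℕ.<⇒≱ big (ℕ.≤-trans (cnt≤k Y) n≤l))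
    none : AgreeOnCut full M N
    none e ()

-- Chains of tight sets

module Chains {n m : ℕ} (Γ : Multigraph n m) where

  open Multigraph Γ

  open Matchings Γ
  open Faces Γ
  open Laminar Γ

  cross-∖ : ∀ {S T : VS} {e} → cross (S ∖ T) e ≡ true → cross S e ≡ true ⊎ cross T e ≡ true
  cross-∖ {S} {T} {e} c with cross-elim (S ∖ T) e c
  ... | p , q , pe , qe , Dp , Dq with bool (S q) | bool (T q)
  ...   | inj₂ ¬Sq | _ = inj₁ (cross-intro {S} pe qe (proj₁ (∧-true Dp)) ¬Sq)
  ...   | inj₁ Sq | inj₁ Tq = inj₂ (cross-intro {T} qe pe Tq (¬true λ Tp → true≢false (proj₂ (∧-true {S p} Dp)) (cong not Tp)))
  ...   | inj₁ Sq | inj₂ ¬Tq = ⊥-elim (true≢false (∧-intro Sq (cong not ¬Tq)) Dq)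

  agree-∖ : ∀ {S T M N} → AgreeOnCut S M N → AgreeOnCut T M N → AgreeOnCut (S ∖ T) M N
  agree-∖ {S} {T} a b e c with cross-∖ {S} {T} {e} c
  ... | inj₁ p = a e p
  ... | inj₂ p = b e p

  Determined : (Fin m → ℕ) → VS → VS → Set
  Determined W T S = ∀ {M N} → Min W M → Min W N → AgreeOnCut T M N → AgreeOnCut S M N → ∀ g → ins (S ∖ T) g ≡ true → M g ≡ N g

  determined-trans : ∀ {W T R S} → (∀ v → T v ≡ true → R v ≡ true) → (∀ v → R v ≡ true → S v ≡ true) →
    Determined W T R → Determined W R S → ∀ {M N} → Min W M → Min W N →
    AgreeOnCut T M N → AgreeOnCut R M N → AgreeOnCut S M N → ∀ h → (S ∖ T) (s h) ≡ true → M h ≡ N h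
  determined-trans {W} {T} {R} {S} T⊆R R⊆S d₁ d₂ {M} {N} mM mN aT aR aS h sh with bool (cross (S ∖ T) h)
  ... | inj₁ c = agree-∖ {S} {T} aS aT h c
  ... | inj₂ nc with bool (cross R h)
  ...   | inj₁ c = aR h c
  ...   | inj₂ ncR with bool (R (s h))
  ...     | inj₁ Rs = d₁ mM mN aT aR h (ins-intro {R ∖ T} (λ xh → ∧-intro (not-cross R ncR (inj₁ refl) xh Rs) (proj₂ (∧-true {S _} (not-cross (S ∖ T) nc (inj₁ refl) xh sh)))))
  ...     | inj₂ ¬Rs = d₂ mM mN aR aS h (ins-intro {S ∖ R} (λ xh → ∧-intro (proj₁ (∧-true (not-cross (S ∖ T) nc (inj₁ refl) xh sh)))
                          (cong not (¬true λ Rx → true≢false (not-cross R ncR xh (inj₁ refl) Rx) ¬Rs))))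

  module Keys (W : Fin m → ℕ) where

    -- The edge along which a minimiser crosses a tight set; `nothing` belongs to the empty set,
    -- which stands at the lower end of each chain.
    Key : Set
    Key = Maybe (Fin m)

    keys : List Key
    keys = nothing ∷ map just (allFin m)

    ∈-keys : ∀ k → k ∈ keys
    ∈-keys nothing = here refl
    ∈-keys (just e) = there (∈-map⁺ just (∈-allFin e))

    length-keys : length keys ≡ suc m
    length-keys = cong suc (trans (length-map just (allFin m)) (length-tabulate {n = m} _))

    HasKey : VS → Key → ES → Set
    HasKey X nothing  M = ∀ e → M e ≡ true → cross X e ≡ false
    HasKey X (just e) M = M e ≡ true × cross X e ≡ true

    HasKey? : ∀ X k M → Dec (HasKey X k M)
    HasKey? X nothing M = all? λ e → (M e Bool.≟ true) →? (cross X e Bool.≟ false)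
    HasKey? X (just e) M = (M e Bool.≟ true) ×-dec (cross X e Bool.≟ true)

    HasKey-resp : ∀ X k → Respects≗ (HasKey X k)
    HasKey-resp X nothing eq h e p = h e (trans (eq e) p)
    HasKey-resp X (just e) eq (a , b) = trans (sym (eq e)) a , b

    Simple : VS → Set
    Simple X = Tight W X ⊎ (∀ v → X v ≡ false)

    no-cross : ∀ {X : VS} → (∀ v → X v ≡ false) → ∀ e → cross X e ≡ false
    no-cross {X} h e = cong₂ _xor_ (h (s e)) (h (t e))

    key-of : ∀ {X M} → Simple X → Min W M → ∃ λ k → HasKey X k M
    key-of {X} {M} (inj₁ tX) mM = let e , p = crossing-edge {M} {X} (tX M mM) in just e , p
    key-of {X} (inj₂ emp) mM = nothing , λ e _ → no-cross emp e

    key-agree : ∀ {X M N} k → Simple X → Min W M → Min W N → HasKey X k M → HasKey X k N → AgreeOnCut X M N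
    key-agree nothing _ _ _ a b e c = trans (¬true λ p → true≢false c (a e p)) (sym (¬true λ p → true≢false c (b e p)))
    key-agree {X} (just e) (inj₁ tX) mM mN (a , c) (b , _) = agree-tight {S = X} tX mM mN a b c
    key-agree (just e) (inj₂ emp) _ _ (_ , c) _ = ⊥-elim (true≢false c (no-cross emp e))

    key-transport : ∀ {X M N} k → AgreeOnCut X M N → HasKey X k M → HasKey X k N
    key-transport nothing ag h e p = ¬true λ c → true≢false c (h e (trans (ag e c) p))
    key-transport (just e) ag (a , c) = trans (sym (ag e c)) a , c

    module _ (S T R : VS) where

      Fits : Key → Key → Key → ES → Set
      Fits kS kT kR M = Min W M × HasKey S kS M × HasKey T kT M × HasKey R kR M

      opaque
        fit? : ∀ kS kT kR → Dec (∃ (Fits kS kT kR))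
        fit? kS kT kR = anyFun? (λ eq (a , b , c , d) → Min-resp eq a , HasKey-resp S kS eq b , HasKey-resp T kT eq c , HasKey-resp R kR eq d)
          (λ M → Min? W M ×-dec HasKey? S kS M ×-dec HasKey? T kT M ×-dec HasKey? R kR M)

        -- Indexing by keys instead of matchings keeps the list polynomial. Once shorter segments
        -- are determined, the chosen `M₁` and `M₂` do not influence the vector; combinations that
        -- no minimiser realises get the zero vector.
        difference : Key → Key → Key → Key → Fin m → ℤ
        difference kS kT k k′ with fit? kS kT k | fit? kS kT k′
        ... | yes (M₁ , _) | yes (M₂ , _) = λ g → χℤ (swap (S ∖ T) M₁ M₂ g) - χℤ (M₁ g)
        ... | _            | _            = λ _ → 0ℤ

        difference-bound : ∀ kS kT k k′ e → ∣ difference kS kT k k′ e ∣ ≤ 1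
        difference-bound kS kT k k′ e with fit? kS kT k | fit? kS kT k′
        ... | no _ | _ = z≤n
        ... | yes _ | no _ = z≤n
        ... | yes (M₁ , _) | yes (M₂ , _) = tab (swap (S ∖ T) M₁ M₂ e) (M₁ e)
          where
          tab : ∀ a b → ∣ χℤ a - χℤ b ∣ ≤ 1
          tab true true = z≤n
          tab true false = ℕ.≤-refl
          tab false true = ℕ.≤-refl
          tab false false = z≤n

        difference-spec : ∀ kS kT k k′ → ∃ (Fits kS kT k) → ∃ (Fits kS kT k′) →
          ∃ λ M₁ → ∃ λ M₂ → Fits kS kT k M₁ × Fits kS kT k′ M₂ × (∀ g → difference kS kT k k′ g ≡ χℤ (swap (S ∖ T) M₁ M₂ g) - χℤ (M₁ g))
        difference-spec kS kT k k′ x y with fit? kS kT k | fit? kS kT k′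
        ... | yes (M₁ , p) | yes (M₂ , q) = M₁ , M₂ , p , q , λ g → refl
        ... | no ¬x | _ = ⊥-elim (¬x x)
        ... | yes _ | no ¬y = ⊥-elim (¬y y)

  module Chain (L : List VS) (lam : Lams L) (single : Singles L) (l : ℕ) (1≤l : 1 ≤ l) where

    1≤2l : 1 ≤ l + l
    1≤2l = ℕ.≤-trans 1≤l (ℕ.m≤m+n l l)

    module Lo = Level L lam single l 1≤l
    module Hi = Level L lam single (l + l) 1≤2l

    InChain : Fin n → ℕ → VS → Set
    InChain v r S = (l < cnt S × cnt S ≤ r) × (∀ u → S u ≡ true → Hi.nd v u ≡ true)

    InChain? : ∀ v r S → Dec (InChain v r S)
    InChain? v r S = ((l ℕ.<? cnt S) ×-dec (cnt S ℕ.≤? r)) ×-dec all? (λ u → (S u Bool.≟ true) →? (Hi.nd v u Bool.≟ true))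

    -- Two disjoint sets with more than `l` vertices each do not fit into a node with at most
    -- `l + l`.
    meet : ∀ v r {S T} → S ∈ L → T ∈ L → InChain v r S → InChain v r T → ∃ λ u → S u ≡ true × T u ≡ true
    meet v r {S} {T} _ _ ((bS , _) , iS) ((bT , _) , iT) with any? (λ u → (S u Bool.≟ true) ×-dec (T u Bool.≟ true))
    ... | yes p = p
    ... | no ¬p = ⊥-elim (ℕ.<⇒≱ (ℕ.+-mono-< bS bT) (ℕ.≤-trans (ℕ.≤-reflexive (sym union)) (ℕ.≤-trans (cnt-mono inc) (Hi.nd-size v))))
      where
      union : cnt (S ∪ T) ≡ cnt S + cnt T
      union = cnt-+ S T (S ∪ T) pt
        where
        pt : ∀ u → χℕ (S u ∨ T u) ≡ χℕ (S u) + χℕ (T u)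
        pt u with S u in p | T u in q
        ... | true | true = ⊥-elim (¬p (u , p , q))
        ... | true | false = refl
        ... | false | _ = refl
      inc : ∀ u → (S ∪ T) u ≡ true → Hi.nd v u ≡ true
      inc u p with ∨-true {S u} p
      ... | inj₁ q = iS u q
      ... | inj₂ q = iT u q

    opaque
      -- The largest member of L with more than l and at most r vertices inside the node of v, or ∅.
      X : Fin n → ℕ → VS
      X v r with largest {L} (InChain v r) (InChain? v r) lam (meet v r)
      ... | inj₁ _ = λ _ → false
      ... | inj₂ (S , _) = S

      X-spec : ∀ v r → (X v r ∈ L × InChain v r (X v r)) ⊎ (∀ u → X v r u ≡ false)
      X-spec v r with largest {L} (InChain v r) (InChain? v r) lam (meet v r)
      ... | inj₁ _ = inj₂ λ _ → refl
      ... | inj₂ (S , S∈ , q , _) = inj₁ (S∈ , q)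

      X-max : ∀ v r {T} → T ∈ L → InChain v r T → ∀ u → T u ≡ true → X v r u ≡ true
      X-max v r T∈ q with largest {L} (InChain v r) (InChain? v r) lam (meet v r)
      ... | inj₁ none = ⊥-elim (none T∈ q)
      ... | inj₂ (S , _ , _ , max) = max T∈ q

    X-mono : ∀ v {r r′} → r ≤ r′ → ∀ u → X v r u ≡ true → X v r′ u ≡ true
    X-mono v {r} {r′} le u p with X-spec v r
    ... | inj₂ emp = ⊥-elim (true≢false p (emp u))
    ... | inj₁ (∈L , ((a , b) , c)) = X-max v r′ ∈L ((a , ℕ.≤-trans b le) , c) u p

    X-nodes : ∀ v r {x y} → Lo.nd x y ≡ true → X v r x ≡ X v r y
    X-nodes v r {x} {y} p with X-spec v r
    ... | inj₂ emp = trans (emp x) (sym (emp y))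
    ... | inj₁ (∈L , ((a , _) , _)) = Lo.big-union ∈L a p

    -- Thresholds on the size replace positions in the chain: a segment can be divided numerically,
    -- and thresholds between two sizes simply repeat a set.
    Segments : (Fin m → ℕ) → ℕ → Set
    Segments W d = ∀ v r r′ → r ≤ r′ → r′ ≤ r + d → r′ ≤ l + l → Determined W (X v r) (X v r′)

    module Base (W : Fin m → ℕ) (tight : ∀ {S} → S ∈ L → Tight W S) (contr : ∀ {S} → S ∈ L → cnt S ≤ l → Contr W S)
                (good : System.Good L lam single l 1≤l W tight contr l) where

      open System L lam single l 1≤l W tight contr using (Wk; wtw; vec; raw-vanishes; UnionOfNodes; Separated; module Region; module Kill)
      open Kill good using (vectors; vectors-length; vectors-bound; find-vector) public

      -- A member of `L` inside `S` with more than `l` vertices either has at most `r` and lies in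
      -- `T`, or has at least `r′` and equals `S`. No edge inside the segment crosses it, so
      -- `region` applies to the segment.
      base : ∀ {W′} → Kills W W′ vectors → Segments W′ 1
      base {W′} K v r r′ le le′ _ {M} {N} mM mN aT aS g ig =
        Region.region W′ sub (l + l) vanish R R-nodes R-alive R-small mM mN (agree-∖ {S} {T} aS aT) g ig
        where
        open Kills K
        S = X v r′
        T = X v r
        R : VS
        R = S ∖ T
        vanish : ∀ u ds → Wk u ds u → ev ds ≡ true → wtw ds ≤ l + l → ∀ {M N} → Min W′ M → Min W′ N →
                 (∀ g → alt (vec g) ds ≡ χℤ (N g) - χℤ (M g)) → ∀ g → alt (raw g) ds ≡ 0ℤ
        vanish u ds w _ le mM mN eq = raw-vanishes ds w λ g →
          let c , c∈ , ceq = find-vector ds w le in trans (sym (ceq g)) (diff c∈ mM mN (λ h → trans (ceq h) (eq h)) g)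
        R-nodes : UnionOfNodes R
        R-nodes p = cong₂ (λ a b → a ∧ not b) (X-nodes v r′ p) (X-nodes v r p)
        R-small : cnt R ≤ l + l
        R-small = ℕ.≤-trans (cnt-mono {p = R} {q = S} (λ i p → proj₁ (∧-true p))) (size (X-spec v r′))
          where
          size : _ → cnt S ≤ l + l
          size (inj₁ (_ , (_ , inc))) = ℕ.≤-trans (cnt-mono inc) (Hi.nd-size v)
          size (inj₂ emp) = ℕ.≤-trans (ℕ.≤-reflexive (cnt-none S emp)) z≤n
        R-alive : ∀ {N e} → Min W N → N e ≡ true → ins R e ≡ true → Separated e → Lo.Alive W e
        R-alive {N} {e} mN Ne iR sep = (N , mN , Ne) , sep , λ {Y} Y∈ big → ¬true λ c → absurd Y Y∈ big c (X-spec v r′)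
          where
          absurd : ∀ Y → Y ∈ L → l < cnt Y → cross Y e ≡ true → (S ∈ L × InChain v r′ S) ⊎ (∀ u → S u ≡ false) → ⊥
          absurd Y Y∈ big c (inj₂ emp) = true≢false (proj₁ (∧-true (ins-elim {R} iR (inj₁ refl)))) (emp (s e))
          absurd Y Y∈ big c (inj₁ (S∈ , ((_ , sz≤) , inc))) with cross-elim Y e c
          ... | p , q , pe , qe , Yp , Yq = go (lam Y∈ S∈)
            where
            Rp = ∧-true {S p} (ins-elim {R} iR pe)
            Rq = ∧-true {S q} (ins-elim {R} iR qe)
            go : Lam Y S → ⊥
            go (inj₂ (inj₁ S⊆Y)) = true≢false (S⊆Y q (proj₁ Rq)) Yq
            go (inj₂ (inj₂ disj)) = disj p Yp (proj₁ Rp)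
            go (inj₁ Y⊆S) with cnt Y ℕ.≤? r
            ... | yes small = true≢false (proj₂ Rp) (cong not (X-max v r Y∈ ((big , small) , λ u Yu → inc u (Y⊆S u Yu)) p Yp))
            ... | no large = true≢false (subset-≥ Y⊆S (ℕ.≤-trans sz≤ (ℕ.≤-trans le′ (ℕ.≤-trans (ℕ.≤-reflexive (ℕ.+-comm r 1)) (ℕ.≰⇒> large)))) q (proj₁ Rq)) Yq

    module Double (W : Fin m → ℕ) (tight : ∀ {S} → S ∈ L → Tight W S) (d : ℕ) where

      open Keys W

      -- Capped at `r′`, so that a short segment simply gets an empty upper half.
      mid : ℕ → ℕ → ℕ
      mid r r′ = (r + d) ⊓ r′

      Index : Set
      Index = Fin n × ℕ × ℕ × Key × Key × Key × Key

      infixr 4 _⊗_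
      _⊗_ : {A B : Set} → List A → List B → List (A × B)
      xs ⊗ ys = cartesianProductWith _,_ xs ys

      sizes : List ℕ
      sizes = upTo (suc (l + l))

      indices : List Index
      indices = allFin n ⊗ sizes ⊗ sizes ⊗ keys ⊗ keys ⊗ keys ⊗ keys

      vector : Index → Fin m → ℤ
      vector (v , r , r′ , kS , kT , k , k′) = difference (X v r′) (X v r) (X v (mid r r′)) kS kT k k′

      vectors : List (Fin m → ℤ)
      vectors = map vector indices

      vectors-length : length vectors ≡ n * (suc (l + l) * (suc (l + l) * (suc m * (suc m * (suc m * suc m)))))
      vectors-length = trans (length-map vector indices)
        (prod (allFin n) I₅ (length-tabulate {n = n} _) (prod sizes I₄ (length-upTo (suc (l + l))) (prod sizes I₃ (length-upTo (suc (l + l)))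
          (prod keys I₂ length-keys (prod keys I₁ length-keys (prod keys keys length-keys length-keys))))))
        where
        I₁ = keys ⊗ keys
        I₂ = keys ⊗ I₁
        I₃ = keys ⊗ I₂
        I₄ = sizes ⊗ I₃
        I₅ = sizes ⊗ I₄
        prod : ∀ {A B : Set} (xs : List A) (ys : List B) {a b} → length xs ≡ a → length ys ≡ b → length (xs ⊗ ys) ≡ a * b
        prod xs ys p q = trans (length-cartesian _,_ xs ys) (cong₂ _*_ p q)

      vectors-bound : ∀ {c} → c ∈ vectors → ∀ e → ∣ c e ∣ ≤ 1
      vectors-bound {c} c∈ e =
        let (v , r , r′ , kS , kT , k , k′) , _ , eq = ∈-map⁻ vector c∈
        in subst (λ c → ∣ c e ∣ ≤ 1) (sym eq) (difference-bound (X v r′) (X v r) (X v (mid r r′)) kS kT k k′ e)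

      ∈-indices : ∀ v {r r′} kS kT k k′ → r ≤ l + l → r′ ≤ l + l → (v , r , r′ , kS , kT , k , k′) ∈ indices
      ∈-indices v kS kT k k′ a b = ∈-cartesianProductWith⁺ _,_ (∈-allFin v) (∈-cartesianProductWith⁺ _,_ (∈-upTo⁺ (s≤s a))
        (∈-cartesianProductWith⁺ _,_ (∈-upTo⁺ (s≤s b)) (∈-cartesianProductWith⁺ _,_ (∈-keys kS) (∈-cartesianProductWith⁺ _,_ (∈-keys kT)
          (∈-cartesianProductWith⁺ _,_ (∈-keys k) (∈-keys k′))))))

      X-simple : ∀ v r → Simple (X v r)
      X-simple v r with X-spec v r
      ... | inj₁ (∈L , _) = inj₁ (tight ∈L)
      ... | inj₂ emp = inj₂ emp

      -- The matchings may cross the middle set along different edges. Each half is determined by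
      -- its keys, so exchanging `M` for `N` on the whole segment changes `M` by a vector of the
      -- list. This is a difference of two minimisers, hence zero.
      double : Segments W d → ∀ {W′} → Kills W W′ vectors → Segments W′ (d + d)
      double seg {W′} K v r r′ le le′ r′≤ {M} {N} mM mN aT aS g ig = sym (from-diff (diff c∈ mM mP value g))
        where
        open Kills K
        q = mid r r′
        S = X v r′
        T = X v r
        R = X v q
        r≤q : r ≤ q
        r≤q = ℕ.⊓-glb (ℕ.m≤m+n r d) le
        q≤r′ : q ≤ r′
        q≤r′ = ℕ.m⊓n≤n (r + d) r′
        r′≤q+d : r′ ≤ q + d
        r′≤q+d with ℕ.≤-total (r + d) r′
        ... | inj₁ x = subst (λ z → r′ ≤ z + d) (sym (ℕ.m≤n⇒m⊓n≡m x)) (ℕ.≤-trans le′ (ℕ.≤-reflexive (sym (ℕ.+-assoc r d d))))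
        ... | inj₂ x = subst (λ z → r′ ≤ z + d) (sym (ℕ.m≥n⇒m⊓n≡n x)) (ℕ.m≤m+n r′ d)
        same : ∀ {A B} → Min W A → Min W B → AgreeOnCut T A B → AgreeOnCut R A B → AgreeOnCut S A B → ∀ h → (S ∖ T) (s h) ≡ true → A h ≡ B h
        same = determined-trans {W} {T} {R} {S} (X-mono v r≤q) (X-mono v q≤r′)
          (seg v r q r≤q (ℕ.m⊓n≤m (r + d) r′) (ℕ.≤-trans q≤r′ r′≤)) (seg v q r′ q≤r′ r′≤q+d r′≤)
        kS = proj₁ (key-of {S} (X-simple v r′) (sub mM))
        hS = proj₂ (key-of {S} (X-simple v r′) (sub mM))
        kT = proj₁ (key-of {T} (X-simple v r) (sub mM))
        hT = proj₂ (key-of {T} (X-simple v r) (sub mM))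
        k = proj₁ (key-of {R} (X-simple v q) (sub mM))
        h = proj₂ (key-of {R} (X-simple v q) (sub mM))
        k′ = proj₁ (key-of {R} (X-simple v q) (sub mN))
        h′ = proj₂ (key-of {R} (X-simple v q) (sub mN))
        fitM : Fits S T R kS kT k M
        fitM = sub mM , hS , hT , h
        fitN : Fits S T R kS kT k′ N
        fitN = sub mN , key-transport {S} {M} {N} kS aS hS , key-transport {T} {M} {N} kT aT hT , h′
        spec = difference-spec S T R kS kT k k′ (M , fitM) (N , fitN)
        M₁ = proj₁ spec
        M₂ = proj₁ (proj₂ spec)
        fit₁ : Fits S T R kS kT k M₁
        fit₁ = proj₁ (proj₂ (proj₂ spec))
        fit₂ : Fits S T R kS kT k′ M₂
        fit₂ = proj₁ (proj₂ (proj₂ (proj₂ spec)))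
        same-fit : ∀ {κ A B} → Fits S T R kS kT κ A → Fits S T R kS kT κ B → ∀ h → (S ∖ T) (s h) ≡ true → A h ≡ B h
        same-fit {κ} (mA , a₁ , a₂ , a₃) (mB , b₁ , b₂ , b₃) = same mA mB
          (key-agree {T} kT (X-simple v r) mA mB a₂ b₂) (key-agree {R} κ (X-simple v q) mA mB a₃ b₃) (key-agree {S} kS (X-simple v r′) mA mB a₁ b₁)
        c : Fin m → ℤ
        c = vector (v , r , r′ , kS , kT , k , k′)
        c∈ : c ∈ vectors
        c∈ = ∈-map⁺ vector (∈-indices v kS kT k k′ (ℕ.≤-trans le r′≤) r′≤)
        P : ES
        P = swap (S ∖ T) M N
        mP : Min W′ P
        mP = Min-swap (S ∖ T) (agree-∖ {S} {T} aS aT) mM mN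
        value : ∀ h → c h ≡ χℤ (P h) - χℤ (M h)
        value h = trans (proj₂ (proj₂ (proj₂ (proj₂ spec))) h) (cases (bool ((S ∖ T) (s h))))
          where
          sel : ∀ (A B : ES) b → (S ∖ T) (s h) ≡ b → swap (S ∖ T) A B h ≡ (if b then B h else A h)
          sel A B b p = cong (λ b → if b then B h else A h) p
          cases : (S ∖ T) (s h) ≡ true ⊎ (S ∖ T) (s h) ≡ false → χℤ (swap (S ∖ T) M₁ M₂ h) - χℤ (M₁ h) ≡ χℤ (P h) - χℤ (M h)
          cases (inj₁ p) = cong₂ (λ a b → χℤ a - χℤ b) (trans (sel M₁ M₂ true p) (trans (same-fit {k′} fit₂ fitN h p) (sym (sel M N true p)))) (same-fit {k} fit₁ fitM h p)
          cases (inj₂ p) = trans (cong (λ a → χℤ a - χℤ (M₁ h)) (sel M₁ M₂ false p)) (trans (ℤ.+-inverseʳ (χℤ (M₁ h)))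
                             (sym (trans (cong (λ a → χℤ a - χℤ (M h)) (sel M N false p)) (ℤ.+-inverseʳ (χℤ (M h))))))
        from-diff : c g ≡ 0ℤ → N g ≡ M g
        from-diff z = inj (N g) (M g) (trans (cong (λ a → χℤ a - χℤ (M g)) (sym (cong (λ b → if b then N g else M g) (ins-elim {S ∖ T} ig (inj₁ refl))))) (trans (sym (value g)) z))
          where
          inj : ∀ a b → χℤ a - χℤ b ≡ 0ℤ → a ≡ b
          inj true true _ = refl
          inj false false _ = refl

    -- The set `S` is the segment from the empty set at threshold `l` to threshold `cnt S`, and
    -- these differ by at most `l`.
    contract : ∀ {W} → (∀ {S} → S ∈ L → Tight W S) → (∀ {S} → S ∈ L → cnt S ≤ l → Contr W S) → Segments W l →
               ∀ {S} → S ∈ L → cnt S ≤ l + l → Contr W S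
    contract {W} tight contr seg {S} S∈ le {M} {N} mM mN {e} Me Ne c g ig with cnt S ℕ.≤? l
    ... | yes small = contr S∈ small mM mN Me Ne c g ig
    ... | no ¬small = seg v l (cnt S) (ℕ.<⇒≤ big) le le mM mN
            (λ e c → ⊥-elim (true≢false c (cong₂ _xor_ (empty (s e)) (empty (t e)))))
            (λ h ch → agree-tight {S = S} (tight S∈) mM mN Me Ne c h (trans (sym (cong₂ _xor_ (X≗S (s h)) (X≗S (t h)))) ch))
            g (ins-intro {X v (cnt S) ∖ X v l} (λ xg → ∧-intro (trans (X≗S _) (ins-elim {S} ig xg)) (cong not (empty _))))
      where
      big : l < cnt S
      big = ℕ.≰⇒> ¬small
      pt = cnt-exists S (ℕ.≤-trans (s≤s z≤n) big)
      v = proj₁ pt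
      inS : InChain v (cnt S) S
      inS = (big , ℕ.≤-refl) , Hi.nd-max S∈ (proj₂ pt) le
      X≗S : X v (cnt S) ≗ S
      X≗S with X-spec v (cnt S)
      ... | inj₂ emp = ⊥-elim (true≢false (X-max v (cnt S) S∈ inS v (proj₂ pt)) (emp v))
      ... | inj₁ (∈L , ((_ , sz) , _)) = λ u → iff→≡ (subset-≥ (X-max v (cnt S) S∈ inS) sz u) (X-max v (cnt S) S∈ inS u)
      empty : ∀ u → X v l u ≡ false
      empty with X-spec v l
      ... | inj₂ emp = emp
      ... | inj₁ (_ , ((a , b) , _)) = ⊥-elim (ℕ.<⇒≱ a b)

  opaque
    SegmentsOf : ∀ {W l} → Inv W l → (Fin m → ℕ) → ℕ → Set
    SegmentsOf {l = l} inv = Chain.Segments (Inv.L inv) (MaxLaminar.lam (Inv.ML inv)) (Inv.single inv) l (Inv.1≤l inv)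

    base-step : ∀ {W l} (inv : Inv W l) → ∃ λ Z → length Z ≡ (1 + (m * 2 + (m * 2) * ((m * 2) * 2))) ℕ.^ 4
      × (∀ {c} → c ∈ Z → ∀ e → ∣ c e ∣ ≤ 4 * (2 + l)) × (∀ {W′} → Kills W W′ Z → SegmentsOf inv W′ 1)
    base-step {W} {l} inv = B.vectors L lam single l 1≤l W tight contr good , B.vectors-length L lam single l 1≤l W tight contr good
      , B.vectors-bound L lam single l 1≤l W tight contr good , B.base L lam single l 1≤l W tight contr good
      where
      open Inv inv
      open MaxLaminar ML using (lam; tight)
      module B = Chain.Base

    double-step : ∀ {W₀ l} (inv : Inv W₀ l) W → (∀ {M} → Min W M → Min W₀ M) → ∀ d →
      ∃ λ Z → length Z ≡ n * (suc (l + l) * (suc (l + l) * (suc m * (suc m * (suc m * suc m)))))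
      × (∀ {c} → c ∈ Z → ∀ e → ∣ c e ∣ ≤ 1) × (SegmentsOf inv W d → ∀ {W′} → Kills W W′ Z → SegmentsOf inv W′ (d + d))
    double-step {W₀} {l} inv W sub d = D.vectors L lam single l 1≤l W tight′ d , D.vectors-length L lam single l 1≤l W tight′ d
      , D.vectors-bound L lam single l 1≤l W tight′ d , D.double L lam single l 1≤l W tight′ d
      where
      open Inv inv
      open MaxLaminar ML using (lam; tight)
      module D = Chain.Double
      tight′ : ∀ {S} → S ∈ L → Tight W S
      tight′ S∈ M mM = tight S∈ M (sub mM)

-- Balanced vectors

χℤ-ℕ : ∀ b → χℤ b ≡ ℤ.+ χℕ b
χℤ-ℕ true  = refl
χℤ-ℕ false = refl

opaque
  unfolding ΣN.∑ ΣZ.∑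
  ∑ℤ-ℕ : ∀ {k} (f : Fin k → ℕ) → ∑ℤ (λ i → ℤ.+ f i) ≡ ℤ.+ ∑ℕ f
  ∑ℤ-ℕ {zero} f = refl
  ∑ℤ-ℕ {suc k} f = cong (λ z → ℤ.+ f zero ℤ.+ z) (∑ℤ-ℕ (f ∘ suc))

∑-alt : ∀ {m} (v : Fin m → Fin m → ℤ) (a : Fin m → ℤ) ds → ∑ℤ (λ g → alt (v g) ds ℤ.* a g) ≡ alt (λ e → ∑ℤ (λ g → v g e ℤ.* a g)) ds
∑-alt v a [] = ΣZ.∑-0 (λ g → refl)
∑-alt v a (d ∷ ds) = trans (ΣZ.∑-cong (λ g → dist (v g (proj₁ d)) (alt (v g) ds) (a g)))
  (trans (∑ℤ-minus (λ g → v g (proj₁ d) ℤ.* a g) (λ g → alt (v g) ds ℤ.* a g)) (cong (λ z → ∑ℤ (λ g → v g (proj₁ d) ℤ.* a g) - z) (∑-alt v a ds)))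
  where
  dist : ∀ x y z → (x - y) ℤ.* z ≡ x ℤ.* z - y ℤ.* z
  dist = solve-ℤ

module Refinement {n m : ℕ} (Γ : Multigraph n m) where

  open Multigraph Γ

  open Matchings Γ
  open Faces Γ
  open Laminar Γ

  module Balance (L : List VS) (lam : Lams L) (single : Singles L) (κ : ℕ) (1≤κ : 1 ≤ κ) (W : Fin m → ℕ)
                 (tight : ∀ {S} → S ∈ L → Tight W S) (contr : ∀ {S} → S ∈ L → cnt S ≤ κ → Contr W S) where

    open Level L lam single κ 1≤κ
    open System L lam single κ 1≤κ W tight contr using (Wk; vec; tch; pick; pick-min; alt-cong-Wk; own-cross; touch-cross; nd-sym; nd-trans; tail; head)

    supported : ∀ {u v} ds → Wk u ds v → Supported W (λ g → alt (vec g) ds)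
    supported ds w g ne = decidable-stable (InFace? W g) λ ¬f → ne (trans (alt-cong-Wk ds w (λ {e} al → absent ¬f al)) (alt-zero ds))
      where
      alt-zero : ∀ ds → alt (λ _ → 0ℤ) ds ≡ 0ℤ
      alt-zero [] = refl
      alt-zero (d ∷ ds) = cong (λ z → 0ℤ - z) (alt-zero ds)
      absent : ∀ {e} → ¬ InFace W g → Alive W e → vec g e ≡ 0ℤ
      absent {e} ¬f al = cong (λ b → χℤ (b ∧ (tch (nd (s e)) g ∨ tch (nd (t e)) g))) (¬true λ p → ¬f (pick e , proj₁ (pick-min al) , p))

    cutOf : VS → Fin m → ℤ
    cutOf T e = ∑ℤ (λ g → vec g e ℤ.* χℤ (cross T g))

    contact : ∀ {e g} v → Alive W e → v ∈ₑ e → pick e g ≡ true → tch (nd v) g ≡ true → ins (nd v) g ≡ true ⊎ e ≡ g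
    contact {e} {g} v al ve p q with bool (ins (nd v) g)
    ... | inj₁ i = inj₁ i
    ... | inj₂ i = inj₂ (crossing-unique (nd v) (tight (nd-∈ v) (pick e) (proj₁ (pick-min al))) (proj₂ (pick-min al))
                     (own-cross (proj₁ (proj₂ al)) ve) p (touch-cross {nd v} q i))

    ins-node : ∀ {v g x y} → ins (nd v) g ≡ true → x ∈ₑ g → y ∈ₑ g → nd x y ≡ true
    ins-node {v} i xg yg = nd-trans (nd-sym (ins-elim {nd v} i xg)) (ins-elim {nd v} i yg)

    vec-zero : ∀ {e g} (T : VS) → (pick e g ≡ true → tch (nd (s e)) g ≡ true ⊎ tch (nd (t e)) g ≡ true → cross T g ≡ true → ⊥) →
               vec g e ℤ.* χℤ (cross T g) ≡ 0ℤ
    vec-zero {e} {g} T h with pick e g in p | tch (nd (s e)) g in q | tch (nd (t e)) g in r | cross T g in c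
    ... | false | _ | _ | _ = refl
    ... | true | false | false | _ = refl
    ... | true | true | _ | true = ⊥-elim (h refl (inj₁ refl) refl)
    ... | true | true | _ | false = refl
    ... | true | false | true | true = ⊥-elim (h refl (inj₂ refl) refl)
    ... | true | false | true | false = refl

    -- A large member is a union of nodes, so completions inside nodes do not cross it, and alive
    -- edges avoid its cut.
    cut-big : ∀ {T e} → T ∈ L → κ < cnt T → Alive W e → cutOf T e ≡ 0ℤ
    cut-big {T} {e} T∈ big al = ΣZ.∑-0 λ g → vec-zero {e} {g} T λ p q c → split g c (touching g p q)
      where
      touching : ∀ g → pick e g ≡ true → tch (nd (s e)) g ≡ true ⊎ tch (nd (t e)) g ≡ true → (∃ λ v → ins (nd v) g ≡ true) ⊎ e ≡ g
      touching g p (inj₁ q) with contact (s e) al (inj₁ refl) p q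
      ... | inj₁ i = inj₁ (s e , i)
      ... | inj₂ eq = inj₂ eq
      touching g p (inj₂ q) with contact (t e) al (inj₂ refl) p q
      ... | inj₁ i = inj₁ (t e , i)
      ... | inj₂ eq = inj₂ eq
      split : ∀ g → cross T g ≡ true → (∃ λ v → ins (nd v) g ≡ true) ⊎ e ≡ g → ⊥
      split g c (inj₂ refl) = true≢false c (proj₂ (proj₂ al) T∈ big)
      split g c (inj₁ (v , i)) = let x , y , xg , yg , Tx , Ty = cross-elim T g c in
        true≢false (trans (sym (big-union T∈ big (ins-node {v} i xg yg))) Tx) Ty

    tch-intro : ∀ {A : VS} {g y} → y ∈ₑ g → A y ≡ true → tch A g ≡ true
    tch-intro {A} (inj₁ refl) p = ∨-introˡ p
    tch-intro {A} {g} (inj₂ refl) p = ∨-introʳ {A (s g)} p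

    module Small {T x e} (T∈ : T ∈ L) (small : cnt T ≤ κ) (Tx : T x ≡ true) (al : Alive W e) where

      M : ES
      M = pick e

      T⊆ : ∀ u → T u ≡ true → nd x u ≡ true
      T⊆ = nd-max T∈ Tx small

      one : ∀ v → v ∈ₑ e → nd x v ≡ true → cutOf T e ≡ ℤ.+ 1
      one v ve p = trans (ΣZ.∑-cong pt) (trans (∑ℤ-ℕ (λ g → χℕ (M g) * χℕ (cross T g))) (cong ℤ.+_ (tight T∈ M (proj₁ (pick-min al)))))
        where
        touch : ∀ g → cross T g ≡ true → (tch (nd (s e)) g ∨ tch (nd (t e)) g) ≡ true
        touch g c = let y , _ , yg , _ , Ty , _ = cross-elim T g c in either ve (tch-intro {nd v} yg (nd-trans (nd-sym p) (T⊆ y Ty)))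
          where
          either : v ∈ₑ e → tch (nd v) g ≡ true → (tch (nd (s e)) g ∨ tch (nd (t e)) g) ≡ true
          either (inj₁ refl) q = ∨-introˡ q
          either (inj₂ refl) q = ∨-introʳ {tch (nd (s e)) g} q
        tab : ∀ a b c → (c ≡ true → b ≡ true) → χℤ (a ∧ b) ℤ.* χℤ c ≡ ℤ.+ (χℕ a * χℕ c)
        tab false b c h = refl
        tab true true true h = refl
        tab true false true h = ⊥-elim (true≢false (h refl) refl)
        tab true true false h = refl
        tab true false false h = refl
        pt : ∀ g → vec g e ℤ.* χℤ (cross T g) ≡ ℤ.+ (χℕ (M g) * χℕ (cross T g))
        pt g = tab (M g) (tch (nd (s e)) g ∨ tch (nd (t e)) g) (cross T g) (touch g)

      none : nd x (s e) ≡ false → nd x (t e) ≡ false → cutOf T e ≡ 0ℤ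
      none p q = ΣZ.∑-0 λ g → vec-zero {e} {g} T λ Mg tc c →
          let y , _ , yg , _ , Ty , _ = cross-elim T g c in absurd g yg (T⊆ y Ty) (which g Mg tc)
        where
        which : ∀ g → M g ≡ true → tch (nd (s e)) g ≡ true ⊎ tch (nd (t e)) g ≡ true → (∃ λ v → v ∈ₑ e × ins (nd v) g ≡ true) ⊎ e ≡ g
        which g Mg (inj₁ r) with contact (s e) al (inj₁ refl) Mg r
        ... | inj₁ i = inj₁ (s e , inj₁ refl , i)
        ... | inj₂ eq = inj₂ eq
        which g Mg (inj₂ r) with contact (t e) al (inj₂ refl) Mg r
        ... | inj₁ i = inj₁ (t e , inj₂ refl , i)
        ... | inj₂ eq = inj₂ eq
        outside : ∀ {v} → v ∈ₑ e → nd x v ≡ true → ⊥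
        outside (inj₁ refl) r = true≢false r p
        outside (inj₂ refl) r = true≢false r q
        absurd : ∀ g {y} → y ∈ₑ g → nd x y ≡ true → (∃ λ v → v ∈ₑ e × ins (nd v) g ≡ true) ⊎ e ≡ g → ⊥
        absurd g yg xy (inj₁ (v , ve , i)) = outside ve (nd-trans xy (nd-sym (ins-elim {nd v} i yg)))
        absurd g yg xy (inj₂ refl) = outside yg xy

    -- A small member lies within one node. If `e` ends there, its column contains every edge of
    -- `pick e` crossing `T`, and by tightness there is one; otherwise it contains none.
    cut-small : ∀ {T x e} → T ∈ L → cnt T ≤ κ → T x ≡ true → Alive W e → cutOf T e ≡ χℤ (nd x (s e)) ℤ.+ χℤ (nd x (t e))
    cut-small {T} {x} {e} T∈ small Tx al = cases (bool (nd x (s e))) (bool (nd x (t e)))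
      where
      open Small T∈ small Tx al
      cases : nd x (s e) ≡ true ⊎ nd x (s e) ≡ false → nd x (t e) ≡ true ⊎ nd x (t e) ≡ false → cutOf T e ≡ χℤ (nd x (s e)) ℤ.+ χℤ (nd x (t e))
      cases (inj₁ p) (inj₁ q) = ⊥-elim (true≢false (nd-trans (nd-sym p) q) (proj₁ (proj₂ al)))
      cases (inj₁ p) (inj₂ q) = trans (one (s e) (inj₁ refl) p) (sym (cong₂ (λ a b → χℤ a ℤ.+ χℤ b) p q))
      cases (inj₂ p) (inj₁ q) = trans (one (t e) (inj₂ refl) q) (sym (cong₂ (λ a b → χℤ a ℤ.+ χℤ b) p q))
      cases (inj₂ p) (inj₂ q) = trans (none p q) (sym (cong₂ (λ a b → χℤ a ℤ.+ χℤ b) p q))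

    telescope : ∀ (τ : Fin n → ℤ) → (∀ {u v} → nd u v ≡ true → τ u ≡ τ v) → ∀ {u v} ds → Wk u ds v →
                alt (λ e → τ (s e) ℤ.+ τ (t e)) ds ≡ τ u - sgn (ev ds) (τ v)
    telescope τ inv {u} {v} [] w = trans (sym (ℤ.+-inverseʳ (τ u))) (cong (λ z → τ u - z) (inv w))
    telescope τ inv {u} {v} (d ∷ ds) (a , b , w) = trans (cong₂ _-_ (trans (both-ends d) (cong (λ z → z ℤ.+ τ (head d)) (sym (inv a)))) (telescope τ inv ds w))
      (flip-sign (τ u) (τ (head d)) (ev ds) (τ v))
      where
      both-ends : ∀ d → τ (s (proj₁ d)) ℤ.+ τ (t (proj₁ d)) ≡ τ (tail d) ℤ.+ τ (head d)
      both-ends (e , true) = refl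
      both-ends (e , false) = ℤ.+-comm (τ (s e)) (τ (t e))
      flip-sign : ∀ a h b x → (a ℤ.+ h) - (h - sgn b x) ≡ a - sgn (not b) x
      flip-sign a h true x = lemma a h x
        where
        lemma : ∀ a h x → (a ℤ.+ h) - (h - x) ≡ a - ℤ.- x
        lemma = solve-ℤ
      flip-sign a h false x = lemma a h x
        where
        lemma : ∀ a h x → (a ℤ.+ h) - (h - ℤ.- x) ≡ a - x
        lemma = solve-ℤ

    -- The cut of a column at a small member counts the ends of the edge in one node. Each passage
    -- through a node contributes with both signs, and for a closed even walk the two ends cancel as
    -- well.
    balanced : ∃ (Min W) → ∀ {u} ds → Wk u ds u → ev ds ≡ true → ∀ {T} → T ∈ L → HZ.cut (λ g → alt (vec g) ds) T ≡ 0ℤ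
    balanced (M₀ , m₀) {u} ds w e {T} T∈ = trans (∑-alt vec (χℤ ∘ cross T) ds) (cases (cnt T ℕ.≤? κ))
      where
      alt-zero : ∀ ds → alt (λ _ → 0ℤ) ds ≡ 0ℤ
      alt-zero [] = refl
      alt-zero (d ∷ ds) = cong (λ z → 0ℤ - z) (alt-zero ds)
      point : ∃ λ x → T x ≡ true
      point = let h , _ , c = crossing-edge {M₀} {T} (tight T∈ M₀ m₀)
                  x , _ , _ , _ , p , _ = cross-elim T h c in x , p
      cases : Dec (cnt T ≤ κ) → alt (cutOf T) ds ≡ 0ℤ
      cases (no big) = trans (alt-cong-Wk ds w (λ al → cut-big T∈ (ℕ.≰⇒> big) al)) (alt-zero ds)
      cases (yes small) = let x , Tx = point in
        trans (alt-cong-Wk ds w (λ al → cut-small T∈ small Tx al))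
          (trans (telescope (λ v → χℤ (nd x v)) (λ p → cong χℤ (iff→≡ (λ q → nd-trans q p) (λ q → nd-trans q (nd-sym p)))) ds w)
            (trans (cong (λ b → χℤ (nd x u) - sgn b (χℤ (nd x u))) e) (ℤ.+-inverseʳ (χℤ (nd x u)))))

-- Doubling the level

module StepC {n m : ℕ} (Γ : Multigraph n m) where

  open Multigraph Γ

  open Matchings Γ
  open Faces Γ
  open Laminar Γ
  open Chains Γ using (SegmentsOf; module Chain)
  open Refinement Γ using (module Balance)

  module Refine {l : ℕ} {W₀ : Fin m → ℕ} (inv : Inv W₀ l) (W : Fin m → ℕ) (sub₀ : ∀ {M} → Min W M → Min W₀ M)
                (contr₂ : ∀ {S} → S ∈ Inv.L inv → cnt S ≤ l + l → Contr W S) where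

    open Inv inv using (L; 1≤l; single) renaming (ML to ML₀; contr to contr₀; good to good₀)
    lam : Lams L
    lam = MaxLaminar.lam ML₀
    1≤2l : 1 ≤ l + l
    1≤2l = ℕ.≤-trans 1≤l (ℕ.m≤m+n l l)

    module Lo = Level L lam single l 1≤l using (nd; nd-∈; nd-refl; nd-size; nd-max)
    module Hi = Level L lam single (l + l) 1≤2l

    tight : ∀ {S} → S ∈ L → Tight W S
    tight S∈ M mM = MaxLaminar.tight ML₀ S∈ M (sub₀ mM)

    module S₀ = System L lam single l 1≤l W₀ (MaxLaminar.tight ML₀) contr₀ using (Wk; wtw)
    module H = System L lam single (l + l) 1≤2l W tight contr₂ using (Good; Wk; Wk-++; wtw; wtw-++; sz; sz-eq; head; tail; half; vec; vec-dir; raw-vanishes; Separated; UnionOfNodes; module Region; module Path; module Kill)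

    lo⊆hi : ∀ {x y} → Lo.nd x y ≡ true → Hi.nd x y ≡ true
    lo⊆hi {x} {y} p = Hi.nd-max (Lo.nd-∈ x) (Lo.nd-refl x) (ℕ.≤-trans (Lo.nd-size x) (ℕ.m≤m+n l l)) y p

    small-node : ∀ {x y} → H.sz x ≤ l → Hi.nd x y ≡ true → Lo.nd x y ≡ true
    small-node {x} {y} le p = Lo.nd-max (Hi.nd-∈ x) (Hi.nd-refl x) le y p

    -- A walk this light meets only nodes with at most `l` vertices, which are nodes at level `l`
    -- too. A crossed member with more than `l` and at most `l + l` vertices would have to fit into
    -- one of them.
    lower-walk : ∀ {u v} ds → H.sz u ≤ l → H.Wk u ds v → H.wtw ds ≤ l → S₀.Wk u ds v × S₀.wtw ds ≤ H.wtw ds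
    lower-walk [] su w le = small-node su w , z≤n
    lower-walk {u} (d ∷ ds) su (a , ((M , mM , Me) , sep , nc) , w) le =
      let su′ = ℕ.≤-trans (ℕ.m≤m+n _ _) le
          w′ , le′ = lower-walk ds su′ w (ℕ.≤-trans (ℕ.m≤n+m _ _) le)
      in (small-node su a , ((M , sub₀ mM , Me) , (¬true λ p → true≢false (lo⊆hi p) sep) , λ {Y} Y∈ big → ¬true λ c → absurd Y Y∈ big c) , w′)
         , ℕ.+-mono-≤ (cnt-mono (λ i → lo⊆hi)) le′
      where
      end-small : ∀ {x} → x ∈ₑ proj₁ d → H.sz x ≤ l
      end-small {x} xe = pick-end d xe (ℕ.≤-trans (ℕ.≤-reflexive (sym (H.sz-eq a))) su) (ℕ.≤-trans (ℕ.m≤m+n _ _) le)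
        where
        pick-end : ∀ d → x ∈ₑ proj₁ d → H.sz (H.tail d) ≤ l → H.sz (H.head d) ≤ l → H.sz x ≤ l
        pick-end (e , true) (inj₁ refl) p q = p
        pick-end (e , true) (inj₂ refl) p q = q
        pick-end (e , false) (inj₁ refl) p q = q
        pick-end (e , false) (inj₂ refl) p q = p
      absurd : ∀ Y → Y ∈ L → l < cnt Y → cross Y (proj₁ d) ≡ true → ⊥
      absurd Y Y∈ big c with cnt Y ℕ.≤? l + l
      ... | no ¬le = true≢false c (nc Y∈ (ℕ.≰⇒> ¬le))
      ... | yes le′ = let x , _ , xe , _ , Yx , _ = cross-elim Y (proj₁ d) c in
        ℕ.<⇒≱ big (ℕ.≤-trans (cnt-mono (Hi.nd-max Y∈ Yx le′)) (end-small xe))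

    end-weight : ∀ {u v} d ds → H.Wk u (d ∷ ds) v → H.sz v ≤ H.wtw (d ∷ ds)
    end-weight d [] (_ , _ , w) = ℕ.≤-trans (ℕ.≤-reflexive (sym (H.sz-eq w))) (ℕ.m≤m+n _ _)
    end-weight d (d′ ∷ ds) (_ , _ , w) = ℕ.≤-trans (end-weight d′ ds w) (ℕ.m≤n+m _ (H.sz (H.head d)))

    -- Counting the walks of weight `l + l` requires cancellation up to `l` for the same, larger
    -- nodes.
    good-hi : H.Good l
    good-hi u [] w e le g = refl
    good-hi u (d ∷ ds) w e le g =
      let w′ , le′ = lower-walk (d ∷ ds) (ℕ.≤-trans (end-weight d ds w) le) w le
      in good₀ u (d ∷ ds) w′ e (ℕ.≤-trans le′ le) g

    open H.Kill good-hi using (vectors; vectors-length; vectors-bound; find-vector) public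

    module Result {W′ : Fin m → ℕ} (K : Kills W W′ vectors) (pm : ∃ PM) where

      open Kills K

      extended : ∃ λ L′ → MaxLaminar W′ L′ × (∀ {S} → S ∈ L → S ∈ L′)
      extended = extend W′ L (λ S∈ M mM → tight S∈ M (sub mM)) lam

      L′ : List VS
      L′ = proj₁ extended
      ML : MaxLaminar W′ L′
      ML = proj₁ (proj₂ extended)
      L⊆L′ : ∀ {S} → S ∈ L → S ∈ L′
      L⊆L′ = proj₂ (proj₂ extended)
      lam′ : Lams L′
      lam′ = MaxLaminar.lam ML
      tight′ : ∀ {S} → S ∈ L′ → Tight W′ S
      tight′ = MaxLaminar.tight ML

      vanish : ∀ u ds → H.Wk u ds u → ev ds ≡ true → H.wtw ds ≤ l + l → ∀ {M N} → Min W′ M → Min W′ N →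
               (∀ g → alt (H.vec g) ds ≡ χℤ (N g) - χℤ (M g)) → ∀ g → alt (raw g) ds ≡ 0ℤ
      vanish u ds w _ le mM mN eq = H.raw-vanishes ds w λ g →
        let c , c∈ , ceq = find-vector ds w le in trans (sym (ceq g)) (diff c∈ mM mN (λ h → trans (ceq h) (eq h)) g)

      -- By laminarity a new tight set lies within an old node, where contractibility is inherited,
      -- or is a union of old nodes, where `region` applies.
      contr′ : ∀ {S} → S ∈ L′ → cnt S ≤ l + l → Contr W′ S
      contr′ {S} S∈ le {M} {N} mM mN {e} Me Ne c g ig
        with any? (λ x → (S x Bool.≟ true) ×-dec all? (λ v → (S v Bool.≟ true) →? (Hi.nd x v Bool.≟ true)))
      ... | yes (x , Sx , S⊆) = contr-subset {W′} {S} {Hi.nd x} (tight′ S∈) (tight′ (L⊆L′ (Hi.nd-∈ x))) S⊆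
              (λ mA mB → contr₂ (Hi.nd-∈ x) (Hi.nd-size x) (sub mA) (sub mB)) mM mN Me Ne c g ig
      ... | no ¬in = H.Region.region W′ sub (l + l) vanish S S-nodes S-alive le mM mN (agree-tight {S = S} (tight′ S∈) mM mN Me Ne c) g ig
        where
        S-nodes : H.UnionOfNodes S
        S-nodes {x} {y} p = cases (lam′ (L⊆L′ (Hi.nd-∈ x)) S∈)
          where
          cases : Lam (Hi.nd x) S → S x ≡ S y
          cases (inj₁ nd⊆) = trans (nd⊆ x (Hi.nd-refl x)) (sym (nd⊆ y p))
          cases (inj₂ (inj₂ disj)) = trans (¬true (disj x (Hi.nd-refl x))) (sym (¬true (disj y p)))
          cases (inj₂ (inj₁ S⊆)) = trans (¬true λ Sx → ¬in (x , Sx , S⊆)) (sym (¬true λ Sy → ¬in (y , Sy , λ v Sv → trans (sym (Hi.nd-eq p v)) (S⊆ v Sv))))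
        S-alive : ∀ {N e} → Min W N → N e ≡ true → ins S e ≡ true → H.Separated e → Hi.Alive W e
        S-alive {N} {e} mN Ne iS sep = (N , mN , Ne) , sep , λ {Y} Y∈ big → ¬true λ c → absurd Y Y∈ big c
          where
          absurd : ∀ Y → Y ∈ L → l + l < cnt Y → cross Y e ≡ true → ⊥
          absurd Y Y∈ big c with cross-elim Y e c | lam′ (L⊆L′ Y∈) S∈
          ... | x , y , xe , ye , Yx , Yy | inj₁ Y⊆S = ℕ.<⇒≱ big (ℕ.≤-trans (cnt-mono Y⊆S) le)
          ... | x , y , xe , ye , Yx , Yy | inj₂ (inj₁ S⊆Y) = true≢false (S⊆Y y (ins-elim {S} iS ye)) Yy
          ... | x , y , xe , ye , Yx , Yy | inj₂ (inj₂ disj) = disj x Yx (ins-elim {S} iS xe)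

      module Hi′ = Level L′ lam′ (singles ML) (l + l) 1≤2l
      module H′ = System L′ lam′ (singles ML) (l + l) 1≤2l W′ tight′ contr′ using (Wk; wtw; Good; head; tail; nd-sym; nd-trans; own-cross; pick; pick-min; half; half-cong; vec; vec-dir; raw-vanishes)

      hi⊆hi′ : ∀ {x y} → Hi.nd x y ≡ true → Hi′.nd x y ≡ true
      hi⊆hi′ {x} {y} p = Hi′.nd-max (L⊆L′ (Hi.nd-∈ x)) (Hi.nd-refl x) (Hi.nd-size x) y p

      alive↓ : ∀ {e} → Hi′.Alive W′ e → Hi.Alive W e
      alive↓ ((M , mM , Me) , sep , nc) = (M , sub mM , Me) , (¬true λ p → true≢false (hi⊆hi′ p) sep) , λ Y∈ big → nc (L⊆L′ Y∈) big

      module NodePath (d d′ : DE {m}) (al : Hi′.Alive W′ (proj₁ d)) (al′ : Hi′.Alive W′ (proj₁ d′))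
                      (next : Hi′.nd (H′.head d) (H′.tail d′) ≡ true) where
        R : VS
        R = Hi′.nd (H′.head d)
        R-nodes : H.UnionOfNodes R
        R-nodes {x} {y} p = iff→≡ (λ q → H′.nd-trans q (hi⊆hi′ p)) (λ q → H′.nd-trans q (H′.nd-sym (hi⊆hi′ p)))
        R-alive : ∀ {N e} → Min W N → N e ≡ true → ins R e ≡ true → H.Separated e → Hi.Alive W e
        R-alive {N} {e} mN Ne iR sep = (N , mN , Ne) , sep , λ {Y} Y∈ big → ¬true λ c →
          let x , y , xe , ye , Yx , Yy = cross-elim Y e c in
          true≢false (trans (sym (Hi′.big-union (L⊆L′ Y∈) big (H′.nd-trans (H′.nd-sym (ins-elim {R} iR xe)) (ins-elim {R} iR ye)))) Yx) Yy
        head-∈ : ∀ d → H′.head d ∈ₑ proj₁ d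
        head-∈ (e , true) = inj₂ refl
        head-∈ (e , false) = inj₁ refl
        tail-∈ : ∀ d → H′.tail d ∈ₑ proj₁ d
        tail-∈ (e , true) = inj₁ refl
        tail-∈ (e , false) = inj₂ refl
        cf : cross R (proj₁ d′) ≡ true
        cf = trans (cong₂ _xor_ (Hi′.nd-eq next (s (proj₁ d′))) (Hi′.nd-eq next (t (proj₁ d′)))) (H′.own-cross (proj₁ (proj₂ al′)) (tail-∈ d′))
        open H.Path W′ sub R R-nodes R-alive (tight′ (Hi′.nd-∈ (H′.head d))) (λ {A} {B} → contr′ (Hi′.nd-∈ (H′.head d)) (Hi′.nd-size (H′.head d)) {A} {B})
          {H′.pick (proj₁ d)} {H′.pick (proj₁ d′)} (proj₁ (H′.pick-min al)) (proj₁ (H′.pick-min al′)) {proj₁ d} {proj₁ d′}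
          (proj₂ (H′.pick-min al)) (H′.own-cross (proj₁ (proj₂ al)) (head-∈ d)) (proj₂ (H′.pick-min al′)) cf
          {H′.head d} {H′.tail d′} (head-∈ d) (Hi′.nd-refl (H′.head d)) (tail-∈ d′) next public

      first : List (DE {m}) → DE {m} → DE {m}
      first [] nx = nx
      first (d ∷ _) nx = d

      Linked : List (DE {m}) → DE → Set
      Linked [] nx = Hi′.Alive W′ (proj₁ nx)
      Linked (d ∷ D) nx = Hi′.Alive W′ (proj₁ d) × Hi′.nd (H′.head d) (H′.tail (first D nx)) ≡ true × Linked D nx

      linked : ∀ {u v} D nx → H′.Wk u D v → Hi′.nd v (H′.tail nx) ≡ true → Hi′.Alive W′ (proj₁ nx) → Linked D nx
      linked [] nx w p al = al
      linked (d ∷ []) nx (_ , a , w) p al = a , H′.nd-trans w p , al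
      linked (d ∷ d′ ∷ D) nx (_ , a , w) p al = a , proj₁ w , linked (d′ ∷ D) nx w p al

      first-alive : ∀ D nx → Linked D nx → Hi′.Alive W′ (proj₁ (first D nx))
      first-alive [] nx al = al
      first-alive (d ∷ D) nx (al , _) = al

      -- The error from completing the tail of an edge in the old node instead of the new one. In
      -- `lift` these errors telescope; `nx` is the edge after `D`, and for a closed even walk it is
      -- the first edge again, so nothing remains.
      δ : DE → Fin m → ℤ
      δ d g = H.half (H′.pick (proj₁ d)) (H′.tail d) g - H′.half (H′.pick (proj₁ d)) (H′.tail d) g

      Lifted : List (DE {m}) → DE → Set
      Lifted D nx = ∃ λ ds → H.Wk (H′.tail (first D nx)) ds (H′.tail nx) × ev ds ≡ ev D × H.wtw ds ≤ H′.wtw D ×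
        (∀ g → alt (H.vec g) ds ≡ alt (H′.vec g) D ℤ.+ δ (first D nx) g - sgn (ev D) (δ nx g))

      lift : ∀ D nx → Linked D nx → Lifted D nx
      lift [] nx al = [] , Hi.nd-refl _ , refl , z≤n , λ g → zero-lemma (δ nx g)
        where
        zero-lemma : ∀ x → 0ℤ ≡ 0ℤ ℤ.+ x - x
        zero-lemma = solve-ℤ
      lift (d ∷ D) nx (al , next , lk) = combine (lift D nx lk) path
        where
        d′ : DE
        d′ = first D nx
        al′ : Hi′.Alive W′ (proj₁ d′)
        al′ = first-alive D nx lk
        open NodePath d d′ al al′ next
        M = H′.pick (proj₁ d)
        M′ = H′.pick (proj₁ d′)
        same-ends : ∀ d → H.tail d ≡ H′.tail d × H.head d ≡ H′.head d
        same-ends (e , true) = refl , refl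
        same-ends (e , false) = refl , refl
        combine : Lifted D nx → (∃ λ p → H.Wk (H′.head d) p (H′.tail d′) × ev p ≡ true × H.wtw p + H.sz (H′.head d) ≤ cnt R ×
           (∀ g → alt (H.vec g) p ≡ H.half M (H′.head d) g - H.half M′ (H′.tail d′) g ℤ.+ (χℤ (M′ g ∧ ins R g) - χℤ (M g ∧ ins R g)))) → Lifted (d ∷ D) nx
        combine (ds , w , e , le , f) (p , wp , ep , lp , fp) = d ∷ p ++ ds
          , (subst (λ x → Hi.nd (H′.tail d) x ≡ true) (sym (proj₁ (same-ends d))) (Hi.nd-refl _) , alive↓ al
            , subst (λ x → H.Wk x (p ++ ds) (H′.tail nx)) (sym (proj₂ (same-ends d))) (H.Wk-++ p ds wp w))
          , cong not (trans (ev-++ p ds) (trans (cong₂ (λ a b → not (a xor b)) ep e) (notnot (ev D))))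
          , ℕ.≤-trans (ℕ.≤-reflexive (trans (cong₂ _+_ (cong H.sz (proj₂ (same-ends d))) (H.wtw-++ p ds)) (trans (sym (ℕ.+-assoc (H.sz (H′.head d)) (H.wtw p) (H.wtw ds))) (cong (_+ H.wtw ds) (ℕ.+-comm (H.sz (H′.head d)) (H.wtw p))))))
                      (ℕ.+-mono-≤ lp le)
          , value
          where
          notnot : ∀ b → not (true xor b) ≡ b
          notnot true = refl
          notnot false = refl
          value : ∀ g → alt (H.vec g) (d ∷ p ++ ds) ≡ (H′.vec g (proj₁ d) - alt (H′.vec g) D) ℤ.+ δ d g - sgn (not (ev D)) (δ nx g)
          value g = begin
            H.vec g (proj₁ d) - alt (H.vec g) (p ++ ds)
              ≡⟨ cong (λ z → H.vec g (proj₁ d) - z) (trans (alt-++ (H.vec g) p ds) (cong (λ b → alt (H.vec g) p ℤ.+ sgn b (alt (H.vec g) ds)) ep)) ⟩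
            H.vec g (proj₁ d) - (alt (H.vec g) p ℤ.+ alt (H.vec g) ds)
              ≡⟨ cong₂ (λ x y → x - (alt (H.vec g) p ℤ.+ y)) (trans (H.vec-dir d (alive↓ al) (sub (proj₁ (H′.pick-min al))) (proj₂ (H′.pick-min al)) g)
                   (cong₂ (λ x y → H.half M x g ℤ.+ raw g (proj₁ d) ℤ.+ H.half M y g) (proj₁ (same-ends d)) (proj₂ (same-ends d)))) (f g) ⟩
            (tH ℤ.+ r ℤ.+ hH) - (alt (H.vec g) p ℤ.+ (A ℤ.+ (tH′ - t′) - σ))
              ≡⟨ cong (λ x → (tH ℤ.+ r ℤ.+ hH) - (x ℤ.+ (A ℤ.+ (tH′ - t′) - σ))) (trans (fp g) (cong (λ x → hH - tH′ ℤ.+ (x - h₁)) (sym-half g))) ⟩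
            (tH ℤ.+ r ℤ.+ hH) - ((hH - tH′ ℤ.+ (t′ - h₁)) ℤ.+ (A ℤ.+ (tH′ - t′) - σ))
              ≡⟨ algebra tH r hH tH′ t′ h₁ A σ t₁ ⟩
            ((t₁ ℤ.+ r ℤ.+ h₁) - A) ℤ.+ (tH - t₁) ℤ.+ σ
              ≡⟨ cong₂ (λ x y → (x - A) ℤ.+ (tH - t₁) ℤ.+ y) (sym (H′.vec-dir d al (proj₁ (H′.pick-min al)) (proj₂ (H′.pick-min al)) g)) (sgn-not (ev D) (δ nx g)) ⟩
            (H′.vec g (proj₁ d) - A) ℤ.+ δ d g - sgn (not (ev D)) (δ nx g) ∎
            where
            open ≡-Reasoning
            tH = H.half M (H′.tail d) g
            hH = H.half M (H′.head d) g
            t₁ = H′.half M (H′.tail d) g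
            h₁ = H′.half M (H′.head d) g
            tH′ = H.half M′ (H′.tail d′) g
            t′ = H′.half M′ (H′.tail d′) g
            r = raw g (proj₁ d)
            A = alt (H′.vec g) D
            σ = sgn (ev D) (δ nx g)
            sym-half : ∀ g → χℤ (M′ g ∧ ins R g) ≡ H′.half M′ (H′.tail d′) g
            sym-half g = H′.half-cong M′ next g
            sgn-not : ∀ b x → sgn b x ≡ ℤ.- sgn (not b) x
            sgn-not true x = sym (ℤ.neg-involutive x)
            sgn-not false x = refl
            algebra : ∀ tH r hH tH′ t′ h₁ A σ t₁ → (tH ℤ.+ r ℤ.+ hH) - ((hH - tH′ ℤ.+ (t′ - h₁)) ℤ.+ (A ℤ.+ (tH′ - t′) - σ)) ≡ ((t₁ ℤ.+ r ℤ.+ h₁) - A) ℤ.+ (tH - t₁) ℤ.+ σ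
            algebra = solve-ℤ

      -- The lifted walk is no heavier, so its vector is in the list, and it equals the vector of
      -- the new walk. The latter is supported and balanced in the new face, so `ortho` applies.
      good′ : H′.Good (l + l)
      good′ u [] w e le g = refl
      good′ u (d ∷ D) w@(a , al , _) e le = H′.raw-vanishes (d ∷ D) w zero-vec
        where
        lifted : Lifted (d ∷ D) d
        lifted = lift (d ∷ D) d (linked (d ∷ D) d w a al)
        ds = proj₁ lifted
        wd : H.Wk (H′.tail d) ds (H′.tail d)
        wd = proj₁ (proj₂ lifted)
        found = find-vector ds wd (ℕ.≤-trans (proj₁ (proj₂ (proj₂ (proj₂ lifted)))) le)
        c : Fin m → ℤ
        c = proj₁ found
        value : ∀ g → c g ≡ alt (H′.vec g) (d ∷ D)
        value g = trans (proj₂ (proj₂ found) g) (trans (proj₂ (proj₂ (proj₂ (proj₂ lifted))) g)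
          (trans (cong (λ b → alt (H′.vec g) (d ∷ D) ℤ.+ δ d g - sgn b (δ d g)) e) (cancel (alt (H′.vec g) (d ∷ D)) (δ d g))))
          where
          cancel : ∀ x y → x ℤ.+ y - y ≡ x
          cancel = solve-ℤ
        open Balance L′ lam′ (singles ML) (l + l) 1≤2l W′ tight′ contr′ using (supported; balanced)
        supp : Supported W′ c
        supp g ne = supported (d ∷ D) w g (λ z → ne (trans (value g) z))
        bal : ∀ S → Tight W′ S → HZ.cut c S ≡ 0ℤ
        bal = balanced-on-tight ML (Min-exists W′ pm) c supp
          (λ {T} T∈ → trans (ΣZ.∑-cong (λ g → cong (ℤ._* χℤ (cross T g)) (value g))) (balanced (Min-exists W′ pm) (d ∷ D) w e T∈))
        zero-vec : ∀ g → alt (H′.vec g) (d ∷ D) ≡ 0ℤ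
        zero-vec g = trans (sym (value g)) (ortho (proj₁ (proj₂ found)) supp bal g)

      inv′ : Inv W′ (l + l)
      inv′ = record { L = L′ ; ML = ML ; 1≤l = 1≤2l ; single = singles ML ; contr = contr′ ; good = good′ }

  opaque
    unfolding SegmentsOf
    refine-step : ∀ {W₀ l} (inv : Inv W₀ l) W → (∀ {M} → Min W M → Min W₀ M) → SegmentsOf inv W l →
      ∃ λ Z → length Z ≡ (1 + (m * 2 + (m * 2) * ((m * 2) * 2))) ℕ.^ 4
      × (∀ {c} → c ∈ Z → ∀ e → ∣ c e ∣ ≤ 4 * (2 + l)) × (∀ {W′} → Kills W W′ Z → ∃ PM → Inv W′ (l + l))
    refine-step {W₀} {l} inv W sub seg = Refine.vectors inv W sub contr₂ , Refine.vectors-length inv W sub contr₂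
      , Refine.vectors-bound inv W sub contr₂ , Refine.Result.inv′ inv W sub contr₂
      where
      open Inv inv
      contr₂ : ∀ {S} → S ∈ L → cnt S ≤ l + l → Contr W S
      contr₂ = Chain.contract L (MaxLaminar.lam ML) single l 1≤l (λ S∈ M mM → MaxLaminar.tight ML S∈ M (sub mM))
        (λ S∈ le mM mN → contr S∈ le (sub mM) (sub mN)) seg

-- Numerical estimates

2^<⌈log₂⌉ : ∀ {i n} → i < ⌈log₂ n ⌉ → 2 ^ i < n
2^<⌈log₂⌉ {i} {n} lt = ℕ.≰⇒> λ le → ℕ.<⇒≱ lt (ℕ.≤-trans (⌈log₂⌉-mono-≤ le) (ℕ.≤-reflexive (⌈log₂2^n⌉≡n i)))

≤2^⌈log₂⌉ : ∀ n → n ≤ 2 ^ ⌈log₂ n ⌉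
≤2^⌈log₂⌉ = <-rec (λ n → n ≤ 2 ^ ⌈log₂ n ⌉) go
  where
  go : ∀ n → (∀ {k} → k < n → k ≤ 2 ^ ⌈log₂ k ⌉) → n ≤ 2 ^ ⌈log₂ n ⌉
  go zero ih = z≤n
  go (suc zero) ih = ℕ.m^n>0 2 ⌈log₂ 1 ⌉
  go n@(suc (suc k)) ih = begin
    n                                        ≡⟨ ℕ.⌊n/2⌋+⌈n/2⌉≡n n ⟨
    ⌊ n /2⌋ + ⌈ n /2⌉                        ≤⟨ ℕ.+-monoˡ-≤ ⌈ n /2⌉ (ℕ.⌊n/2⌋≤⌈n/2⌉ n) ⟩
    ⌈ n /2⌉ + ⌈ n /2⌉                        ≤⟨ ℕ.+-mono-≤ half half ⟩
    2 ^ (⌈log₂ n ⌉ ∸ 1) + 2 ^ (⌈log₂ n ⌉ ∸ 1) ≡⟨ cong (2 ^ (⌈log₂ n ⌉ ∸ 1) +_) (ℕ.+-identityʳ _) ⟨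
    2 ^ suc (⌈log₂ n ⌉ ∸ 1)                  ≡⟨ cong (2 ^_) (ℕ.m+[n∸m]≡n 1≤) ⟩
    2 ^ ⌈log₂ n ⌉                            ∎
    where
    open ℕ.≤-Reasoning
    half : ⌈ n /2⌉ ≤ 2 ^ (⌈log₂ n ⌉ ∸ 1)
    half = subst (λ z → ⌈ n /2⌉ ≤ 2 ^ z) (⌈log₂⌈n/2⌉⌉≡⌈log₂n⌉∸1 n) (ih (ℕ.⌈n/2⌉<n k))
    1≤ : 1 ≤ ⌈log₂ n ⌉
    1≤ = ℕ.≤-trans (ℕ.≤-reflexive (sym (⌈log₂2^n⌉≡n 1))) (⌈log₂⌉-mono-≤ {2} {n} (s≤s (s≤s z≤n)))

quadratic≤2^ : ∀ n → 9 ≤ n → 4 * n ^ 2 + 1 ≤ 2 ^ n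
quadratic≤2^ n le with ℕ.m≤n⇒∃[o]m+o≡n le
... | k , refl = go k
  where
  go : ∀ k → 4 * (9 + k) ^ 2 + 1 ≤ 2 ^ (9 + k)
  go zero = ℕ.≤ᵇ⇒≤ 325 512 tt
  go (suc k) = begin
    4 * (9 + suc k) ^ 2 + 1 ≡⟨ cong (λ x → 4 * x ^ 2 + 1) (ℕ.+-suc 9 k) ⟩
    4 * (suc (9 + k)) ^ 2 + 1 ≤⟨ ℕ.m≤m+n _ (4 * (k * k) + 64 * k + 249) ⟩
    4 * (suc (9 + k)) ^ 2 + 1 + (4 * (k * k) + 64 * k + 249) ≡⟨ identity k ⟩
    2 * (4 * (9 + k) ^ 2 + 1) ≤⟨ ℕ.*-monoʳ-≤ 2 (go k) ⟩
    2 ^ suc (9 + k) ≡⟨ cong (2 ^_) (ℕ.+-suc 9 k) ⟨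
    2 ^ (9 + suc k) ∎
    where
    open ℕ.≤-Reasoning
    identity : ∀ k → 4 * (suc (9 + k) * (suc (9 + k) * 1)) + 1 + (4 * (k * k) + 64 * k + 249) ≡ 2 * (4 * ((9 + k) * ((9 + k) * 1)) + 1)
    identity = solve-ℕ

module Large (n : ℕ) (large : 131072 ≤ n) where

  open ℕ.≤-Reasoning

  1≤n : 1 ≤ n
  1≤n = ℕ.≤-trans (s≤s z≤n) large

  instance
    n≢0 : NonZero n
    n≢0 = ℕ.>-nonZero 1≤n

  1≤n² : 1 ≤ n * n
  1≤n² = ℕ.*-mono-≤ 1≤n 1≤n

  2+n≤n² : 2 + n ≤ n * n
  2+n≤n² = begin
    2 + n ≤⟨ ℕ.+-monoˡ-≤ n (ℕ.≤-trans (s≤s (s≤s z≤n)) large) ⟩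
    n + n ≡⟨ cong (n +_) (ℕ.+-identityʳ n) ⟨
    2 * n ≤⟨ ℕ.*-monoˡ-≤ n (ℕ.≤-trans (s≤s (s≤s z≤n)) large) ⟩
    n * n ∎

  base-power : ∀ {m} → m ≤ n * n → (4 * n ^ 2 + 1) ^ suc m ≤ 2 ^ (n * suc (n * n))
  base-power {m} le = begin
    (4 * n ^ 2 + 1) ^ suc m  ≤⟨ ℕ.^-monoˡ-≤ (suc m) (quadratic≤2^ n (ℕ.≤-trans (ℕ.≤ᵇ⇒≤ 9 131072 tt) large)) ⟩
    (2 ^ n) ^ suc m          ≡⟨ ℕ.^-*-assoc 2 n (suc m) ⟩
    2 ^ (n * suc m)          ≤⟨ ℕ.^-monoʳ-≤ 2 (ℕ.*-monoʳ-≤ n (s≤s le)) ⟩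
    2 ^ (n * suc (n * n))    ∎

  -- Four blocks with two edges each, from at most `n * n` edges, give the power 16; 16384 is the
  -- least power of two above 14641, the fourth power of the 11 in `walk-count`.
  capacity : ℕ
  capacity = n ^ 16 * 16384

  -- By `base-power` each numeral has at most `n * suc (n * n)` bits. Bounding the successor by
  -- `n * n * 2` doubles 16384 to 32768.
  bits : ∀ {k} → k ≤ capacity → n * suc (n * n) * k < suc (n ^ 19 * 32768)
  bits {k} le = s≤s (begin
    n * suc (n * n) * k                 ≤⟨ ℕ.*-mono-≤ (ℕ.*-monoʳ-≤ n suc≤) le ⟩
    n * (n * n * 2) * (n ^ 16 * 16384)  ≡⟨ cong (_* (n ^ 16 * 16384)) (cube n) ⟩
    n ^ 3 * 2 * (n ^ 16 * 16384)        ≡⟨ shuffle (n ^ 3) (n ^ 16) 2 16384 ⟩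
    n ^ 3 * n ^ 16 * (2 * 16384)        ≡⟨ cong (_* 32768) (ℕ.^-distribˡ-+-* n 3 16) ⟨
    n ^ 19 * 32768                      ∎)
    where
    cube : ∀ n → n * (n * n * 2) ≡ n * (n * (n * 1)) * 2
    cube = solve-ℕ
    shuffle : ∀ a b c d → a * c * (b * d) ≡ a * b * (c * d)
    shuffle = solve-ℕ
    suc≤ : suc (n * n) ≤ n * n * 2
    suc≤ = ℕ.≤-trans (ℕ.+-monoˡ-≤ (n * n) 1≤n²) (ℕ.≤-reflexive (trans (cong (n * n +_) (sym (ℕ.+-identityʳ _))) (ℕ.*-comm 2 (n * n))))

  -- Absorbing the successors costs another factor 2, and four times 32768 is 131072, the lower
  -- bound for `n`.
  range : suc (n ^ 19 * 32768) + suc (n ^ 19 * 32768) ≤ n ^ 20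
  range = begin
    suc X + suc X              ≤⟨ ℕ.+-mono-≤ dbl dbl ⟩
    (X + X) + (X + X)          ≡⟨ collect (n ^ 19) 32768 ⟩
    n ^ 19 * (32768 + 32768 + (32768 + 32768))  ≤⟨ ℕ.*-monoʳ-≤ (n ^ 19) large ⟩
    n ^ 19 * n                 ≡⟨ ℕ.*-comm (n ^ 19) n ⟩
    n ^ 20                     ∎
    where
    X = n ^ 19 * 32768
    dbl : suc X ≤ X + X
    dbl = ℕ.+-monoˡ-≤ X (ℕ.*-mono-≤ (ℕ.m^n>0 n 19) (s≤s z≤n))
    collect : ∀ a c → (a * c + a * c) + (a * c + a * c) ≡ a * (c + c + (c + c))
    collect = solve-ℕ

  walk-count : ∀ {m} → m ≤ n * n → (1 + (m * 2 + (m * 2) * ((m * 2) * 2))) ^ 4 ≤ capacity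
  walk-count {m} le = begin
    (1 + (m * 2 + (m * 2) * ((m * 2) * 2))) ^ 4  ≤⟨ ℕ.^-monoˡ-≤ 4 one ⟩
    (n ^ 4 * 11) ^ 4                             ≡⟨ fourth (n ^ 4) 11 ⟩
    (n ^ 4) ^ 4 * 14641                          ≡⟨ cong (_* 14641) (ℕ.^-*-assoc n 4 4) ⟩
    n ^ 16 * 14641                               ≤⟨ ℕ.*-monoʳ-≤ (n ^ 16) (ℕ.≤ᵇ⇒≤ 14641 16384 tt) ⟩
    capacity                                     ∎
    where
    p = n * n
    fourth : ∀ a b → (a * b) * ((a * b) * ((a * b) * ((a * b) * 1))) ≡ (a * (a * (a * (a * 1)))) * (b * (b * (b * (b * 1))))
    fourth = solve-ℕ
    p² : p ≤ p * p
    p² = ℕ.m≤m*n p p {{ℕ.>-nonZero 1≤n²}}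
    sum-up : ∀ p → p * p + (p * p * 2 + (p * 2) * ((p * 2) * 2)) ≡ p * p * 11
    sum-up = solve-ℕ
    square : ∀ n → (n * n) * (n * n) * 11 ≡ n * (n * (n * (n * 1))) * 11
    square = solve-ℕ
    one : 1 + (m * 2 + (m * 2) * ((m * 2) * 2)) ≤ n ^ 4 * 11
    one = begin
      1 + (m * 2 + (m * 2) * ((m * 2) * 2))       ≤⟨ ℕ.+-mono-≤ (ℕ.*-mono-≤ 1≤n² 1≤n²) (ℕ.+-mono-≤ (ℕ.*-monoˡ-≤ 2 (ℕ.≤-trans le p²)) (ℕ.*-mono-≤ m2 (ℕ.*-monoˡ-≤ 2 m2))) ⟩
      p * p + (p * p * 2 + (p * 2) * ((p * 2) * 2)) ≡⟨ sum-up p ⟩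
      p * p * 11                                  ≡⟨ square n ⟩
      n ^ 4 * 11                                  ∎
      where
      m2 : m * 2 ≤ p * 2
      m2 = ℕ.*-monoˡ-≤ 2 le

  chain-count : ∀ {m l} → m ≤ n * n → l ≤ n →
    n * (suc (l + l) * (suc (l + l) * (suc m * (suc m * (suc m * suc m))))) ≤ capacity
  chain-count {m} {l} le l≤n = begin
    n * (suc (l + l) * (suc (l + l) * (suc m * (suc m * (suc m * suc m)))))
      ≤⟨ ℕ.*-monoʳ-≤ n (ℕ.*-mono-≤ L (ℕ.*-mono-≤ L (ℕ.*-mono-≤ E (ℕ.*-mono-≤ E (ℕ.*-mono-≤ E E))))) ⟩
    n * (n * 3 * (n * 3 * (n * n * 2 * (n * n * 2 * (n * n * 2 * (n * n * 2))))))
      ≡⟨ collect n ⟩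
    n ^ 11 * 144 ≤⟨ ℕ.*-mono-≤ (ℕ.^-monoʳ-≤ n (ℕ.≤ᵇ⇒≤ 11 16 tt)) (ℕ.≤ᵇ⇒≤ 144 16384 tt) ⟩
    capacity ∎
    where
    collect : ∀ n → n * (n * 3 * (n * 3 * (n * n * 2 * (n * n * 2 * (n * n * 2 * (n * n * 2))))))
                  ≡ n * (n * (n * (n * (n * (n * (n * (n * (n * (n * (n * 1)))))))))) * 144
    collect = solve-ℕ
    L : suc (l + l) ≤ n * 3
    L = ℕ.≤-trans (ℕ.+-mono-≤ 1≤n (ℕ.+-mono-≤ l≤n l≤n)) (ℕ.≤-reflexive (three n))
      where
      three : ∀ n → n + (n + n) ≡ n * 3
      three = solve-ℕ
    E : suc m ≤ n * n * 2
    E = ℕ.≤-trans (ℕ.+-mono-≤ 1≤n² le) (ℕ.≤-reflexive (two (n * n)))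
      where
      two : ∀ p → p + p ≡ p * 2
      two = solve-ℕ

-- The iterated weight functions

opaque
  unfolding ΣN.∑
  sumFin≡∑ : ∀ {k} (f : Fin k → ℕ) → sumFin f ≡ ∑ℕ f
  sumFin≡∑ {zero} f = refl
  sumFin≡∑ {suc k} f = cong (f zero +_) (sumFin≡∑ (f ∘ suc))

module Main {n : ℕ} (G : Graph n) (large : 131072 ≤ n) where

  open Large n large

  E : Set
  E = Fin (m G)

  s t : E → Fin n
  s e = proj₁ (ends G e)
  t e = proj₂ (ends G e)

  Γ : Multigraph n (m G)
  Γ = record { s = s ; t = t ; s≢t = loopless G }

  open Matchings Γ
  open Faces Γ using (Min; Min-exists; Min-wt; Tight; Supported; orthogonal; full)
  open Duality Γ using (⟪_,_⟫)
  open Laminar Γ using (Kills; module Kills; Inv; initial; final)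
  open Chains Γ using (SegmentsOf; base-step; double-step)
  open StepC Γ using (refine-step)

  edges≤n² : m G ≤ n * n
  edges≤n² = injective⇒≤ {f = λ e → Fin.combine (s e) (t e)} λ {e} {e′} p →
    noMulti G e e′ (inj₁ (combine-injective (s e) (t e) (s e′) (t e′) p))

  extendW : ℕ → (E → ℕ) → E → ℕ
  extendW k W e = n ^ 21 * W e + wk n k e

  module Concatenation (W : E → ℕ) (k : ℕ) (valid : ValidModulus n k) where

    x : E → ℕ
    x = wk n k

    W′ : E → ℕ
    W′ = extendW k W

    wk≤ : ∀ k (e : E) → wk n k e ≤ k
    wk≤ zero e = z≤n
    wk≤ (suc k) e = ℕ.<⇒≤ (m%n<n ((4 * n ^ 2 + 1) ^ (toℕ e + 1)) (suc k))

    wt-W′ : ∀ M → wt W′ M ≡ n ^ 21 * wt W M + wt x M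
    wt-W′ M = trans (wt-+ (λ e → n ^ 21 * W e) x M (λ e _ → refl)) (cong (_+ wt x M)
      (trans (ΣN.∑-cong (λ e → swap-factor (χℕ (M e)) (n ^ 21) (W e))) (ΣN.∑-* (n ^ 21) (λ e → χℕ (M e) * W e))))
      where
      swap-factor : ∀ a b c → a * (b * c) ≡ b * (a * c)
      swap-factor a b c = trans (sym (ℕ.*-assoc a b c)) (trans (cong (_* c) (ℕ.*-comm a b)) (ℕ.*-assoc b a c))

    -- Fewer than `n` edges weigh at most `n ^ 20` each. So the factor `n ^ 21` makes concatenation
    -- lexicographic.
    wt-small : ∀ {M} → PM M → wt x M < n ^ 21
    wt-small {M} pM = begin-strict
      wt x M ≤⟨ ∑ℕ-mono (λ e → ℕ.≤-trans (ℕ.*-monoʳ-≤ (χℕ (M e)) (ℕ.≤-trans (wk≤ k e) (proj₂ valid)))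
                   (ℕ.≤-reflexive (trans (ℕ.*-comm (χℕ (M e)) (n ^ 20)) (cong (n ^ 20 *_) (sym (ℕ.*-identityʳ _)))))) ⟩
      ∑ℕ (λ e → n ^ 20 * (χℕ (M e) * 1)) ≡⟨ ΣN.∑-* (n ^ 20) _ ⟩
      n ^ 20 * inM M full <⟨ ℕ.*-monoʳ-< (n ^ 20) {{ℕ.m^n≢0 n 20}} few ⟩
      n ^ 20 * n ≡⟨ ℕ.*-comm (n ^ 20) n ⟩
      n ^ 21 ∎
      where
      open ℕ.≤-Reasoning
      few : inM M full < n
      few with inM M full | ℕ.≤-trans (in≤ (proj₁ pM) full) (cnt≤k full)
      ... | zero | _ = 1≤n
      ... | suc a | le = ℕ.≤-trans (s≤s (ℕ.≤-trans (s≤s (ℕ.m≤m+n a a)) (ℕ.≤-reflexive (sym (ℕ.+-suc a a))))) le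

    sub : ∀ {M} → Min W′ M → Min W M
    sub {M} (pM , hM) = pM , λ N pN → ℕ.≮⇒≥ λ lt → ℕ.<⇒≱ (smaller N pN lt) (hM N pN)
      where
      smaller : ∀ N → PM N → wt W N < wt W M → wt W′ N < wt W′ M
      smaller N pN lt = begin-strict
        wt W′ N ≡⟨ wt-W′ N ⟩
        n ^ 21 * wt W N + wt x N <⟨ ℕ.+-monoʳ-< (n ^ 21 * wt W N) (wt-small pN) ⟩
        n ^ 21 * wt W N + n ^ 21 ≡⟨ trans (ℕ.+-comm _ (n ^ 21)) (sym (ℕ.*-suc (n ^ 21) (wt W N))) ⟩
        n ^ 21 * suc (wt W N) ≤⟨ ℕ.*-monoʳ-≤ (n ^ 21) lt ⟩
        n ^ 21 * wt W M ≤⟨ ℕ.m≤m+n _ (wt x M) ⟩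
        n ^ 21 * wt W M + wt x M ≡⟨ wt-W′ M ⟨
        wt W′ M ∎
        where open ℕ.≤-Reasoning

    same-weight : ∀ {M N} → Min W′ M → Min W′ N → wt x M ≡ wt x N
    same-weight {M} {N} mM mN = ℕ.+-cancelˡ-≡ (n ^ 21 * wt W M) _ _ (trans (sym (wt-W′ M)) (trans (Min-wt mM mN)
      (trans (wt-W′ N) (cong (λ z → n ^ 21 * z + wt x N) (sym (Min-wt (sub mM) (sub mN)))))))

    vector : (E → ℤ) → ℤ
    vector c = ∑ℤ (λ e → c e ℤ.* ℤ.+ x e)

    wtℤ : ∀ M → ∑ℤ (λ e → χℤ (M e) ℤ.* ℤ.+ x e) ≡ ℤ.+ wt x M
    wtℤ M = trans (ΣZ.∑-cong λ e → trans (cong (ℤ._* ℤ.+ x e) (χℤ-ℕ (M e))) (sym (ℤ.pos-* (χℕ (M e)) (x e)))) (∑ℤ-ℕ (λ e → χℕ (M e) * x e))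

    vector-diff : ∀ {M N} → Min W′ M → Min W′ N → ∀ {c} → (∀ g → c g ≡ χℤ (N g) - χℤ (M g)) → vector c ≡ 0ℤ
    vector-diff {M} {N} mM mN {c} h = begin
      vector c ≡⟨ ΣZ.∑-cong (λ e → trans (cong (ℤ._* ℤ.+ x e) (h e)) (dist (χℤ (N e)) (χℤ (M e)) (ℤ.+ x e))) ⟩
      ∑ℤ (λ e → χℤ (N e) ℤ.* ℤ.+ x e - χℤ (M e) ℤ.* ℤ.+ x e) ≡⟨ ∑ℤ-minus _ _ ⟩
      ∑ℤ (λ e → χℤ (N e) ℤ.* ℤ.+ x e) - ∑ℤ (λ e → χℤ (M e) ℤ.* ℤ.+ x e) ≡⟨ cong₂ _-_ (wtℤ N) (wtℤ M) ⟩
      ℤ.+ wt x N - ℤ.+ wt x M ≡⟨ ℤ.i≡j⇒i-j≡0 (cong ℤ.+_ (same-weight mN mM)) ⟩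
      0ℤ ∎
      where
      open ≡-Reasoning
      dist : ∀ x y z → (x - y) ℤ.* z ≡ x ℤ.* z - y ℤ.* z
      dist x y z = trans (ℤ.*-distribʳ-+ z x (ℤ.- y)) (cong (λ w → x ℤ.* z ℤ.+ w) (sym (ℤ.neg-distribˡ-* y z)))

    -- The new face lies in the old one, so sets tight for `W` are tight for `W′`, and duality makes
    -- both weights orthogonal to `c`; the added summand is then orthogonal too.
    vector-ortho : ∀ {c} → Supported W′ c → (∀ S → Tight W′ S → HZ.cut c S ≡ 0ℤ) → vector c ≡ 0ℤ
    vector-ortho {c} supp bal = begin
      vector c ≡⟨ ΣZ.∑-cong (λ e → ℤ.*-comm (c e) (ℤ.+ x e)) ⟩
      ⟪ x , c ⟫ ≡⟨ ℤ.+-identityˡ _ ⟨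
      0ℤ ℤ.+ ⟪ x , c ⟫ ≡⟨ cong (ℤ._+ ⟪ x , c ⟫) (trans (cong (ℤ.+ (n ^ 21) ℤ.*_) coarse) (ℤ.*-zeroʳ (ℤ.+ (n ^ 21)))) ⟨
      ℤ.+ (n ^ 21) ℤ.* ⟪ W , c ⟫ ℤ.+ ⟪ x , c ⟫ ≡⟨ cong (ℤ._+ ⟪ x , c ⟫) (ΣZ.∑-* (ℤ.+ (n ^ 21)) (λ e → ℤ.+ W e ℤ.* c e)) ⟨
      ∑ℤ (λ e → ℤ.+ (n ^ 21) ℤ.* (ℤ.+ W e ℤ.* c e)) ℤ.+ ⟪ x , c ⟫ ≡⟨ ΣZ.∑-+ _ _ ⟨
      ∑ℤ (λ e → ℤ.+ (n ^ 21) ℤ.* (ℤ.+ W e ℤ.* c e) ℤ.+ ℤ.+ x e ℤ.* c e) ≡⟨ ΣZ.∑-cong pt ⟨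
      ⟪ W′ , c ⟫ ≡⟨ orthogonal W′ c supp bal ⟩
      0ℤ ∎
      where
      open ≡-Reasoning
      coarse : ⟪ W , c ⟫ ≡ 0ℤ
      coarse = orthogonal W c (λ e ne → let M , mM , Me = supp e ne in M , sub mM , Me) (λ S tS → bal S (λ M mM → tS M (sub mM)))
      pt : ∀ e → ℤ.+ W′ e ℤ.* c e ≡ ℤ.+ (n ^ 21) ℤ.* (ℤ.+ W e ℤ.* c e) ℤ.+ ℤ.+ x e ℤ.* c e
      pt e = trans (ℤ.*-distribʳ-+ (c e) (ℤ.+ (n ^ 21 * W e)) (ℤ.+ x e)) (cong (ℤ._+ (ℤ.+ x e ℤ.* c e))
        (trans (cong (ℤ._* c e) (ℤ.pos-* (n ^ 21) (W e))) (ℤ.*-assoc (ℤ.+ (n ^ 21)) (ℤ.+ W e) (c e))))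

  opaque
    kill : ∀ W (Z : List (E → ℤ)) → length Z ≤ capacity → (∀ {c} → c ∈ Z → ∀ e → ∣ c e ∣ ≤ 4 * n ^ 2) →
           ∃ λ k → ValidModulus n k × Kills W (extendW k W) Z
    kill W Z few small =
      let k , k≥2 , k≤ , sep = Horner.separating-modulus (4 * n ^ 2 + 1) (n * suc (n * n)) (suc (n ^ 19 * 32768)) (n ^ 20) Z
            (ℕ.m≤n+m 1 (4 * n ^ 2)) (λ c∈ e → ℕ.≤-trans (s≤s (small c∈ e)) (ℕ.≤-reflexive (ℕ.+-comm 1 (4 * n ^ 2))))
            (base-power edges≤n²) (bits few) range
          module C = Concatenation W (suc k) (k≥2 , k≤)
      in suc k , (k≥2 , k≤) , record
           { sub = C.sub
           ; diff = λ {c} c∈ mM mN h → sep c∈ (C.vector-diff mM mN {c} h)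
           ; ortho = λ {c} c∈ supp bal → sep c∈ (C.vector-ortho {c} supp bal) }

  -- A representing walk has four blocks of at most `2 + l` edges, so its entries are digits in base
  -- `4 * n ^ 2 + 1`.
  small-bound : ∀ {l} → l ≤ n → 4 * (2 + l) ≤ 4 * n ^ 2
  small-bound le = ℕ.*-monoʳ-≤ 4 (ℕ.≤-trans (ℕ.+-monoʳ-≤ 2 le) (ℕ.≤-trans 2+n≤n² (ℕ.≤-reflexive (cong (n *_) (sym (ℕ.*-identityʳ n))))))

  double^ : ℕ → ℕ → ℕ
  double^ zero d = d
  double^ (suc c) d = double^ c (d + d)

  double^-2^ : ∀ c d → double^ c d ≡ 2 ^ c * d
  double^-2^ zero d = sym (ℕ.+-identityʳ d)
  double^-2^ (suc c) d = trans (double^-2^ c (d + d)) (rearr (2 ^ c) d)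
    where
    rearr : ∀ p d → p * (d + d) ≡ (p + (p + 0)) * d
    rearr p d = trans (ℕ.*-distribˡ-+ p d d) (trans (sym (ℕ.*-distribʳ-+ d p p)) (cong (λ z → (p + z) * d) (sym (ℕ.+-identityʳ p))))

  module Phase (pm : ∃ PM) {l : ℕ} (l≤n : l ≤ n) {W₀ : E → ℕ} (inv : Inv W₀ l) where

    Outcome : (E → ℕ) → ℕ → Set
    Outcome W k = ∃ λ ks → length ks ≡ k × All (ValidModulus n) ks × Inv (concatW n W ks) (l + l)

    prepend : ∀ {W k c} → ValidModulus n k → Outcome (extendW k W) c → Outcome W (suc c)
    prepend {k = k} valid (ks , len , valids , inv) = k ∷ ks , cong suc len , valid ∷ valids , inv

    step : ∀ W {c b} Z → length Z ≤ capacity → (∀ {v} → v ∈ Z → ∀ e → ∣ v e ∣ ≤ b) → b ≤ 4 * n ^ 2 →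
           (∀ {W′} → Kills W W′ Z → Outcome W′ c) → Outcome W (suc c)
    step W {c} Z few bound le next = conclude (kill W Z few (λ v∈ e → ℕ.≤-trans (bound v∈ e) le))
      where
      conclude : (∃ λ k → ValidModulus n k × Kills W (extendW k W) Z) → Outcome W (suc c)
      conclude (k , valid , K) = prepend valid (next K)

    finish : ∀ W → (∀ {M} → Min W M → Min W₀ M) → SegmentsOf inv W l → Outcome W 1
    finish W sub seg =
      let Z , len , bound , refine = refine-step inv W sub seg
      in step W Z (ℕ.≤-trans (ℕ.≤-reflexive len) (walk-count edges≤n²)) bound (small-bound l≤n) (λ K → [] , refl , [] , refine K pm)

    doubling : ∀ c d → double^ c d ≡ l → ∀ W → (∀ {M} → Min W M → Min W₀ M) → SegmentsOf inv W d → Outcome W (suc c)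
    doubling zero d eq W sub seg = finish W sub (subst (SegmentsOf inv W) eq seg)
    doubling (suc c) d eq W sub seg =
      let Z , len , bound , double = double-step inv W sub d
      in step W Z (ℕ.≤-trans (ℕ.≤-reflexive len) (chain-count edges≤n² l≤n)) bound (ℕ.≤-trans (s≤s z≤n) (small-bound {0} z≤n))
           (λ {W′} K → doubling c (d + d) eq W′ (λ mM → sub (Kills.sub K mM)) (double seg K))

    -- One modulus for the shortest segments, `c` for doubling their length up to `l`, one for the
    -- walks.
    phase : ∀ c → double^ c 1 ≡ l → Outcome W₀ (2 + c)
    phase c eq =
      let Z , len , bound , base = base-step inv
      in step W₀ Z (ℕ.≤-trans (ℕ.≤-reflexive len) (walk-count edges≤n²)) bound (small-bound l≤n)
           (λ {W′} K → doubling c 1 eq W′ (Kills.sub K) (base K))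

  concat-++ : ∀ W xs ys → concatW n W (xs ++ ys) ≡ concatW n {m G} (concatW n W xs) ys
  concat-++ W [] ys = refl
  concat-++ W (x ∷ xs) ys = concat-++ (extendW x W) xs ys

  -- The phase at level `2 ^ i` uses `2 + i` moduli, and `i` stays below the logarithm; the level
  -- stays below `n` until the last doubling, as the numerical bounds demand.
  phases : ∃ PM → ∀ c i → i + c ≡ ⌈log₂ n ⌉ → ∀ W → Inv W (2 ^ i) →
    ∃ λ ks → length ks ≤ c * (⌈log₂ n ⌉ + 1) × All (ValidModulus n) ks × Inv (concatW n W ks) (2 ^ ⌈log₂ n ⌉)
  phases pm zero i eq W inv = [] , z≤n , [] , subst (λ z → Inv W (2 ^ z)) (trans (sym (ℕ.+-identityʳ i)) eq) inv
  phases pm (suc c) i eq W inv =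
    let i<L = ℕ.≤-trans (s≤s (ℕ.m≤m+n i c)) (ℕ.≤-reflexive (trans (sym (ℕ.+-suc i c)) eq))
        l≤n = ℕ.<⇒≤ (2^<⌈log₂⌉ {i} {n} i<L)
        ks , len , valid , inv′ = Phase.phase pm l≤n inv i (trans (double^-2^ i 1) (ℕ.*-identityʳ (2 ^ i)))
        ks′ , len′ , valid′ , inv″ = phases pm c (suc i) (trans (sym (ℕ.+-suc i c)) eq) (concatW n W ks)
                                       (subst (Inv (concatW n W ks)) (cong (2 ^ i +_) (sym (ℕ.+-identityʳ (2 ^ i)))) inv′)
    in ks ++ ks′
     , ℕ.≤-trans (ℕ.≤-reflexive (length-++ ks)) (ℕ.+-mono-≤ (ℕ.≤-trans (ℕ.≤-reflexive len) (ℕ.≤-trans (s≤s i<L) (ℕ.≤-reflexive (ℕ.+-comm 1 _)))) len′)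
     , ++⁺ valid valid′
     , subst (λ w → Inv w (2 ^ ⌈log₂ n ⌉)) (sym (concat-++ W ks ks′)) inv″

  Unique : (E → ℕ) → Set
  Unique W = ∀ {M N} → Min W M → Min W N → M ≗ N

  unique-concat : ∀ W ks → All (ValidModulus n) ks → Unique W → Unique (concatW n W ks)
  unique-concat W [] [] u = u
  unique-concat W (k ∷ ks) (v ∷ vs) u = unique-concat (extendW k W) ks vs (λ mM mN → u (Concatenation.sub W k v mM) (Concatenation.sub W k v mN))

  isolating : ∃ PM → ∀ W → ∃ λ ks → length ks ≡ (⌈log₂ n ⌉ + 1) * ⌈log₂ n ⌉ × All (ValidModulus n) ks × Unique (concatW n W ks)
  isolating pm W =
    let ks , len , valid , inv = phases pm ⌈log₂ n ⌉ 0 refl W (initial W)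
        len″ = ℕ.≤-trans len (ℕ.≤-reflexive (ℕ.*-comm ⌈log₂ n ⌉ (⌈log₂ n ⌉ + 1)))
        r , eq = ℕ.m≤n⇒∃[o]m+o≡n len″
        -- The early phases need fewer moduli than allotted. Further concatenation only shrinks the
        -- face, so the valid modulus 2 fills up to the exact number.
        pad = replicate r 2
        valid-pad = replicate⁺ {x = 2} r (ℕ.≤-refl , ℕ.≤-trans 2≤n (ℕ.m≤m*n n (n ^ 19) {{ℕ.m^n≢0 n 19}}))
    in ks ++ pad
     , trans (length-++ ks) (trans (cong (length ks +_) (length-replicate r)) eq)
     , ++⁺ valid valid-pad
     , subst (λ w → Unique w) (sym (concat-++ W ks pad)) (unique-concat (concatW n W ks) pad valid-pad (final inv (≤2^⌈log₂⌉ n)))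
    where
    2≤n : 2 ≤ n
    2≤n = ℕ.≤-trans (s≤s (s≤s z≤n)) large

  -- Translation to the matchings of the given graph

  incident-true : ∀ {v e} → incident G v e ≡ true → v ∈ₑ e
  incident-true {v} {e} p with ∨-true {⌊ v ≟ s e ⌋} p
  ... | inj₁ q = inj₁ (sym (≟-true q))
  ... | inj₂ q = inj₂ (sym (≟-true q))

  incident-intro : ∀ {v e} → v ∈ₑ e → incident G v e ≡ true
  incident-intro {v} {e} (inj₁ refl) = ∨-introˡ (≟-refl v)
  incident-intro {v} {e} (inj₂ refl) = ∨-introʳ {⌊ v ≟ s e ⌋} (≟-refl v)

  deg-cnt : ∀ (V : EdgeSet G) v → degIn G V v ≡ cnt (λ e → lookup V e ∧ incident G v e)
  deg-cnt V v = trans (sumFin≡∑ _) (ΣN.∑-cong λ e → if-χ (lookup V e ∧ incident G v e))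
    where
    if-χ : ∀ b → (if b then 1 else 0) ≡ χℕ b
    if-χ true = refl
    if-χ false = refl

  weight-wt : ∀ w (V : EdgeSet G) → weight G w V ≡ wt w (lookup V)
  weight-wt w V = trans (sumFin≡∑ _) (ΣN.∑-cong λ e → if-χ (lookup V e) (w e))
    where
    if-χ : ∀ b x → (if b then x else 0) ≡ χℕ b * x
    if-χ true x = sym (ℕ.+-identityʳ x)
    if-χ false x = refl

  to-PM : ∀ V → IsPerfectMatching G V → PM (lookup V)
  to-PM V h = mat , cov
    where
    deg : ∀ v → cnt (λ e → lookup V e ∧ incident G v e) ≡ 1
    deg v = trans (sym (deg-cnt V v)) (h v)
    mat : Mat (lookup V)
    mat v e f p q ve vf = cnt≤1→unique _ (ℕ.≤-reflexive (deg v)) (∧-intro p (incident-intro ve)) (∧-intro q (incident-intro vf))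
    cov : ∀ v → Cov (lookup V) v
    cov v = let e , p = cnt-exists _ (ℕ.≤-reflexive (sym (deg v))) in e , proj₁ (∧-true p) , incident-true (proj₂ (∧-true {lookup V e} p))

  from-PM : ∀ V → PM (lookup V) → IsPerfectMatching G V
  from-PM V (mat , cov) v = trans (deg-cnt V v) (let e , p , q = cov v in cnt≡1 _ e (∧-intro p (incident-intro q))
    λ {e} {f} a b → mat v e f (proj₁ (∧-true a)) (proj₁ (∧-true b)) (incident-true (proj₂ (∧-true {lookup V e} a))) (incident-true (proj₂ (∧-true {lookup V f} b))))

  concat-cong : ∀ {w w′ : E → ℕ} → w ≗ w′ → ∀ ks → concatW n w ks ≗ concatW n w′ ks
  concat-cong eq [] = eq
  concat-cong eq (k ∷ ks) = concat-cong (λ e → cong (λ z → n ^ 21 * z + wk n k e) (eq e)) ks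

  unique-min : ∃ PM → ∀ {w} → Unique w → UniqueMinPM G w
  unique-min pm {w} u =
    let M , (pM , hM) = Min-exists w pm
        V = tabulate M
        V≗M = lookup∘tabulate M
        pV = PM-resp (sym ∘ V≗M) pM
        wV = wt-resp w V≗M
        least : ∀ M′ → PM M′ → wt w (lookup V) ≤ wt w M′
        least M′ p = ℕ.≤-trans (ℕ.≤-reflexive wV) (hM M′ p)
    in V , from-PM V pV
     , (λ V′ p → subst (λ z → weight G w V ≤ z) (sym (weight-wt w V′)) (subst (λ z → z ≤ wt w (lookup V′)) (sym (weight-wt w V)) (least (lookup V′) (to-PM V′ p))))
     , λ V′ p le → trans (sym (tabulate∘lookup V′)) (tabulate-cong (u
         (to-PM V′ p , λ N pN → ℕ.≤-trans (ℕ.≤-trans (ℕ.≤-reflexive (sym (weight-wt w V′))) (ℕ.≤-trans le (ℕ.≤-reflexive (weight-wt w V)))) (least N pN))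
         (pM , hM)))

  isolated : Σ (EdgeSet G) (IsPerfectMatching G) → Σ ℕ λ k₀ → Σ (List ℕ) λ ks →
    ValidModulus n k₀ × All (ValidModulus n) ks × 1 + length ks ≡ (⌈log₂ n ⌉ + 1) * ⌈log₂ n ⌉ × UniqueMinPM G (iterW n k₀ ks)
  isolated (V , p) = go (isolating pm (λ _ → 0))
    where
    pm : ∃ PM
    pm = lookup V , to-PM V p
    0<L : 0 < ⌈log₂ n ⌉
    0<L = ℕ.n≢0⇒n>0 λ z → ℕ.<⇒≱ (ℕ.≤-trans (s≤s (s≤s z≤n)) large) (subst (λ k → n ≤ 2 ^ k) z (≤2^⌈log₂⌉ n))
    go : (∃ λ ks → length ks ≡ (⌈log₂ n ⌉ + 1) * ⌈log₂ n ⌉ × All (ValidModulus n) ks × Unique (concatW n (λ _ → 0) ks)) → _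
    go ([] , len , _ , _) = ⊥-elim (ℕ.<⇒≢ (ℕ.*-mono-≤ (ℕ.m≤n+m 1 ⌈log₂ n ⌉) 0<L) len)
    go (k ∷ ks , len , v ∷ vs , u) = k , ks , v , vs , len , unique-min pm (λ mM mN → u (transport mM) (transport mN))
      where
      eq : iterW n k ks ≗ concatW n (λ _ → 0) (k ∷ ks)
      -- Starting from weight 0, the first concatenation yields `wk n k` up to the summand
      -- `n ^ 21 * 0`.
      eq = concat-cong (λ e → cong (_+ wk n k e) (sym (ℕ.*-zeroʳ (n ^ 21)))) ks
      wt-eq : ∀ M → wt (iterW n k ks) M ≡ wt (concatW n (λ _ → 0) (k ∷ ks)) M
      wt-eq M = ΣN.∑-cong (λ e → cong (χℕ (M e) *_) (eq e))
      transport : ∀ {M} → Min (iterW n k ks) M → Min (concatW n (λ _ → 0) (k ∷ ks)) M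
      transport {M} (a , b) = a , λ N pN → ℕ.≤-trans (ℕ.≤-reflexive (sym (wt-eq M))) (ℕ.≤-trans (b N pN) (ℕ.≤-reflexive (wt-eq N)))

theorem4p11 : Σ ℕ (λ N → (n : ℕ) → n ≥ N → (G : Graph n) →
    Σ (EdgeSet G) (IsPerfectMatching G) →
    Σ ℕ (λ k₀ → Σ (List ℕ) (λ ks →
    ValidModulus n k₀ × All (ValidModulus n) ks ×
    1 + length ks ≡ (⌈log₂ n ⌉ + 1) * ⌈log₂ n ⌉ ×
    UniqueMinPM G (iterW n k₀ ks))))
theorem4p11 = 131072 , λ n large G pm → Main.isolated G large pm
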